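{- Let $\phi_1,\dots,\phi_n,\psi_1,\dots,\psi_m$ be Drinfeld modules over $K$ with $\operatorname{rk}\phi_i>\operatorname{rk}\psi_j$ for all $i,j$. Then $\operatorname{Ext}^1_\tau\big(\prod_{i=1}^n\phi_i,\prod_{j=1}^m\psi_j\big)$ has a natural structure of a $\mathbf t$-module, i.e. there is a $\mathbf t$-module $\Pi:\mathbb F_q[t]\to\mathrm{Mat}_{m\sum_i\operatorname{rk}\phi_i}(K\{\tau\})$ whose Mordell–Weil $\mathbb F_q[t]$-module is isomorphic to $\operatorname{Ext}^1_\tau\big(\prod_i\phi_i,\prod_j\psi_j\big)$.
   Context: $A=\mathbb F_q[t]$, $K$ a field of characteristic $p$ with $\mathbb F_q$-algebra map $\iota:A\to K$, $\theta=\iota(t)$; $K\{\tau\}$ twisted polynomials, $\tau x=x^q\tau$. A $\mathbf t$-module of dimension $d$: $\mathbb F_q$-algebra homomorphism $\Phi:\mathbb F_q[t]\to\mathrm{Mat}_d(K\{\tau\})$, $\Phi_t=(\theta I+N)+\sum_{i\ge1}M_i\tau^i$, $N$ nilpotent; rank $=\deg_\tau\Phi_t$; Drinfeld module = dimension one. Mordell–Weil module: $K^d$ with $t$ acting by evaluation of $\Phi_t$. The product $\prod_{i=1}^n\phi_i$ is the $n$-dimensional $\mathbf t$-module $a\mapsto\mathrm{diag}(\phi_1(a),\dots,\phi_n(a))$. For $\mathbf t$-modules $\Phi$ (dim $d$), $\Psi$ (dim $e$): $\mathrm{Der}(\Phi,\Psi)$ = $\mathbb F_q$-linear $\delta:\mathbb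 F_q[t]\to\mathrm{Mat}_{e\times d}(K\{\tau\})$ with $\delta(ab)=\Psi_a\delta(b)+\delta(a)\Phi_b$; inner: $\delta^{(U)}(a)=U\Phi_a-\Psi_aU$; $\operatorname{Ext}^1_\tau(\Phi,\Psi)=\mathrm{Der}(\Phi,\Psi)/\mathrm{Der}_{in}(\Phi,\Psi)$ with $a*[\delta]=[\Psi_a\delta]$ (this is the group of extensions of $\Phi$ by $\Psi$). -}

module Defs where

open import Algebra.Bundles
open import Algebra.Bundles.Raw using (RawRing)
open import Algebra.Apartness.Bundles using (HeytingField; HeytingCommutativeRing)
open import Algebra.Module.Bundles using (LeftModule)
open import Algebra.Morphism.Structures using (IsRingHomomorphism)
import Algebra.Definitions.RawMonoid as RawMonoidDefs
import Algebra.Module.Morphism.Structures as ModuleMorphisms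
import Algebra.Morphism.Construct.Identity as Identity
import Algebra.Properties.AbelianGroup as AbelianGroupProperties
import Algebra.Properties.CommutativeSemigroup as CommutativeSemigroupProperties
import Algebra.Properties.CommutativeSemiring.Binomial as Binomial
import Algebra.Properties.CommutativeSemiring.Exp as CommutativeExp
import Algebra.Properties.Group as GroupProperties
import Algebra.Properties.Monoid.Mult as MonoidMult
import Algebra.Properties.Ring as RingProperties
import Algebra.Properties.Semiring.Exp as Exp
import Algebra.Properties.Semiring.Mult as Mult
import Algebra.Properties.Semiring.Sum as SemiringSum
open import Data.Bool.Base using (true; false; if_then_else_)
open import Data.Empty using (⊥-elim)
open import Data.Fin.Base as Fin using (Fin; zero; suc; toℕ; fromℕ; inject₁)
import Data.Fin.Properties as Fin
open import Data.List.Base using (List; []; _∷_; map)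
open import Data.Nat.Base as ℕ using (ℕ; zero; suc; z≤n; s≤s; _!)
open import Data.Nat.Combinatorics using (_C_; nCn≡1; k![n∸k]!∣n!; nCk≡n!/k![n-k]!)
open import Data.Nat.Divisibility using (_∣_; divides; m∣m*n; ∣1⇒≡1; ∣⇒≤)
import Data.Nat.DivMod as ℕ
open import Data.Nat.Primality using (Prime; euclidsLemma; prime⇒nonZero; ¬prime[1])
import Data.Nat.Properties as ℕ
open import Data.Product using (∃-syntax; _×_; _,_; proj₁)
open import Data.Sum.Base using (_⊎_; inj₁; inj₂)
open import Function.Base using (_∘_; id)
open import Function.Bundles using (Inverse; Equivalence; _⇔_)
open import Level using (_⊔_) renaming (suc to lsuc)
open import Relation.Binary.PropositionalEquality as ≡ using (_≡_)
import Relation.Binary.Reasoning.Setoid as SetoidReasoning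
open import Relation.Nullary using (¬_; does)

private
  prime∤! : ∀ {p} → Prime p → ∀ k → k ℕ.< p → ¬ (p ∣ k !)
  prime∤! {p} pr zero    _   p∣1 = ¬prime[1] (≡.subst Prime (∣1⇒≡1 p∣1) pr)
  prime∤! {p} pr (suc k) k<p p∣ with euclidsLemma (suc k) (k !) pr p∣
  ... | inj₁ p∣k = ℕ.<⇒≱ k<p (∣⇒≤ p∣k)
  ... | inj₂ p∣! = prime∤! pr k (ℕ.<-trans (ℕ.n<1+n k) k<p) p∣!

  prime∣C : ∀ {p} → Prime p → ∀ k → 0 ℕ.< k → k ℕ.< p → p ∣ p C k
  prime∣C {zero} pr k 0<k ()
  prime∣C {p@(suc p′)} pr k 0<k k<p
    with euclidsLemma (p C k) (k ! ℕ.* (p ℕ.∸ k) !) pr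
           (≡.subst (p ∣_) (≡.sym C*d≡p!) (m∣m*n (p′ !)))
    where
    instance _ = k ℕ.!* (p ℕ.∸ k) !≢0
    k≤p = ℕ.<⇒≤ k<p
    C*d≡p! : (p C k) ℕ.* (k ! ℕ.* (p ℕ.∸ k) !) ≡ p !
    C*d≡p! = ≡.trans (≡.cong (ℕ._* (k ! ℕ.* (p ℕ.∸ k) !)) (nCk≡n!/k![n-k]! k≤p))
                     (ℕ.m/n*n≡m (k![n∸k]!∣n! k≤p))
  ... | inj₁ h = h
  ... | inj₂ h with euclidsLemma (k !) ((p ℕ.∸ k) !) pr h
  ...   | inj₁ h′ = ⊥-elim (prime∤! pr k k<p h′)
  ...   | inj₂ h′ = ⊥-elim (prime∤! pr (p ℕ.∸ k) (ℕ.∸-monoʳ-< {p} 0<k (ℕ.<⇒≤ k<p)) h′)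

module Characteristic {c ℓ} (R : CommutativeRing c ℓ) where
  open CommutativeRing R hiding (zero)
  open MonoidMult +-monoid using () renaming (_×_ to _·_)
  open Exp semiring using (_^_)

  HasCharacteristic : ℕ → Set ℓ
  HasCharacteristic p = ∀ n → (n · 1# ≈ 0#) ⇔ (p ∣ n)

  private
    module M = Mult semiring
    module E = CommutativeExp commutativeSemiring
    module S = SemiringSum semiring
    open SetoidReasoning setoid

    1^ : ∀ n → 1# ^ n ≈ 1#
    1^ zero    = refl
    1^ (suc n) = trans (*-identityˡ _) (1^ n)

    kill : ∀ {p n} → p · 1# ≈ 0# → p ∣ n → ∀ x → n · x ≈ 0#
    kill {p} {n} p·1≈0 (divides k n≡kp) x = begin
      n · x              ≡⟨ ≡.cong (_· x) n≡kp ⟩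
      (k ℕ.* p) · x      ≈⟨ M.×-assocˡ x k p ⟨
      k · (p · x)        ≈⟨ M.×-congʳ k (M.×-congʳ p (*-identityˡ x)) ⟨
      k · (p · (1# * x)) ≈⟨ M.×-congʳ k (M.×-assoc-* p 1# x) ⟨
      k · (p · 1# * x)   ≈⟨ M.×-congʳ k (*-congʳ p·1≈0) ⟩
      k · (0# * x)       ≈⟨ M.×-congʳ k (zeroˡ x) ⟩
      k · 0#             ≈⟨ S.sum-replicate k ⟨
      _                  ≈⟨ S.sum-replicate-zero k ⟩
      0#                 ∎

    freshman : ∀ p → Prime p → p · 1# ≈ 0# → ∀ x y → (x + y) ^ p ≈ x ^ p + y ^ p
    freshman zero    pr _     x y = ⊥-elim (ℕ.≢-nonZero⁻¹ 0 ⦃ prime⇒nonZero pr ⦄ ≡.refl)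
    freshman (suc n) pr p·1≈0 x y = begin
      (x + y) ^ suc n
        ≈⟨ Binomial.theorem commutativeSemiring (suc n) x y ⟩
      term zero + S.sum (term ∘ suc)
        ≈⟨ +-congˡ (S.sum-init-last (term ∘ suc)) ⟩
      term zero + (S.sum (term ∘ suc ∘ inject₁) + term (suc (fromℕ n)))
        ≈⟨ +-cong first (+-cong middle last) ⟩
      y ^ suc n + (0# + x ^ suc n)
        ≈⟨ +-congˡ (+-identityˡ _) ⟩
      y ^ suc n + x ^ suc n
        ≈⟨ +-comm _ _ ⟩
      x ^ suc n + y ^ suc n ∎
      where
      term = Binomial.binomialTerm commutativeSemiring x y (suc n)
      first : term zero ≈ y ^ suc n
      first = trans (M.×-homo-1 _) (*-identityˡ _)
      last : term (suc (fromℕ n)) ≈ x ^ suc n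
      last rewrite Fin.toℕ-fromℕ n | nCn≡1 (suc n) | ℕ.n∸n≡0 n =
        trans (M.×-homo-1 _) (*-identityʳ _)
      middle : S.sum (term ∘ suc ∘ inject₁) ≈ 0#
      middle = trans
        (S.sum-cong-≋ λ i → kill p·1≈0 (prime∣C pr _ (s≤s z≤n)
          (s≤s (≡.subst (ℕ._< n) (≡.sym (Fin.toℕ-inject₁ i)) (Fin.toℕ<n i)))) _)
        (S.sum-replicate-zero n)

    frobenius-+ : ∀ {p} → Prime p → p · 1# ≈ 0# → ∀ e x y →
                  (x + y) ^ (p ℕ.^ e) ≈ x ^ (p ℕ.^ e) + y ^ (p ℕ.^ e)
    frobenius-+ pr p·1≈0 zero    x y = trans (*-identityʳ _)
      (sym (+-cong (*-identityʳ _) (*-identityʳ _)))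
    frobenius-+ {p} pr p·1≈0 (suc e) x y = begin
      (x + y) ^ (p ℕ.* p ℕ.^ e)                     ≈⟨ E.^-assocʳ _ p _ ⟨
      ((x + y) ^ p) ^ (p ℕ.^ e)                     ≈⟨ E.^-congˡ (p ℕ.^ e) (freshman p pr p·1≈0 x y) ⟩
      (x ^ p + y ^ p) ^ (p ℕ.^ e)                   ≈⟨ frobenius-+ pr p·1≈0 e _ _ ⟩
      (x ^ p) ^ (p ℕ.^ e) + (y ^ p) ^ (p ℕ.^ e)     ≈⟨ +-cong (E.^-assocʳ x p _) (E.^-assocʳ y p _) ⟩
      x ^ (p ℕ.* p ℕ.^ e) + y ^ (p ℕ.* p ℕ.^ e)     ∎

    0^ : ∀ n → .⦃ ℕ.NonZero n ⦄ → 0# ^ n ≈ 0#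
    0^ (suc n) = zeroˡ _

  frobenius-isRingHomomorphism :
    ∀ {p} → Prime p → p · 1# ≈ 0# → ∀ e →
    IsRingHomomorphism rawRing rawRing (_^ (p ℕ.^ e))
  frobenius-isRingHomomorphism {p} pr p·1≈0 e = record
    { isSemiringHomomorphism = record
      { isNearSemiringHomomorphism = record
        { +-isMonoidHomomorphism = record
          { isMagmaHomomorphism = record
            { isRelHomomorphism = record { cong = E.^-congˡ q }
            ; homo = frobenius-+ pr p·1≈0 e }
          ; ε-homo = 0^q }
        ; *-homo = λ x y → E.^-distrib-* x y q }
      ; 1#-homo = 1^ q }
    ; -‿homo = λ x → GroupProperties.inverseˡ-unique +-group _ _
        (trans (sym (frobenius-+ pr p·1≈0 e (- x) x))
          (trans (E.^-congˡ q (-‿inverseˡ x)) 0^q)) }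
    where
    q = p ℕ.^ e
    0^q = 0^ q ⦃ ℕ.m^n≢0 p e ⦃ prime⇒nonZero pr ⦄ ⦄

-- The skew polynomial ring R{τ; σ} with τ a = σ(a) τ.  The list
-- a₀ ∷ a₁ ∷ … ∷ [] stands for a₀ + a₁τ + ⋯, and _≋_ identifies lists that
-- differ by trailing zeros.

module SkewPolynomial {c ℓ} (R : CommutativeRing c ℓ)
  (σ : CommutativeRing.Carrier R → CommutativeRing.Carrier R)
  (σ-hom : IsRingHomomorphism (CommutativeRing.rawRing R) (CommutativeRing.rawRing R) σ)
  where

  open CommutativeRing R hiding (zero)
  private module σ = IsRingHomomorphism σ-hom

  Poly : Set c
  Poly = List Carrier

  coeff : Poly → ℕ → Carrier
  coeff []      k       = 0#
  coeff (a ∷ f) zero    = a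
  coeff (a ∷ f) (suc k) = coeff f k

  infix 4 _≋_
  record _≋_ (f g : Poly) : Set ℓ where
    constructor mk≋
    field coeff-≈ : ∀ k → coeff f k ≈ coeff g k
  open _≋_ public

  infixl 6 _⊕_
  infixl 7 _⊙_ _⊗_

  _⊕_ : Poly → Poly → Poly
  []      ⊕ g       = g
  (a ∷ f) ⊕ []      = a ∷ f
  (a ∷ f) ⊕ (b ∷ g) = (a + b) ∷ (f ⊕ g)

  ⊖_ : Poly → Poly
  ⊖_ = map (-_)

  const : Carrier → Poly
  const a = a ∷ []

  X : Poly
  X = 0# ∷ 1# ∷ []

  _⊙_ : Carrier → Poly → Poly
  a ⊙ f = map (a *_) f

  -- (a + f τ) g = a g + f σ(g) τ
  _⊗_ : Poly → Poly → Poly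
  []      ⊗ g = []
  (a ∷ f) ⊗ g = a ⊙ g ⊕ (0# ∷ (f ⊗ map σ g))

  -- τ acts on R as σ.
  eval : Poly → Carrier → Carrier
  eval []      x = 0#
  eval (a ∷ f) x = a * x + eval f (σ x)

  private
    open SetoidReasoning setoid
    open CommutativeSemigroupProperties +-commutativeSemigroup using (interchange)
    open RingProperties ring using (-0#≈0#)

  Seq : Set c
  Seq = ℕ → Carrier

  conv : Seq → Seq → Seq
  conv f g zero    = f 0 * g 0
  conv f g (suc k) = f 0 * g (suc k) + conv (f ∘ suc) (σ ∘ g) k

  conv-cong : ∀ {f f′ g g′ : Seq} → (∀ k → f k ≈ f′ k) → (∀ k → g k ≈ g′ k) →
              ∀ k → conv f g k ≈ conv f′ g′ k
  conv-cong p q zero    = *-cong (p 0) (q 0)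
  conv-cong p q (suc k) =
    +-cong (*-cong (p 0) (q (suc k))) (conv-cong (p ∘ suc) (σ.⟦⟧-cong ∘ q) k)

  conv-zeroˡ : ∀ (g : Seq) k → conv (λ _ → 0#) g k ≈ 0#
  conv-zeroˡ g zero    = zeroˡ _
  conv-zeroˡ g (suc k) = trans (+-cong (zeroˡ _) (conv-zeroˡ (σ ∘ g) k)) (+-identityˡ _)

  conv-distribʳ : ∀ (h f g : Seq) k →
                  conv (λ k → f k + g k) h k ≈ conv f h k + conv g h k
  conv-distribʳ h f g zero    = distribʳ _ _ _
  conv-distribʳ h f g (suc k) =
    trans (+-cong (distribʳ _ _ _) (conv-distribʳ (σ ∘ h) (f ∘ suc) (g ∘ suc) k))
          (interchange _ _ _ _)

  conv-distribˡ : ∀ (h f g : Seq) k →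
                  conv h (λ k → f k + g k) k ≈ conv h f k + conv h g k
  conv-distribˡ h f g zero    = distribˡ _ _ _
  conv-distribˡ h f g (suc k) =
    trans (+-cong (distribˡ _ _ _)
                  (trans (conv-cong (λ _ → refl) (λ k → σ.+-homo (f k) (g k)) k)
                         (conv-distribˡ (h ∘ suc) (σ ∘ f) (σ ∘ g) k)))
          (interchange _ _ _ _)

  conv-scaleˡ : ∀ a (f g : Seq) k → conv (λ k → a * f k) g k ≈ a * conv f g k
  conv-scaleˡ a f g zero    = *-assoc _ _ _
  conv-scaleˡ a f g (suc k) =
    trans (+-cong (*-assoc _ _ _) (conv-scaleˡ a (f ∘ suc) (σ ∘ g) k))
          (sym (distribˡ _ _ _))

  σ-conv : ∀ (f g : Seq) k → σ (conv f g k) ≈ conv (σ ∘ f) (σ ∘ g) k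
  σ-conv f g zero    = σ.*-homo _ _
  σ-conv f g (suc k) = trans (σ.+-homo _ _)
    (+-cong (σ.*-homo _ _) (σ-conv (f ∘ suc) (σ ∘ g) k))

  conv-assoc : ∀ (f g h : Seq) k → conv (conv f g) h k ≈ conv f (conv g h) k
  conv-assoc f g h zero    = *-assoc _ _ _
  conv-assoc f g h (suc k) = begin
    f 0 * g 0 * h (suc k)
      + conv (λ k → f 0 * g (suc k) + conv (f ∘ suc) (σ ∘ g) k) (σ ∘ h) k
      ≈⟨ +-cong (*-assoc _ _ _) (conv-distribʳ (σ ∘ h) (λ k → f 0 * g (suc k)) _ k) ⟩
    f 0 * (g 0 * h (suc k))
      + (conv (λ k → f 0 * g (suc k)) (σ ∘ h) k
         + conv (conv (f ∘ suc) (σ ∘ g)) (σ ∘ h) k)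
      ≈⟨ +-congˡ (+-cong (conv-scaleˡ (f 0) (g ∘ suc) (σ ∘ h) k)
           (trans (conv-assoc (f ∘ suc) (σ ∘ g) (σ ∘ h) k)
                  (conv-cong (λ _ → refl) (λ k → sym (σ-conv g h k)) k))) ⟩
    f 0 * (g 0 * h (suc k))
      + (f 0 * conv (g ∘ suc) (σ ∘ h) k + conv (f ∘ suc) (σ ∘ conv g h) k)
      ≈⟨ +-assoc _ _ _ ⟨
    f 0 * (g 0 * h (suc k)) + f 0 * conv (g ∘ suc) (σ ∘ h) k
      + conv (f ∘ suc) (σ ∘ conv g h) k
      ≈⟨ +-congʳ (distribˡ _ _ _) ⟨
    f 0 * conv g h (suc k) + conv (f ∘ suc) (σ ∘ conv g h) k ∎

  one : Seq
  one = coeff (const 1#)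

  conv-identityˡ : ∀ (f : Seq) k → conv one f k ≈ f k
  conv-identityˡ f zero    = *-identityˡ _
  conv-identityˡ f (suc k) =
    trans (+-cong (*-identityˡ _) (conv-zeroˡ (σ ∘ f) k)) (+-identityʳ _)

  σ-one : ∀ k → σ (one k) ≈ one k
  σ-one zero    = σ.1#-homo
  σ-one (suc k) = σ.0#-homo

  conv-identityʳ : ∀ (f : Seq) k → conv f one k ≈ f k
  conv-identityʳ f zero    = *-identityʳ _
  conv-identityʳ f (suc k) =
    trans (+-cong (zeroʳ _) (trans (conv-cong (λ _ → refl) σ-one k)
                                   (conv-identityʳ (f ∘ suc) k)))
          (+-identityˡ _)

  coeff-⊕ : ∀ f g k → coeff (f ⊕ g) k ≈ coeff f k + coeff g k
  coeff-⊕ []      g       k       = sym (+-identityˡ _)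
  coeff-⊕ (a ∷ f) []      k       = sym (+-identityʳ _)
  coeff-⊕ (a ∷ f) (b ∷ g) zero    = refl
  coeff-⊕ (a ∷ f) (b ∷ g) (suc k) = coeff-⊕ f g k

  coeff-map : ∀ {h : Carrier → Carrier} → h 0# ≈ 0# →
              ∀ f k → coeff (map h f) k ≈ h (coeff f k)
  coeff-map h0 []      k       = sym h0
  coeff-map h0 (a ∷ f) zero    = refl
  coeff-map h0 (a ∷ f) (suc k) = coeff-map h0 f k

  coeff-⊖ : ∀ f k → coeff (⊖ f) k ≈ - coeff f k
  coeff-⊖ = coeff-map -0#≈0#

  coeff-⊗ : ∀ f g k → coeff (f ⊗ g) k ≈ conv (coeff f) (coeff g) k
  coeff-⊗ []      g k       = sym (conv-zeroˡ (coeff g) k)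
  coeff-⊗ (a ∷ f) g zero    = begin
    coeff (a ⊙ g ⊕ (0# ∷ (f ⊗ map σ g))) 0 ≈⟨ coeff-⊕ (a ⊙ g) _ 0 ⟩
    coeff (a ⊙ g) 0 + 0#                   ≈⟨ +-identityʳ _ ⟩
    coeff (a ⊙ g) 0                        ≈⟨ coeff-map (zeroʳ a) g 0 ⟩
    a * coeff g 0                          ∎
  coeff-⊗ (a ∷ f) g (suc k) = begin
    coeff (a ⊙ g ⊕ (0# ∷ (f ⊗ map σ g))) (suc k)
      ≈⟨ coeff-⊕ (a ⊙ g) _ (suc k) ⟩
    coeff (a ⊙ g) (suc k) + coeff (f ⊗ map σ g) k
      ≈⟨ +-cong (coeff-map (zeroʳ a) g (suc k))
                (trans (coeff-⊗ f (map σ g) k)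
                       (conv-cong (λ _ → refl) (coeff-map σ.0#-homo g) k)) ⟩
    a * coeff g (suc k) + conv (coeff f) (σ ∘ coeff g) k ∎

  via-conv₂ : ∀ {f g f′ g′} →
    (∀ k → conv (coeff f) (coeff g) k ≈ conv (coeff f′) (coeff g′) k) →
    f ⊗ g ≋ f′ ⊗ g′
  via-conv₂ {f} {g} {f′} {g′} h =
    mk≋ λ k → trans (coeff-⊗ f g k) (trans (h k) (sym (coeff-⊗ f′ g′ k)))

  ⊕-cong : ∀ {f f′ g g′} → f ≋ f′ → g ≋ g′ → f ⊕ g ≋ f′ ⊕ g′
  ⊕-cong {f} {f′} {g} {g′} p q = mk≋ λ k →
    trans (coeff-⊕ f g k)
      (trans (+-cong (coeff-≈ p k) (coeff-≈ q k)) (sym (coeff-⊕ f′ g′ k)))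

  skewRing : Ring c ℓ
  skewRing = record
    { Carrier = Poly ; _≈_ = _≋_ ; _+_ = _⊕_ ; _*_ = _⊗_ ; -_ = ⊖_
    ; 0# = [] ; 1# = const 1#
    ; isRing = record
      { +-isAbelianGroup = record
        { isGroup = record
          { isMonoid = record
            { isSemigroup = record
              { isMagma = record
                { isEquivalence = record
                  { refl  = mk≋ λ _ → refl
                  ; sym   = λ p → mk≋ λ k → sym (coeff-≈ p k)
                  ; trans = λ p q → mk≋ λ k → trans (coeff-≈ p k) (coeff-≈ q k) }
                ; ∙-cong = ⊕-cong }
              ; assoc = λ f g h → mk≋ λ k → begin
                  coeff (f ⊕ g ⊕ h) k                 ≈⟨ coeff-⊕ (f ⊕ g) h k ⟩
                  coeff (f ⊕ g) k + coeff h k         ≈⟨ +-congʳ (coeff-⊕ f g k) ⟩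
                  coeff f k + coeff g k + coeff h k   ≈⟨ +-assoc _ _ _ ⟩
                  coeff f k + (coeff g k + coeff h k) ≈⟨ +-congˡ (coeff-⊕ g h k) ⟨
                  coeff f k + coeff (g ⊕ h) k         ≈⟨ coeff-⊕ f (g ⊕ h) k ⟨
                  coeff (f ⊕ (g ⊕ h)) k               ∎ }
            ; identity = (λ f → mk≋ λ k → refl)
                       , (λ f → mk≋ λ k → trans (coeff-⊕ f [] k) (+-identityʳ _)) }
          ; inverse =
              (λ f → mk≋ λ k → trans (coeff-⊕ (⊖ f) f k)
                 (trans (+-congʳ (coeff-⊖ f k)) (-‿inverseˡ _)))
            , (λ f → mk≋ λ k → trans (coeff-⊕ f (⊖ f) k)
                 (trans (+-congˡ (coeff-⊖ f k)) (-‿inverseʳ _)))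
          ; ⁻¹-cong = λ {f} {g} p → mk≋ λ k → trans (coeff-⊖ f k)
              (trans (-‿cong (coeff-≈ p k)) (sym (coeff-⊖ g k))) }
        ; comm = λ f g → mk≋ λ k → trans (coeff-⊕ f g k)
            (trans (+-comm _ _) (sym (coeff-⊕ g f k))) }
      ; *-cong = λ {f} {f′} {g} {g′} p q →
          via-conv₂ {f} {g} {f′} {g′} (conv-cong (coeff-≈ p) (coeff-≈ q))
      ; *-assoc = λ f g h → via-conv₂ {f ⊗ g} {h} {f} {g ⊗ h} λ k →
          trans (conv-cong (coeff-⊗ f g) (λ _ → refl) k)
            (trans (conv-assoc (coeff f) (coeff g) (coeff h) k)
                   (conv-cong (λ _ → refl) (λ k → sym (coeff-⊗ g h k)) k))
      ; *-identity =
          (λ f → mk≋ λ k → trans (coeff-⊗ (const 1#) f k) (conv-identityˡ (coeff f) k))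
        , (λ f → mk≋ λ k → trans (coeff-⊗ f (const 1#) k) (conv-identityʳ (coeff f) k))
      ; distrib =
          (λ h f g → mk≋ λ k → begin
             coeff (h ⊗ (f ⊕ g)) k
               ≈⟨ coeff-⊗ h (f ⊕ g) k ⟩
             conv (coeff h) (coeff (f ⊕ g)) k
               ≈⟨ conv-cong (λ _ → refl) (coeff-⊕ f g) k ⟩
             conv (coeff h) (λ k → coeff f k + coeff g k) k
               ≈⟨ conv-distribˡ (coeff h) (coeff f) (coeff g) k ⟩
             conv (coeff h) (coeff f) k + conv (coeff h) (coeff g) k
               ≈⟨ +-cong (coeff-⊗ h f k) (coeff-⊗ h g k) ⟨
             coeff (h ⊗ f) k + coeff (h ⊗ g) k
               ≈⟨ coeff-⊕ (h ⊗ f) (h ⊗ g) k ⟨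
             coeff (h ⊗ f ⊕ h ⊗ g) k ∎)
        , (λ h f g → mk≋ λ k → begin
             coeff ((f ⊕ g) ⊗ h) k
               ≈⟨ coeff-⊗ (f ⊕ g) h k ⟩
             conv (coeff (f ⊕ g)) (coeff h) k
               ≈⟨ conv-cong (coeff-⊕ f g) (λ _ → refl) k ⟩
             conv (λ k → coeff f k + coeff g k) (coeff h) k
               ≈⟨ conv-distribʳ (coeff h) (coeff f) (coeff g) k ⟩
             conv (coeff f) (coeff h) k + conv (coeff g) (coeff h) k
               ≈⟨ +-cong (coeff-⊗ f h k) (coeff-⊗ g h k) ⟨
             coeff (f ⊗ h) k + coeff (g ⊗ h) k
               ≈⟨ coeff-⊕ (f ⊗ h) (g ⊗ h) k ⟨
             coeff (f ⊗ h ⊕ g ⊗ h) k ∎) } }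

  ⊗-comm : (∀ x → σ x ≈ x) → ∀ f g → f ⊗ g ≋ g ⊗ f
  ⊗-comm σ≈id f g = via-conv₂ {f} {g} {g} {f} (comm (coeff f) (coeff g))
    where
    unfoldˡ : ∀ f g k → conv f g (suc k) ≈ f 0 * g (suc k) + conv (f ∘ suc) g k
    unfoldˡ f g k = +-congˡ (conv-cong (λ _ → refl) (λ k → σ≈id (g k)) k)
    unfoldʳ : ∀ f g k → conv f g (suc k) ≈ conv f (g ∘ suc) k + f (suc k) * g 0
    unfoldʳ f g zero    = unfoldˡ f g 0
    unfoldʳ f g (suc k) = begin
      conv f g (suc (suc k))
        ≈⟨ unfoldˡ f g (suc k) ⟩
      f 0 * g (suc (suc k)) + conv (f ∘ suc) g (suc k)
        ≈⟨ +-congˡ (unfoldʳ (f ∘ suc) g k) ⟩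
      f 0 * g (suc (suc k)) + (conv (f ∘ suc) (g ∘ suc) k + f (suc (suc k)) * g 0)
        ≈⟨ +-assoc _ _ _ ⟨
      f 0 * g (suc (suc k)) + conv (f ∘ suc) (g ∘ suc) k + f (suc (suc k)) * g 0
        ≈⟨ +-congʳ (unfoldˡ f (g ∘ suc) k) ⟨
      conv f (g ∘ suc) (suc k) + f (suc (suc k)) * g 0 ∎
    comm : ∀ f g k → conv f g k ≈ conv g f k
    comm f g zero    = *-comm _ _
    comm f g (suc k) = begin
      conv f g (suc k)                       ≈⟨ unfoldʳ f g k ⟩
      conv f (g ∘ suc) k + f (suc k) * g 0   ≈⟨ +-cong (comm f (g ∘ suc) k) (*-comm _ _) ⟩
      conv (g ∘ suc) f k + g 0 * f (suc k)   ≈⟨ +-comm _ _ ⟩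
      g 0 * f (suc k) + conv (g ∘ suc) f k   ≈⟨ unfoldˡ g f k ⟨
      conv g f (suc k)                       ∎

  eval-congʳ : ∀ f {x y} → x ≈ y → eval f x ≈ eval f y
  eval-congʳ []      p = refl
  eval-congʳ (a ∷ f) p = +-cong (*-congˡ p) (eval-congʳ f (σ.⟦⟧-cong p))

  eval-congˡ : ∀ {f g} → f ≋ g → ∀ x → eval f x ≈ eval g x
  eval-congˡ {[]}    {[]}    p x = refl
  eval-congˡ {[]}    {b ∷ g} p x = sym (trans
    (+-cong (trans (*-congʳ (sym (coeff-≈ p 0))) (zeroˡ x))
            (sym (eval-congˡ {[]} {g} (mk≋ (coeff-≈ p ∘ suc)) (σ x))))
    (+-identityˡ _))
  eval-congˡ {a ∷ f} {[]}    p x = trans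
    (+-cong (trans (*-congʳ (coeff-≈ p 0)) (zeroˡ x))
            (eval-congˡ {f} {[]} (mk≋ (coeff-≈ p ∘ suc)) (σ x)))
    (+-identityˡ _)
  eval-congˡ {a ∷ f} {b ∷ g} p x =
    +-cong (*-congʳ (coeff-≈ p 0)) (eval-congˡ {f} {g} (mk≋ (coeff-≈ p ∘ suc)) (σ x))

  eval-⊕ : ∀ f g x → eval (f ⊕ g) x ≈ eval f x + eval g x
  eval-⊕ []      g       x = sym (+-identityˡ _)
  eval-⊕ (a ∷ f) []      x = sym (+-identityʳ _)
  eval-⊕ (a ∷ f) (b ∷ g) x =
    trans (+-cong (distribʳ _ _ _) (eval-⊕ f g (σ x))) (interchange _ _ _ _)

  eval-+ : ∀ f x y → eval f (x + y) ≈ eval f x + eval f y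
  eval-+ []      x y = sym (+-identityˡ _)
  eval-+ (a ∷ f) x y =
    trans (+-cong (distribˡ _ _ _)
                  (trans (eval-congʳ f (σ.+-homo x y)) (eval-+ f (σ x) (σ y))))
          (interchange _ _ _ _)

  eval-0 : ∀ f → eval f 0# ≈ 0#
  eval-0 []      = refl
  eval-0 (a ∷ f) =
    trans (+-cong (zeroʳ a) (trans (eval-congʳ f σ.0#-homo) (eval-0 f))) (+-identityˡ _)

  eval-const : ∀ a x → eval (const a) x ≈ a * x
  eval-const a x = +-identityʳ _

  eval-⊙ : ∀ a f x → eval (a ⊙ f) x ≈ a * eval f x
  eval-⊙ a []      x = sym (zeroʳ a)
  eval-⊙ a (b ∷ f) x =
    trans (+-cong (*-assoc _ _ _) (eval-⊙ a f (σ x))) (sym (distribˡ _ _ _))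

  eval-σ : ∀ f x → eval (map σ f) (σ x) ≈ σ (eval f x)
  eval-σ []      x = sym σ.0#-homo
  eval-σ (a ∷ f) x =
    trans (+-cong (sym (σ.*-homo _ _)) (eval-σ f (σ x))) (sym (σ.+-homo _ _))

  eval-⊗ : ∀ f g x → eval (f ⊗ g) x ≈ eval f (eval g x)
  eval-⊗ []      g x = refl
  eval-⊗ (a ∷ f) g x = begin
    eval (a ⊙ g ⊕ (0# ∷ (f ⊗ map σ g))) x
      ≈⟨ eval-⊕ (a ⊙ g) _ x ⟩
    eval (a ⊙ g) x + (0# * x + eval (f ⊗ map σ g) (σ x))
      ≈⟨ +-cong (eval-⊙ a g x) (trans (+-congʳ (zeroˡ x)) (+-identityˡ _)) ⟩
    a * eval g x + eval (f ⊗ map σ g) (σ x)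
      ≈⟨ +-congˡ (trans (eval-⊗ f (map σ g) (σ x)) (eval-congʳ f (eval-σ g x))) ⟩
    a * eval g x + eval f (σ (eval g x)) ∎

module Polynomial {c ℓ} (R : CommutativeRing c ℓ) where

  id-isRingHomomorphism :
    IsRingHomomorphism (CommutativeRing.rawRing R) (CommutativeRing.rawRing R) id
  id-isRingHomomorphism = Identity.isRingHomomorphism
    (CommutativeRing.rawRing R) (CommutativeRing.refl R)

  open SkewPolynomial R id id-isRingHomomorphism public
    hiding (eval; eval-congʳ; eval-congˡ; eval-⊕; eval-+; eval-0; eval-const; eval-⊗)
    renaming (skewRing to polynomialRing)

  -- f is a homomorphism of R-algebras from R[X] to the R-algebra B whose
  -- structure map is s.
  record IsAlgebraHomomorphism {b ℓb} (B : RawRing b ℓb)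
      (s : CommutativeRing.Carrier R → RawRing.Carrier B)
      (f : Poly → RawRing.Carrier B) : Set (c ⊔ ℓ ⊔ b ⊔ ℓb) where
    field
      isRingHomomorphism : IsRingHomomorphism (Ring.rawRing polynomialRing) B f
      const-homo         : ∀ a → RawRing._≈_ B (f (const a)) (s a)
    open IsRingHomomorphism isRingHomomorphism public

module Matrix {c ℓ} (R : Ring c ℓ) where

  open Ring R hiding (zero)
  open SemiringSum semiring
  private module RP = RingProperties R

  Mat : ℕ → ℕ → Set c
  Mat m n = Fin m → Fin n → Carrier

  infix 4 _≈ᴹ_
  infixl 6 _+ᴹ_
  infixl 7 _*ᴹ_

  _≈ᴹ_ : ∀ {m n} → Mat m n → Mat m n → Set ℓ
  M ≈ᴹ N = ∀ i j → M i j ≈ N i j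

  _+ᴹ_ : ∀ {m n} → Mat m n → Mat m n → Mat m n
  (M +ᴹ N) i j = M i j + N i j

  -ᴹ_ : ∀ {m n} → Mat m n → Mat m n
  (-ᴹ M) i j = - M i j

  0ᴹ : ∀ {m n} → Mat m n
  0ᴹ i j = 0#

  _*ᴹ_ : ∀ {m n o} → Mat m n → Mat n o → Mat m o
  (M *ᴹ N) i k = ∑[ j < _ ] (M i j * N j k)

  diag : ∀ {n} → (Fin n → Carrier) → Mat n n
  diag f i j = if does (i Fin.≟ j) then f i else 0#

  scalar : ∀ {n} → Carrier → Mat n n
  scalar a = diag (λ _ → a)

  1ᴹ : ∀ {n} → Mat n n
  1ᴹ = scalar 1#

  matAbelianGroup : ℕ → ℕ → AbelianGroup c ℓ
  matAbelianGroup m n = record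
    { Carrier = Mat m n ; _≈_ = _≈ᴹ_ ; _∙_ = _+ᴹ_ ; ε = 0ᴹ ; _⁻¹ = -ᴹ_
    ; isAbelianGroup = record
      { isGroup = record
        { isMonoid = record
          { isSemigroup = record
            { isMagma = record
              { isEquivalence = record
                { refl  = λ _ _ → refl
                ; sym   = λ p i j → sym (p i j)
                ; trans = λ p q i j → trans (p i j) (q i j) }
              ; ∙-cong = λ p q i j → +-cong (p i j) (q i j) }
            ; assoc = λ _ _ _ i j → +-assoc _ _ _ }
          ; identity = (λ _ i j → +-identityˡ _) , (λ _ i j → +-identityʳ _) }
        ; inverse = (λ _ i j → -‿inverseˡ _) , (λ _ i j → -‿inverseʳ _)
        ; ⁻¹-cong = λ p i j → -‿cong (p i j) }
      ; comm = λ _ _ i j → +-comm _ _ } }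

  *ᴹ-cong : ∀ {m n o} {M M′ : Mat m n} {N N′ : Mat n o} →
            M ≈ᴹ M′ → N ≈ᴹ N′ → M *ᴹ N ≈ᴹ M′ *ᴹ N′
  *ᴹ-cong p q i k = sum-cong-≋ λ j → *-cong (p i j) (q j k)

  *ᴹ-assoc : ∀ {m n o r} (M : Mat m n) (N : Mat n o) (P : Mat o r) →
             (M *ᴹ N) *ᴹ P ≈ᴹ M *ᴹ (N *ᴹ P)
  *ᴹ-assoc M N P i l = begin
    ∑[ k < _ ] ((∑[ j < _ ] (M i j * N j k)) * P k l)
      ≈⟨ sum-cong-≋ (λ k → *-distribʳ-sum (P k l) (λ j → M i j * N j k)) ⟩
    ∑[ k < _ ] ∑[ j < _ ] (M i j * N j k * P k l)
      ≈⟨ ∑-comm (λ k j → M i j * N j k * P k l) ⟩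
    ∑[ j < _ ] ∑[ k < _ ] (M i j * N j k * P k l)
      ≈⟨ sum-cong-≋ (λ j → sum-cong-≋ λ k → *-assoc (M i j) (N j k) (P k l)) ⟩
    ∑[ j < _ ] ∑[ k < _ ] (M i j * (N j k * P k l))
      ≈⟨ sum-cong-≋ (λ j → *-distribˡ-sum (M i j) (λ k → N j k * P k l)) ⟨
    ∑[ j < _ ] (M i j * ∑[ k < _ ] (N j k * P k l)) ∎
    where open SetoidReasoning setoid

  *ᴹ-distribˡ : ∀ {m n o} (M : Mat m n) (N P : Mat n o) →
                M *ᴹ (N +ᴹ P) ≈ᴹ M *ᴹ N +ᴹ M *ᴹ P
  *ᴹ-distribˡ M N P i k =
    trans (sum-cong-≋ λ j → distribˡ (M i j) (N j k) (P j k))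
          (∑-distrib-+ (λ j → M i j * N j k) (λ j → M i j * P j k))

  *ᴹ-distribʳ : ∀ {m n o} (P : Mat n o) (M N : Mat m n) →
                (M +ᴹ N) *ᴹ P ≈ᴹ M *ᴹ P +ᴹ N *ᴹ P
  *ᴹ-distribʳ P M N i k =
    trans (sum-cong-≋ λ j → distribʳ (P j k) (M i j) (N i j))
          (∑-distrib-+ (λ j → M i j * P j k) (λ j → N i j * P j k))

  ∑-zero : ∀ {n} {f : Fin n → Carrier} → (∀ i → f i ≈ 0#) → sum f ≈ 0#
  ∑-zero {n} p = trans (sum-cong-≋ p) (sum-replicate-zero n)

  diag-∑ˡ : ∀ {n} (f g : Fin n → Carrier) i → ∑[ k < n ] (diag f i k * g k) ≈ f i * g i
  diag-∑ˡ f g zero    =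
    trans (+-congˡ (∑-zero λ k → zeroˡ (g (suc k)))) (+-identityʳ _)
  diag-∑ˡ f g (suc i) =
    trans (+-cong (zeroˡ (g zero)) (diag-∑ˡ (f ∘ suc) (g ∘ suc) i)) (+-identityˡ _)

  diag-∑ʳ : ∀ {n} (f g : Fin n → Carrier) j → ∑[ k < n ] (g k * diag f k j) ≈ g j * f j
  diag-∑ʳ f g zero    =
    trans (+-congˡ (∑-zero λ k → zeroʳ (g (suc k)))) (+-identityʳ _)
  diag-∑ʳ f g (suc j) =
    trans (+-cong (zeroʳ (g zero)) (diag-∑ʳ (f ∘ suc) (g ∘ suc) j)) (+-identityˡ _)

  diag-cong : ∀ {n} {f g : Fin n → Carrier} → (∀ i → f i ≈ g i) → diag f ≈ᴹ diag g
  diag-cong p i j with does (i Fin.≟ j)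
  ... | true  = p i
  ... | false = refl

  diag-+ : ∀ {n} (f g : Fin n → Carrier) → diag (λ i → f i + g i) ≈ᴹ diag f +ᴹ diag g
  diag-+ f g i j with does (i Fin.≟ j)
  ... | true  = refl
  ... | false = sym (+-identityˡ _)

  diag-0 : ∀ {n} → diag {n} (λ _ → 0#) ≈ᴹ 0ᴹ
  diag-0 i j with does (i Fin.≟ j)
  ... | true  = refl
  ... | false = refl

  diag-neg : ∀ {n} (f : Fin n → Carrier) → diag (λ i → - f i) ≈ᴹ -ᴹ diag f
  diag-neg f i j with does (i Fin.≟ j)
  ... | true  = refl
  ... | false = sym (RingProperties.-0#≈0# R)

  diag-* : ∀ {n} (f g : Fin n → Carrier) → diag (λ i → f i * g i) ≈ᴹ diag f *ᴹ diag g
  diag-* f g i j = trans (lemma i j) (sym (diag-∑ˡ f (λ k → diag g k j) i))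
    where
    lemma : ∀ i j → diag (λ i → f i * g i) i j ≈ f i * diag g i j
    lemma i j with does (i Fin.≟ j)
    ... | true  = refl
    ... | false = sym (zeroʳ _)

  *ᴹ-identityˡ : ∀ {m n} (M : Mat m n) → 1ᴹ *ᴹ M ≈ᴹ M
  *ᴹ-identityˡ M i j = trans (diag-∑ˡ (λ _ → 1#) (λ k → M k j) i) (*-identityˡ _)

  *ᴹ-identityʳ : ∀ {m n} (M : Mat m n) → M *ᴹ 1ᴹ ≈ᴹ M
  *ᴹ-identityʳ M i j = trans (diag-∑ʳ (λ _ → 1#) (M i) j) (*-identityʳ _)

  ∑-neg : ∀ {n} (f : Fin n → Carrier) → sum (λ i → - f i) ≈ - sum f
  ∑-neg {zero}  f = sym RP.-0#≈0#
  ∑-neg {suc n} f = trans (+-congˡ (∑-neg (f ∘ suc)))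
    (RP.-‿+-comm (f zero) (sum (f ∘ suc)))

  negˡ : ∀ {m n o} (M : Mat m n) (N : Mat n o) → (-ᴹ M) *ᴹ N ≈ᴹ -ᴹ (M *ᴹ N)
  negˡ M N i k = trans
    (sum-cong-≋ λ j → sym (RP.-‿distribˡ-* (M i j) (N j k)))
    (∑-neg (λ j → M i j * N j k))

  negʳ : ∀ {m n o} (M : Mat m n) (N : Mat n o) → M *ᴹ (-ᴹ N) ≈ᴹ -ᴹ (M *ᴹ N)
  negʳ M N i k = trans
    (sum-cong-≋ λ j → sym (RP.-‿distribʳ-* (M i j) (N j k)))
    (∑-neg (λ j → M i j * N j k))

  *ᴹ-zeroˡ : ∀ {m n o} (N : Mat n o) → 0ᴹ {m} {n} *ᴹ N ≈ᴹ 0ᴹ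
  *ᴹ-zeroˡ {n = n} N i k = trans
    (sum-cong-≋ λ j → zeroˡ (N j k)) (sum-replicate-zero n)

  *ᴹ-zeroʳ : ∀ {m n o} (N : Mat m n) → N *ᴹ 0ᴹ {n} {o} ≈ᴹ 0ᴹ
  *ᴹ-zeroʳ {n = n} N i k = trans
    (sum-cong-≋ λ j → zeroʳ (N i j)) (sum-replicate-zero n)

  matRing : ℕ → Ring c ℓ
  matRing n = record
    { Carrier = Mat n n ; _≈_ = _≈ᴹ_ ; _+_ = _+ᴹ_ ; _*_ = _*ᴹ_ ; -_ = -ᴹ_
    ; 0# = 0ᴹ ; 1# = 1ᴹ
    ; isRing = record
      { +-isAbelianGroup = AbelianGroup.isAbelianGroup (matAbelianGroup n n)
      ; *-cong     = *ᴹ-cong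
      ; *-assoc    = *ᴹ-assoc
      ; *-identity = *ᴹ-identityˡ , *ᴹ-identityʳ
      ; distrib    = *ᴹ-distribˡ , *ᴹ-distribʳ } }

  IsNilpotent : ∀ {n} → Mat n n → Set ℓ
  IsNilpotent {n} M = ∃[ k ] M ^ k ≈ᴹ 0ᴹ
    where open Exp (Ring.semiring (matRing n)) using (_^_)

fieldRing : ∀ {c ℓ₁ ℓ₂} → HeytingField c ℓ₁ ℓ₂ → CommutativeRing c ℓ₁
fieldRing F = HeytingCommutativeRing.commutativeRing (HeytingField.heytingCommutativeRing F)

-- Classically a HeytingField is just a field, x # y meaning x ≉ y; its axioms
-- exclude the zero ring.  ι makes sense as an 𝔽_q-algebra map only relative to
-- the structure map η of K.
record Base c ℓ₁ ℓ₂ c′ ℓ₁′ ℓ₂′ : Set (lsuc (c ⊔ ℓ₁ ⊔ ℓ₂ ⊔ c′ ⊔ ℓ₁′ ⊔ ℓ₂′)) where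
  field
    p e     : ℕ
    p-prime : Prime p

  q : ℕ
  q = p ℕ.^ e

  field
    𝔽     : HeytingField c ℓ₁ ℓ₂
    𝔽-card : Inverse (CommutativeRing.setoid (fieldRing 𝔽)) (≡.setoid (Fin q))
    K      : HeytingField c′ ℓ₁′ ℓ₂′
    K-char : Characteristic.HasCharacteristic (fieldRing K) p

  module 𝔽 = CommutativeRing (fieldRing 𝔽)
  module K = HeytingField K
  module A = Polynomial (fieldRing 𝔽)

  field
    η     : 𝔽.Carrier → K.Carrier
    η-hom : IsRingHomomorphism 𝔽.rawRing (CommutativeRing.rawRing (fieldRing K)) η
    ι     : A.Poly → K.Carrier
    ι-hom : A.IsAlgebraHomomorphism (CommutativeRing.rawRing (fieldRing K)) η ι

module TModules {c ℓ₁ ℓ₂ c′ ℓ₁′ ℓ₂′} (B : Base c ℓ₁ ℓ₂ c′ ℓ₁′ ℓ₂′) where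

  open Base B using (p; e; q; p-prime; K-char; η; η-hom; ι; ι-hom)
  module 𝔽 = CommutativeRing (fieldRing (Base.𝔽 B))
  module K where
    open HeytingField (Base.K B) public using (_#_)
    open CommutativeRing (fieldRing (Base.K B)) public
  module Kᴱ = Exp K.semiring

  module A where
    open Polynomial (fieldRing (Base.𝔽 B)) public
    open Ring polynomialRing public hiding (_≉_)

  Frob : K.Carrier → K.Carrier
  Frob x = x Kᴱ.^ q

  module Kτ where
    open SkewPolynomial (fieldRing (Base.K B)) Frob
      (Characteristic.frobenius-isRingHomomorphism (fieldRing (Base.K B)) p-prime
        (Equivalence.from (K-char p)
          (divides 1 (≡.sym (ℕ.*-identityˡ p)))) e) public
    open Ring skewRing public hiding (_≉_)

  module MK  = Matrix (CommutativeRing.ring (fieldRing (Base.K B)))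
  module MKτ = Matrix Kτ.skewRing
  open MKτ using (Mat; _≈ᴹ_; _+ᴹ_; _*ᴹ_; -ᴹ_; 0ᴹ; *ᴹ-zeroˡ; *ᴹ-zeroʳ; negˡ; negʳ)

  θ : K.Carrier
  θ = ι A.X

  coeffᴹ : ∀ {m n} → ℕ → Mat m n → MK.Mat m n
  coeffᴹ k M i j = Kτ.coeff (M i j) k

  record TModule (d : ℕ) : Set (c ⊔ ℓ₁ ⊔ c′ ⊔ ℓ₁′) where
    field
      act       : A.Poly → Mat d d
      act-hom   : A.IsAlgebraHomomorphism (Ring.rawRing (MKτ.matRing d))
                    (λ a → MKτ.scalar (Kτ.const (η a))) act
      nilpotent : MK.IsNilpotent (coeffᴹ 0 (act A.X) MK.+ᴹ (MK.-ᴹ MK.scalar θ))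
    module hom = A.IsAlgebraHomomorphism act-hom

  open TModule public using (act)

  -- r = deg_τ Φ_t, stated as a relation because deciding which coefficients
  -- vanish need not be possible in K.  A constant Φ_t, even Φ_t = 0 (which can
  -- occur when θ = 0), has degree 0.
  HasRank : ∀ {d} → TModule d → ℕ → Set (ℓ₁′ ⊔ ℓ₂′)
  HasRank Φ r =
      (∀ k → r ℕ.< k → coeffᴹ k (act Φ A.X) MK.≈ᴹ MK.0ᴹ)
    × (r ≡ 0 ⊎ ∃[ i ] ∃[ j ] coeffᴹ r (act Φ A.X) i j K.# K.0#)

  DrinfeldModule : Set (c ⊔ ℓ₁ ⊔ c′ ⊔ ℓ₁′)
  DrinfeldModule = TModule 1

  ∏ : ∀ {n} → (Fin n → DrinfeldModule) → TModule n
  ∏ {n} φ = record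
    { act = λ a → MKτ.diag (entry a)
    ; act-hom = record
      { isRingHomomorphism = record
        { isSemiringHomomorphism = record
          { isNearSemiringHomomorphism = record
            { +-isMonoidHomomorphism = record
              { isMagmaHomomorphism = record
                { isRelHomomorphism = record
                  { cong = λ a≈b → MKτ.diag-cong λ i → h.⟦⟧-cong i a≈b zero zero }
                ; homo = λ a b → ≈ᴹ-trans
                    (MKτ.diag-cong λ i → h.+-homo i a b zero zero)
                    (MKτ.diag-+ (entry a) (entry b)) }
              ; ε-homo = ≈ᴹ-trans
                  (MKτ.diag-cong λ i → h.0#-homo i zero zero) MKτ.diag-0 }
            ; *-homo = λ a b → ≈ᴹ-trans
                (MKτ.diag-cong λ i → Kτ.trans (h.*-homo i a b zero zero)
                                              (Kτ.+-identityʳ _))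
                (MKτ.diag-* (entry a) (entry b)) }
          ; 1#-homo = MKτ.diag-cong λ i → h.1#-homo i zero zero }
        ; -‿homo = λ a → ≈ᴹ-trans
            (MKτ.diag-cong λ i → h.-‿homo i a zero zero)
            (MKτ.diag-neg (entry a)) }
      ; const-homo = λ a → MKτ.diag-cong λ i → h.const-homo i a zero zero }
    ; nilpotent = 1 , λ i j → K.trans (MK.*ᴹ-identityʳ N i j) (vanish i j)
    }
    where
    module h (i : Fin n) = TModule.hom (φ i)

    entry : A.Poly → Fin n → Kτ.Poly
    entry a i = act (φ i) a zero zero

    ≈ᴹ-trans : ∀ {M N P : Mat n n} → M ≈ᴹ N → N ≈ᴹ P → M ≈ᴹ P
    ≈ᴹ-trans p q i j = Kτ.trans (p i j) (q i j)

    N₁ : Fin n → MK.Mat 1 1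
    N₁ i = coeffᴹ 0 (act (φ i) A.X) MK.+ᴹ (MK.-ᴹ MK.scalar θ)

    open Exp (Ring.semiring (MK.matRing 1)) using () renaming (_^_ to _^₁_)

    power : ∀ (M : MK.Mat 1 1) k → (M ^₁ k) zero zero K.≈ M zero zero Kᴱ.^ k
    power M zero    = K.refl
    power M (suc k) = K.trans (K.+-identityʳ _) (K.*-congˡ (power M k))

    reduced : ∀ x k → x Kᴱ.^ k K.≈ K.0# → x K.≈ K.0#
    reduced x k xᵏ≈0 = proj₁ (HeytingField.tight (Base.K B) x K.0#) not#
      where
      open SetoidReasoning K.setoid
      not# : ¬ (x K.# K.0#)
      not# x#0 with HeytingField.#⇒invertible (Base.K B) x#0
      ... | y , yx≈1 , _ = HeytingField.#-irrefl (Base.K B) x≈0 x#0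
        where
        x-0≈x : x K.- K.0# K.≈ x
        x-0≈x = K.trans (K.+-congˡ (RingProperties.-0#≈0# K.ring)) (K.+-identityʳ x)
        lower : ∀ k → x Kᴱ.^ k K.≈ K.0# → K.1# K.≈ K.0#
        lower zero    h = h
        lower (suc k) h = lower k (begin
          x Kᴱ.^ k                           ≈⟨ K.*-identityˡ _ ⟨
          K.1# K.* x Kᴱ.^ k                  ≈⟨ K.*-congʳ yx≈1 ⟨
          y K.* (x K.- K.0#) K.* x Kᴱ.^ k    ≈⟨ K.*-congʳ (K.*-congˡ x-0≈x) ⟩
          y K.* x K.* x Kᴱ.^ k               ≈⟨ K.*-assoc _ _ _ ⟩
          y K.* (x K.* x Kᴱ.^ k)             ≈⟨ K.*-congˡ h ⟩
          y K.* K.0#                         ≈⟨ K.zeroʳ y ⟩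
          K.0#                               ∎)
        x≈0 : x K.≈ K.0#
        x≈0 = begin
          x            ≈⟨ K.*-identityˡ x ⟨
          K.1# K.* x   ≈⟨ K.*-congʳ (lower k xᵏ≈0) ⟩
          K.0# K.* x   ≈⟨ K.zeroˡ x ⟩
          K.0#         ∎

    N₁≈0 : ∀ i → N₁ i zero zero K.≈ K.0#
    N₁≈0 i with TModule.nilpotent (φ i)
    ... | k , Nᵏ≈0 = reduced _ k (K.trans (K.sym (power (N₁ i) k)) (Nᵏ≈0 zero zero))

    N : MK.Mat n n
    N = coeffᴹ 0 (MKτ.diag (entry A.X)) MK.+ᴹ (MK.-ᴹ MK.scalar θ)

    vanish : N MK.≈ᴹ MK.0ᴹ
    vanish i j with does (i Fin.≟ j)
    ... | true  = N₁≈0 i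
    ... | false = K.-‿inverseʳ _

  evalᴹ : ∀ {m n} → Mat m n → (Fin n → K.Carrier) → (Fin m → K.Carrier)
  evalᴹ {n = n} M x i = ∑[ j < n ] Kτ.eval (M i j) (x j)
    where open SemiringSum K.semiring using (sum-syntax)

  MordellWeil : ∀ {d} → TModule d → LeftModule A.polynomialRing c′ ℓ₁′
  MordellWeil {d} Φ = record
    { Carrierᴹ = Fin d → K.Carrier
    ; _≈ᴹ_ = λ x y → ∀ i → x i K.≈ y i
    ; _+ᴹ_ = λ x y i → x i K.+ y i
    ; _*ₗ_ = λ a x → evalᴹ (act Φ a) x
    ; 0ᴹ = λ _ → K.0#
    ; -ᴹ_ = λ x i → K.- x i
    ; isLeftModule = record
      { isLeftSemimodule = record
        { +ᴹ-isCommutativeMonoid = record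
          { isMonoid = record
            { isSemigroup = record
              { isMagma = record
                { isEquivalence = record
                  { refl  = λ _ → K.refl
                  ; sym   = λ p i → K.sym (p i)
                  ; trans = λ p q i → K.trans (p i) (q i) }
                ; ∙-cong = λ p q i → K.+-cong (p i) (q i) }
              ; assoc = λ x y z i → K.+-assoc _ _ _ }
            ; identity = (λ x i → K.+-identityˡ _) , (λ x i → K.+-identityʳ _) }
          ; comm = λ x y i → K.+-comm _ _ }
        ; isPreleftSemimodule = record
          { *ₗ-cong      = λ {a} {b} {x} {y} a≈b x≈y i → S.sum-cong-≋ λ j →
              K.trans (Kτ.eval-congˡ (H.⟦⟧-cong a≈b i j) (x j))
                      (Kτ.eval-congʳ (act Φ b i j) (x≈y j))
          ; *ₗ-zeroˡ     = λ x i → ∑-zero λ j → Kτ.eval-congˡ (H.0#-homo i j) (x j)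
          ; *ₗ-distribʳ  = λ x a b i → K.trans
              (S.sum-cong-≋ λ j → K.trans
                (Kτ.eval-congˡ (H.+-homo a b i j) (x j))
                (Kτ.eval-⊕ (act Φ a i j) (act Φ b i j) (x j)))
              (S.∑-distrib-+ (λ j → Kτ.eval (act Φ a i j) (x j)) _)
          ; *ₗ-identityˡ = λ x i → K.trans
              (S.sum-cong-≋ λ j → K.trans
                (Kτ.eval-congˡ (H.1#-homo i j) (x j)) (eval-1 x i j))
              (K.trans (MK.diag-∑ˡ (λ _ → K.1#) x i) (K.*-identityˡ _))
          ; *ₗ-assoc     = λ a b x i → begin
              (∑[ j < d ] Kτ.eval (act Φ (a A.* b) i j) (x j))
                ≈⟨ S.sum-cong-≋ (λ j → Kτ.eval-congˡ (H.*-homo a b i j) (x j)) ⟩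
              (∑[ j < d ] Kτ.eval ((act Φ a *ᴹ act Φ b) i j) (x j))
                ≈⟨ S.sum-cong-≋ (λ j → K.trans
                     (eval-sum (λ k → act Φ a i k Kτ.* act Φ b k j) (x j))
                     (S.sum-cong-≋ λ k → Kτ.eval-⊗ (act Φ a i k) (act Φ b k j) (x j))) ⟩
              (∑[ j < d ] ∑[ k < d ] Kτ.eval (act Φ a i k) (Kτ.eval (act Φ b k j) (x j)))
                ≈⟨ S.∑-comm (λ j k → Kτ.eval (act Φ a i k) (Kτ.eval (act Φ b k j) (x j))) ⟩
              (∑[ k < d ] ∑[ j < d ] Kτ.eval (act Φ a i k) (Kτ.eval (act Φ b k j) (x j)))
                ≈⟨ S.sum-cong-≋ (λ k → sum-eval (act Φ a i k) (λ j → Kτ.eval (act Φ b k j) (x j))) ⟨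
              (∑[ k < d ] Kτ.eval (act Φ a i k) (∑[ j < d ] Kτ.eval (act Φ b k j) (x j))) ∎
          ; *ₗ-zeroʳ     = λ a i → ∑-zero λ j → Kτ.eval-0 (act Φ a i j)
          ; *ₗ-distribˡ  = λ a x y i → K.trans
              (S.sum-cong-≋ λ j → Kτ.eval-+ (act Φ a i j) (x j) (y j))
              (S.∑-distrib-+ (λ j → Kτ.eval (act Φ a i j) (x j)) _) } }
      ; -ᴹ‿cong = λ p i → K.-‿cong (p i)
      ; -ᴹ‿inverse = (λ x i → K.-‿inverseˡ _) , (λ x i → K.-‿inverseʳ _) } }
    where
    module H = TModule.hom Φ
    module S = SemiringSum K.semiring
    open S using (sum-syntax)
    open SetoidReasoning K.setoid

    ∑-zero : ∀ {n} {f : Fin n → K.Carrier} → (∀ i → f i K.≈ K.0#) → S.sum f K.≈ K.0#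
    ∑-zero {n} p = K.trans (S.sum-cong-≋ p) (S.sum-replicate-zero n)

    eval-1 : ∀ x (i j : Fin d) → Kτ.eval (MKτ.1ᴹ i j) (x j) K.≈ MK.1ᴹ i j K.* x j
    eval-1 x i j with does (i Fin.≟ j)
    ... | true  = Kτ.eval-const K.1# (x j)
    ... | false = K.sym (K.zeroˡ _)

    module Sτ = SemiringSum (Ring.semiring Kτ.skewRing)

    eval-sum : ∀ {n} (f : Fin n → Kτ.Poly) x →
               Kτ.eval (Sτ.sum f) x K.≈ S.sum (λ k → Kτ.eval (f k) x)
    eval-sum {zero}  f x = K.refl
    eval-sum {suc n} f x =
      K.trans (Kτ.eval-⊕ (f zero) _ x) (K.+-congˡ (eval-sum (f ∘ suc) x))

    sum-eval : ∀ {n} f (x : Fin n → K.Carrier) →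
               Kτ.eval f (S.sum x) K.≈ S.sum (λ k → Kτ.eval f (x k))
    sum-eval {zero}  f x = Kτ.eval-0 f
    sum-eval {suc n} f x =
      K.trans (Kτ.eval-+ f (x zero) _) (K.+-congˡ (sum-eval f (x ∘ suc)))

  module _ {d e : ℕ} (Φ : TModule d) (Ψ : TModule e) where

    record Der : Set (c ⊔ ℓ₁ ⊔ c′ ⊔ ℓ₁′) where
      field
        δ        : A.Poly → Mat e d
        δ-cong   : ∀ {a b} → a A.≈ b → δ a ≈ᴹ δ b
        δ-+      : ∀ a b → δ (a A.+ b) ≈ᴹ δ a +ᴹ δ b
        δ-scalar : ∀ x a → δ (A.const x A.* a) ≈ᴹ
                           (λ i j → Kτ.const (η x) Kτ.* δ a i j)
        leibniz  : ∀ a b → δ (a A.* b) ≈ᴹ act Ψ a *ᴹ δ b +ᴹ δ a *ᴹ act Φ b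

    open Der

    inner : Mat e d → A.Poly → Mat e d
    inner U a = U *ᴹ act Φ a +ᴹ (-ᴹ (act Ψ a *ᴹ U))

    -- equality in Der(Φ, Ψ) / Der_in(Φ, Ψ)
    _∼_ : Der → Der → Set (c ⊔ c′ ⊔ ℓ₁′)
    δ₁ ∼ δ₂ = ∃[ U ] ∀ a → δ δ₁ a +ᴹ (-ᴹ δ δ₂ a) ≈ᴹ inner U a

    private
      module G = AbelianGroup (MKτ.matAbelianGroup e d)
      module GP = AbelianGroupProperties (MKτ.matAbelianGroup e d)
      open CommutativeSemigroupProperties G.commutativeSemigroup using (interchange)
      open SetoidReasoning G.setoid
      module HΦ = TModule.hom Φ
      module HΨ = TModule.hom Ψ
      module RP = RingProperties Kτ.skewRing

    A-comm : ∀ a b → a A.* b A.≈ b A.* a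
    A-comm = A.⊗-comm (λ _ → 𝔽.refl)

    Ψ-comm : ∀ {m} a b (M : Mat e m) →
             act Ψ a *ᴹ (act Ψ b *ᴹ M) ≈ᴹ act Ψ b *ᴹ (act Ψ a *ᴹ M)
    Ψ-comm a b M i j = Kτ.trans (Kτ.sym (MKτ.*ᴹ-assoc (act Ψ a) (act Ψ b) M i j))
      (Kτ.trans (MKτ.*ᴹ-cong {N = M} {N′ = M} ΨaΨb≈ΨbΨa (λ _ _ → Kτ.refl) i j)
                (MKτ.*ᴹ-assoc (act Ψ b) (act Ψ a) M i j))
      where
      ΨaΨb≈ΨbΨa : act Ψ a *ᴹ act Ψ b ≈ᴹ act Ψ b *ᴹ act Ψ a
      ΨaΨb≈ΨbΨa i j = Kτ.trans (Kτ.sym (HΨ.*-homo a b i j))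
        (Kτ.trans (HΨ.⟦⟧-cong (A-comm a b) i j) (HΨ.*-homo b a i j))

    scalar-act : ∀ x (M : Mat e d) →
      act Ψ (A.const x) *ᴹ M ≈ᴹ (λ i j → Kτ.const (η x) Kτ.* M i j)
    scalar-act x M i j = Kτ.trans
      (MKτ.*ᴹ-cong {N = M} {N′ = M} (HΨ.const-homo x) (λ _ _ → Kτ.refl) i j)
      (MKτ.diag-∑ˡ (λ _ → Kτ.const (η x)) (λ k → M k j) i)

    inner-0 : ∀ a → inner 0ᴹ a ≈ᴹ 0ᴹ
    inner-0 a = begin
      0ᴹ *ᴹ act Φ a +ᴹ (-ᴹ (act Ψ a *ᴹ 0ᴹ))
        ≈⟨ G.∙-cong (*ᴹ-zeroˡ (act Φ a)) (G.⁻¹-cong (*ᴹ-zeroʳ (act Ψ a))) ⟩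
      0ᴹ +ᴹ (-ᴹ 0ᴹ)
        ≈⟨ G.inverseʳ 0ᴹ ⟩
      0ᴹ ∎

    inner-+ : ∀ U V a → inner (U +ᴹ V) a ≈ᴹ inner U a +ᴹ inner V a
    inner-+ U V a = begin
      (U +ᴹ V) *ᴹ act Φ a +ᴹ (-ᴹ (act Ψ a *ᴹ (U +ᴹ V)))
        ≈⟨ G.∙-cong (MKτ.*ᴹ-distribʳ (act Φ a) U V)
             (G.trans (G.⁻¹-cong (MKτ.*ᴹ-distribˡ (act Ψ a) U V))
                      (G.sym (GP.⁻¹-∙-comm (act Ψ a *ᴹ U) (act Ψ a *ᴹ V)))) ⟩
      (U *ᴹ act Φ a +ᴹ V *ᴹ act Φ a) +ᴹ ((-ᴹ (act Ψ a *ᴹ U)) +ᴹ (-ᴹ (act Ψ a *ᴹ V)))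
        ≈⟨ interchange (U *ᴹ act Φ a) (V *ᴹ act Φ a)
                       (-ᴹ (act Ψ a *ᴹ U)) (-ᴹ (act Ψ a *ᴹ V)) ⟩
      inner U a +ᴹ inner V a ∎

    inner-neg : ∀ U a → inner (-ᴹ U) a ≈ᴹ -ᴹ inner U a
    inner-neg U a = begin
      (-ᴹ U) *ᴹ act Φ a +ᴹ (-ᴹ (act Ψ a *ᴹ (-ᴹ U)))
        ≈⟨ G.∙-cong (negˡ U (act Φ a)) (G.⁻¹-cong (negʳ (act Ψ a) U)) ⟩
      (-ᴹ (U *ᴹ act Φ a)) +ᴹ (-ᴹ (-ᴹ (act Ψ a *ᴹ U)))
        ≈⟨ GP.⁻¹-∙-comm (U *ᴹ act Φ a) (-ᴹ (act Ψ a *ᴹ U)) ⟩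
      -ᴹ inner U a ∎

    inner-act : ∀ a U b → inner (act Ψ a *ᴹ U) b ≈ᴹ act Ψ a *ᴹ inner U b
    inner-act a U b = begin
      (act Ψ a *ᴹ U) *ᴹ act Φ b +ᴹ (-ᴹ (act Ψ b *ᴹ (act Ψ a *ᴹ U)))
        ≈⟨ G.∙-cong (MKτ.*ᴹ-assoc (act Ψ a) U (act Φ b))
             (G.trans (G.⁻¹-cong (Ψ-comm b a U))
                      (G.sym (negʳ (act Ψ a) (act Ψ b *ᴹ U)))) ⟩
      act Ψ a *ᴹ (U *ᴹ act Φ b) +ᴹ act Ψ a *ᴹ (-ᴹ (act Ψ b *ᴹ U))
        ≈⟨ MKτ.*ᴹ-distribˡ (act Ψ a) (U *ᴹ act Φ b) (-ᴹ (act Ψ b *ᴹ U)) ⟨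
      act Ψ a *ᴹ inner U b ∎

    infixl 6 _+ᴰ_
    infixr 7 _*ᴰ_

    _+ᴰ_ : Der → Der → Der
    δ₁ +ᴰ δ₂ = record
      { δ        = λ a → δ δ₁ a +ᴹ δ δ₂ a
      ; δ-cong   = λ p → G.∙-cong (δ-cong δ₁ p) (δ-cong δ₂ p)
      ; δ-+      = λ a b → G.trans (G.∙-cong (δ-+ δ₁ a b) (δ-+ δ₂ a b))
                     (interchange (δ δ₁ a) (δ δ₁ b) (δ δ₂ a) (δ δ₂ b))
      ; δ-scalar = λ x a i j → Kτ.trans
                     (Kτ.+-cong (δ-scalar δ₁ x a i j) (δ-scalar δ₂ x a i j))
                     (Kτ.sym (Kτ.distribˡ (Kτ.const (η x)) (δ δ₁ a i j) (δ δ₂ a i j)))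
      ; leibniz  = λ a b → begin
          δ δ₁ (a A.* b) +ᴹ δ δ₂ (a A.* b)
            ≈⟨ G.∙-cong (leibniz δ₁ a b) (leibniz δ₂ a b) ⟩
          (act Ψ a *ᴹ δ δ₁ b +ᴹ δ δ₁ a *ᴹ act Φ b)
            +ᴹ (act Ψ a *ᴹ δ δ₂ b +ᴹ δ δ₂ a *ᴹ act Φ b)
            ≈⟨ interchange (act Ψ a *ᴹ δ δ₁ b) (δ δ₁ a *ᴹ act Φ b)
                           (act Ψ a *ᴹ δ δ₂ b) (δ δ₂ a *ᴹ act Φ b) ⟩
          (act Ψ a *ᴹ δ δ₁ b +ᴹ act Ψ a *ᴹ δ δ₂ b)
            +ᴹ (δ δ₁ a *ᴹ act Φ b +ᴹ δ δ₂ a *ᴹ act Φ b)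
            ≈⟨ G.∙-cong (MKτ.*ᴹ-distribˡ (act Ψ a) (δ δ₁ b) (δ δ₂ b))
                        (MKτ.*ᴹ-distribʳ (act Φ b) (δ δ₁ a) (δ δ₂ a)) ⟨
          act Ψ a *ᴹ (δ δ₁ b +ᴹ δ δ₂ b) +ᴹ (δ δ₁ a +ᴹ δ δ₂ a) *ᴹ act Φ b ∎
      }

    0ᴰ : Der
    0ᴰ = record
      { δ        = λ _ → 0ᴹ
      ; δ-cong   = λ _ → G.refl
      ; δ-+      = λ _ _ → G.sym (G.identityˡ 0ᴹ)
      ; δ-scalar = λ x _ _ _ → Kτ.sym (Kτ.zeroʳ (Kτ.const (η x)))
      ; leibniz  = λ a b → G.sym (G.trans
          (G.∙-cong (*ᴹ-zeroʳ (act Ψ a)) (*ᴹ-zeroˡ (act Φ b))) (G.identityˡ 0ᴹ))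
      }

    -ᴰ_ : Der → Der
    -ᴰ δ₁ = record
      { δ        = λ a → -ᴹ δ δ₁ a
      ; δ-cong   = λ p → G.⁻¹-cong (δ-cong δ₁ p)
      ; δ-+      = λ a b → G.trans (G.⁻¹-cong (δ-+ δ₁ a b))
                     (G.sym (GP.⁻¹-∙-comm (δ δ₁ a) (δ δ₁ b)))
      ; δ-scalar = λ x a i j → Kτ.trans (Kτ.-‿cong (δ-scalar δ₁ x a i j))
                     (RP.-‿distribʳ-* (Kτ.const (η x)) (δ δ₁ a i j))
      ; leibniz  = λ a b → begin
          -ᴹ δ δ₁ (a A.* b)
            ≈⟨ G.⁻¹-cong (leibniz δ₁ a b) ⟩
          -ᴹ (act Ψ a *ᴹ δ δ₁ b +ᴹ δ δ₁ a *ᴹ act Φ b)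
            ≈⟨ GP.⁻¹-∙-comm (act Ψ a *ᴹ δ δ₁ b) (δ δ₁ a *ᴹ act Φ b) ⟨
          (-ᴹ (act Ψ a *ᴹ δ δ₁ b)) +ᴹ (-ᴹ (δ δ₁ a *ᴹ act Φ b))
            ≈⟨ G.∙-cong (negʳ (act Ψ a) (δ δ₁ b)) (negˡ (δ δ₁ a) (act Φ b)) ⟨
          act Ψ a *ᴹ (-ᴹ δ δ₁ b) +ᴹ (-ᴹ δ δ₁ a) *ᴹ act Φ b ∎
      }

    _*ᴰ_ : A.Poly → Der → Der
    a *ᴰ δ₁ = record
      { δ        = λ b → act Ψ a *ᴹ δ δ₁ b
      ; δ-cong   = λ p → MKτ.*ᴹ-cong {M = act Ψ a} (λ _ _ → Kτ.refl) (δ-cong δ₁ p)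
      ; δ-+      = λ b b′ → G.trans
          (MKτ.*ᴹ-cong {M = act Ψ a} (λ _ _ → Kτ.refl) (δ-+ δ₁ b b′))
          (MKτ.*ᴹ-distribˡ (act Ψ a) (δ δ₁ b) (δ δ₁ b′))
      ; δ-scalar = λ x b → begin
          act Ψ a *ᴹ δ δ₁ (A.const x A.* b)
            ≈⟨ MKτ.*ᴹ-cong {M = act Ψ a} (λ _ _ → Kτ.refl)
                 (G.trans (δ-scalar δ₁ x b) (G.sym (scalar-act x (δ δ₁ b)))) ⟩
          act Ψ a *ᴹ (act Ψ (A.const x) *ᴹ δ δ₁ b)
            ≈⟨ Ψ-comm a (A.const x) (δ δ₁ b) ⟩
          act Ψ (A.const x) *ᴹ (act Ψ a *ᴹ δ δ₁ b)
            ≈⟨ scalar-act x (act Ψ a *ᴹ δ δ₁ b) ⟩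
          (λ i j → Kτ.const (η x) Kτ.* (act Ψ a *ᴹ δ δ₁ b) i j) ∎
      ; leibniz  = λ b b′ → begin
          act Ψ a *ᴹ δ δ₁ (b A.* b′)
            ≈⟨ MKτ.*ᴹ-cong {M = act Ψ a} (λ _ _ → Kτ.refl) (leibniz δ₁ b b′) ⟩
          act Ψ a *ᴹ (act Ψ b *ᴹ δ δ₁ b′ +ᴹ δ δ₁ b *ᴹ act Φ b′)
            ≈⟨ MKτ.*ᴹ-distribˡ (act Ψ a) (act Ψ b *ᴹ δ δ₁ b′) (δ δ₁ b *ᴹ act Φ b′) ⟩
          act Ψ a *ᴹ (act Ψ b *ᴹ δ δ₁ b′) +ᴹ act Ψ a *ᴹ (δ δ₁ b *ᴹ act Φ b′)
            ≈⟨ G.∙-cong (Ψ-comm a b (δ δ₁ b′))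
                 (G.sym (MKτ.*ᴹ-assoc (act Ψ a) (δ δ₁ b) (act Φ b′))) ⟩
          act Ψ b *ᴹ (act Ψ a *ᴹ δ δ₁ b′) +ᴹ (act Ψ a *ᴹ δ δ₁ b) *ᴹ act Φ b′ ∎
      }

    diff≈0 : ∀ {M N : Mat e d} → M ≈ᴹ N → M +ᴹ (-ᴹ N) ≈ᴹ 0ᴹ
    diff≈0 {M} {N} p = G.trans (G.∙-congʳ p) (G.inverseʳ N)

    ≈⇒∼ : ∀ {δ₁ δ₂ : Der} → (∀ a → δ δ₁ a ≈ᴹ δ δ₂ a) → δ₁ ∼ δ₂
    ≈⇒∼ p = 0ᴹ , λ a → G.trans (diff≈0 (p a)) (G.sym (inner-0 a))

    ∼-sym : ∀ {δ₁ δ₂} → δ₁ ∼ δ₂ → δ₂ ∼ δ₁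
    ∼-sym {δ₁} {δ₂} (U , h) = -ᴹ U , λ a → begin
      δ δ₂ a +ᴹ (-ᴹ δ δ₁ a)
        ≈⟨ G.∙-congʳ (GP.⁻¹-involutive (δ δ₂ a)) ⟨
      (-ᴹ (-ᴹ δ δ₂ a)) +ᴹ (-ᴹ δ δ₁ a)
        ≈⟨ GP.⁻¹-∙-comm (-ᴹ δ δ₂ a) (δ δ₁ a) ⟩
      -ᴹ ((-ᴹ δ δ₂ a) +ᴹ δ δ₁ a)
        ≈⟨ G.⁻¹-cong (G.comm (-ᴹ δ δ₂ a) (δ δ₁ a)) ⟩
      -ᴹ (δ δ₁ a +ᴹ (-ᴹ δ δ₂ a))
        ≈⟨ G.⁻¹-cong (h a) ⟩
      -ᴹ inner U a
        ≈⟨ inner-neg U a ⟨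
      inner (-ᴹ U) a ∎

    ∼-trans : ∀ {δ₁ δ₂ δ₃} → δ₁ ∼ δ₂ → δ₂ ∼ δ₃ → δ₁ ∼ δ₃
    ∼-trans {δ₁} {δ₂} {δ₃} (U , h) (V , k) = U +ᴹ V , λ a → begin
      δ δ₁ a +ᴹ (-ᴹ δ δ₃ a)
        ≈⟨ G.∙-congˡ {x = δ δ₁ a} (G.identityˡ (-ᴹ δ δ₃ a)) ⟨
      δ δ₁ a +ᴹ (0ᴹ +ᴹ (-ᴹ δ δ₃ a))
        ≈⟨ G.∙-congˡ {x = δ δ₁ a} (G.∙-congʳ (G.inverseˡ (δ δ₂ a))) ⟨
      δ δ₁ a +ᴹ (((-ᴹ δ δ₂ a) +ᴹ δ δ₂ a) +ᴹ (-ᴹ δ δ₃ a))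
        ≈⟨ G.∙-congˡ {x = δ δ₁ a} (G.assoc (-ᴹ δ δ₂ a) (δ δ₂ a) (-ᴹ δ δ₃ a)) ⟩
      δ δ₁ a +ᴹ ((-ᴹ δ δ₂ a) +ᴹ (δ δ₂ a +ᴹ (-ᴹ δ δ₃ a)))
        ≈⟨ G.assoc (δ δ₁ a) (-ᴹ δ δ₂ a) (δ δ₂ a +ᴹ (-ᴹ δ δ₃ a)) ⟨
      (δ δ₁ a +ᴹ (-ᴹ δ δ₂ a)) +ᴹ (δ δ₂ a +ᴹ (-ᴹ δ δ₃ a))
        ≈⟨ G.∙-cong (h a) (k a) ⟩
      inner U a +ᴹ inner V a
        ≈⟨ inner-+ U V a ⟨
      inner (U +ᴹ V) a ∎

    +ᴰ-cong : ∀ {δ₁ δ₂ ε₁ ε₂} → δ₁ ∼ δ₂ → ε₁ ∼ ε₂ → (δ₁ +ᴰ ε₁) ∼ (δ₂ +ᴰ ε₂)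
    +ᴰ-cong {δ₁} {δ₂} {ε₁} {ε₂} (U , h) (V , k) = U +ᴹ V , λ a → begin
      (δ δ₁ a +ᴹ δ ε₁ a) +ᴹ (-ᴹ (δ δ₂ a +ᴹ δ ε₂ a))
        ≈⟨ G.∙-congˡ (GP.⁻¹-∙-comm (δ δ₂ a) (δ ε₂ a)) ⟨
      (δ δ₁ a +ᴹ δ ε₁ a) +ᴹ ((-ᴹ δ δ₂ a) +ᴹ (-ᴹ δ ε₂ a))
        ≈⟨ interchange (δ δ₁ a) (δ ε₁ a) (-ᴹ δ δ₂ a) (-ᴹ δ ε₂ a) ⟩
      (δ δ₁ a +ᴹ (-ᴹ δ δ₂ a)) +ᴹ (δ ε₁ a +ᴹ (-ᴹ δ ε₂ a))
        ≈⟨ G.∙-cong (h a) (k a) ⟩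
      inner U a +ᴹ inner V a
        ≈⟨ inner-+ U V a ⟨
      inner (U +ᴹ V) a ∎

    -ᴰ-cong : ∀ {δ₁ δ₂} → δ₁ ∼ δ₂ → (-ᴰ δ₁) ∼ (-ᴰ δ₂)
    -ᴰ-cong {δ₁} {δ₂} (U , h) = -ᴹ U , λ a → begin
      (-ᴹ δ δ₁ a) +ᴹ (-ᴹ (-ᴹ δ δ₂ a))
        ≈⟨ GP.⁻¹-∙-comm (δ δ₁ a) (-ᴹ δ δ₂ a) ⟩
      -ᴹ (δ δ₁ a +ᴹ (-ᴹ δ δ₂ a))
        ≈⟨ G.⁻¹-cong (h a) ⟩
      -ᴹ inner U a
        ≈⟨ inner-neg U a ⟨
      inner (-ᴹ U) a ∎

    *ᴰ-congʳ : ∀ a {δ₁ δ₂} → δ₁ ∼ δ₂ → (a *ᴰ δ₁) ∼ (a *ᴰ δ₂)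
    *ᴰ-congʳ a {δ₁} {δ₂} (U , h) = act Ψ a *ᴹ U , λ b → begin
      act Ψ a *ᴹ δ δ₁ b +ᴹ (-ᴹ (act Ψ a *ᴹ δ δ₂ b))
        ≈⟨ G.∙-congˡ (negʳ (act Ψ a) (δ δ₂ b)) ⟨
      act Ψ a *ᴹ δ δ₁ b +ᴹ act Ψ a *ᴹ (-ᴹ δ δ₂ b)
        ≈⟨ MKτ.*ᴹ-distribˡ (act Ψ a) (δ δ₁ b) (-ᴹ δ δ₂ b) ⟨
      act Ψ a *ᴹ (δ δ₁ b +ᴹ (-ᴹ δ δ₂ b))
        ≈⟨ MKτ.*ᴹ-cong {M = act Ψ a} (λ _ _ → Kτ.refl) (h b) ⟩
      act Ψ a *ᴹ inner U b
        ≈⟨ inner-act a U b ⟨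
      inner (act Ψ a *ᴹ U) b ∎

    act-congˡ : ∀ {M N : Mat e e} → M ≈ᴹ N → (P : Mat e d) → M *ᴹ P ≈ᴹ N *ᴹ P
    act-congˡ p P = MKτ.*ᴹ-cong {N = P} p (λ _ _ → Kτ.refl)

    Ext¹ : LeftModule A.polynomialRing (c ⊔ ℓ₁ ⊔ c′ ⊔ ℓ₁′) (c ⊔ c′ ⊔ ℓ₁′)
    Ext¹ = record
      { Carrierᴹ = Der
      ; _≈ᴹ_ = _∼_
      ; _+ᴹ_ = _+ᴰ_
      ; _*ₗ_ = _*ᴰ_
      ; 0ᴹ = 0ᴰ
      ; -ᴹ_ = -ᴰ_
      ; isLeftModule = record
        { isLeftSemimodule = record
          { +ᴹ-isCommutativeMonoid = record
            { isMonoid = record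
              { isSemigroup = record
                { isMagma = record
                  { isEquivalence = record
                    { refl  = λ {x} → ≈⇒∼ {x} {x} λ _ → G.refl
                    ; sym   = λ {x} {y} → ∼-sym {x} {y}
                    ; trans = λ {x} {y} {z} → ∼-trans {x} {y} {z} }
                  ; ∙-cong = λ {x} {y} {u} {v} → +ᴰ-cong {x} {y} {u} {v} }
                ; assoc = λ x y z → ≈⇒∼ {(x +ᴰ y) +ᴰ z} {x +ᴰ (y +ᴰ z)}
                    λ a → G.assoc (δ x a) (δ y a) (δ z a) }
              ; identity = (λ x → ≈⇒∼ {0ᴰ +ᴰ x} {x} λ a → G.identityˡ (δ x a))
                         , (λ x → ≈⇒∼ {x +ᴰ 0ᴰ} {x} λ a → G.identityʳ (δ x a)) }
            ; comm = λ x y → ≈⇒∼ {x +ᴰ y} {y +ᴰ x} λ a → G.comm (δ x a) (δ y a) }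
          ; isPreleftSemimodule = record
            { *ₗ-cong      = λ {a} {b} {x} {y} a≈b x∼y →
                ∼-trans {a *ᴰ x} {b *ᴰ x} {b *ᴰ y}
                  (≈⇒∼ {a *ᴰ x} {b *ᴰ x} λ z → act-congˡ (HΨ.⟦⟧-cong a≈b) (δ x z))
                  (*ᴰ-congʳ b {x} {y} x∼y)
            ; *ₗ-zeroˡ     = λ x → ≈⇒∼ {A.0# *ᴰ x} {0ᴰ} λ b →
                G.trans (act-congˡ HΨ.0#-homo (δ x b)) (*ᴹ-zeroˡ (δ x b))
            ; *ₗ-distribʳ  = λ x a b → ≈⇒∼ {(a A.+ b) *ᴰ x} {(a *ᴰ x) +ᴰ (b *ᴰ x)} λ z →
                G.trans (act-congˡ (HΨ.+-homo a b) (δ x z))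
                        (MKτ.*ᴹ-distribʳ (δ x z) (act Ψ a) (act Ψ b))
            ; *ₗ-identityˡ = λ x → ≈⇒∼ {A.1# *ᴰ x} {x} λ z →
                G.trans (act-congˡ HΨ.1#-homo (δ x z)) (MKτ.*ᴹ-identityˡ (δ x z))
            ; *ₗ-assoc     = λ a b x → ≈⇒∼ {(a A.* b) *ᴰ x} {a *ᴰ (b *ᴰ x)} λ z →
                G.trans (act-congˡ (HΨ.*-homo a b) (δ x z))
                        (MKτ.*ᴹ-assoc (act Ψ a) (act Ψ b) (δ x z))
            ; *ₗ-zeroʳ     = λ a → ≈⇒∼ {a *ᴰ 0ᴰ} {0ᴰ} λ _ → *ᴹ-zeroʳ (act Ψ a)
            ; *ₗ-distribˡ  = λ a x y → ≈⇒∼ {a *ᴰ (x +ᴰ y)} {(a *ᴰ x) +ᴰ (a *ᴰ y)} λ z →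
                MKτ.*ᴹ-distribˡ (act Ψ a) (δ x z) (δ y z) } }
        ; -ᴹ‿cong = λ {x} {y} → -ᴰ-cong {x} {y}
        ; -ᴹ‿inverse = (λ x → ≈⇒∼ {(-ᴰ x) +ᴰ x} {0ᴰ} λ a → G.inverseˡ (δ x a))
                     , (λ x → ≈⇒∼ {x +ᴰ (-ᴰ x)} {0ᴰ} λ a → G.inverseʳ (δ x a)) } }

  infix 4 _≅_
  _≅_ : ∀ {m₁ ℓm₁ m₂ ℓm₂} → LeftModule A.polynomialRing m₁ ℓm₁ →
        LeftModule A.polynomialRing m₂ ℓm₂ → Set (c ⊔ m₁ ⊔ ℓm₁ ⊔ m₂ ⊔ ℓm₂)
  M ≅ N = ∃[ f ] IsLeftModuleIsomorphism f
    where
    open ModuleMorphisms.LeftModuleMorphisms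
      (LeftModule.rawLeftModule M) (LeftModule.rawLeftModule N)

sumℕ : ∀ {n} → (Fin n → ℕ) → ℕ
sumℕ = RawMonoidDefs.sum ℕ.+-0-rawMonoid

{-# OPTIONS --safe #-}

-- A derivation is determined by its value at t, which may be any m × n matrix
-- over K{τ}; so Ext¹ splits into the quotients of K{τ} by the subgroups
-- { uφᵢ(t) − ψⱼ(t)u }.  As deg φᵢ(t) > deg ψⱼ(t) and the leading coefficient of
-- φᵢ(t) is a unit, division with remainder gives every class a unique
-- representative of degree < rk φᵢ, i.e. a vector of rk φᵢ elements of K.
-- The remainder of ψⱼ(t)xτᵏ depends on x through polynomials in τ, and these
-- are the entries of Π_t; only the term ψⱼ(t)₀xτᵏ = θxτᵏ, which needs no
-- division, contributes to their constant coefficients, so ∂Π_t = θI.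

module Submission where

open import Algebra.Apartness.Bundles using (HeytingField)
import Algebra.Apartness.Properties.HeytingCommutativeRing as HeytingProperties
open import Algebra.Bundles
open import Algebra.Module.Bundles using (LeftModule)
open import Algebra.Morphism.Structures using (IsRingHomomorphism)
import Algebra.Properties.AbelianGroup as AbelianGroupProperties
import Algebra.Properties.CommutativeMonoid.Sum as CommutativeMonoidSum
import Algebra.Properties.CommutativeSemigroup as CommutativeSemigroupProperties
import Algebra.Properties.Group as GroupProperties
import Algebra.Properties.Ring as RingProperties
import Algebra.Properties.Semiring.Exp as Exp
import Algebra.Properties.Semiring.Sum as SemiringSum
open import Data.Bool.Base using (true; false; if_then_else_)
open import Data.Fin.Base using (Fin; zero; suc; toℕ; _↑ˡ_; _↑ʳ_; splitAt; combine; remQuot)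
open import Data.Fin.Permutation using (Permutation′)
import Data.Fin.Properties as Fin
open import Data.List.Base using ([]; _∷_; tabulate; length)
open import Data.List.Properties using (map-id)
open import Data.Nat.Base as ℕ using (ℕ; zero; suc; z≤n; s≤s; _≤_; _<_; _∸_; NonZero)
open import Data.Nat.Divisibility using (divides)
import Data.Nat.Properties as ℕ
open import Data.Product using (_,_; _×_; Σ-syntax; ∃-syntax; proj₁; proj₂; map₂)
open import Data.Sum.Base using (inj₁; inj₂; [_,_]′)
open import Function.Base using (_∘_; id)
open import Function.Bundles using (Inverse; Equivalence; mk↔ₛ′)
open import Level using (_⊔_)
open import Relation.Binary.PropositionalEquality as ≡ using (_≡_; _≢_)
import Relation.Binary.Reasoning.Setoid as SetoidReasoning
open import Relation.Nullary using (¬_; does; yes; no; contradiction)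
open import Relation.Nullary.Decidable using (dec-true; dec-false)

open import Defs

-- Fermat's little theorem in a finite Heyting field

-- Three points lie behind the outline. Scalars: building a derivation from its value at t, or Π
-- from Π_t, requires the constants η(x) to be central in K{τ}, that is, fixed by the q-power
-- Frobenius. The base data only say that 𝔽 has q elements, so x^q = x is proved first; 0 is
-- recognised by its index in Fin q, and apartness is never decided. Degrees: over a Heyting field
-- the degree of a polynomial cannot be computed, so division runs on an upper bound and removes one
-- top coefficient per step, zero or not. It treats a whole family depending on x in K at once,
-- because the entries of Π_t are the formulas in x and not their values. Constant terms: the
-- τ^k-coefficient of ψxτ^k₀ is ψ_{k-k₀}τ^{k-k₀} applied to x, which for k ≥ r > k₀ has no constant
-- term as a polynomial in τ. The corrections made by the division are built from left multiples of
-- such polynomials, and these have no constant term either.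

module FieldProperties {c ℓ₁ ℓ₂} (F : HeytingField c ℓ₁ ℓ₂) where

  open HeytingField F using (_#_; #-irrefl; #⇒invertible; tight; heytingCommutativeRing)
  open CommutativeRing (fieldRing F)
  open HeytingProperties heytingCommutativeRing using (1#0; x-0≈x)
  open SetoidReasoning setoid

  #0⇒invertible : ∀ {x} → x # 0# → ∃[ y ] y * x ≈ 1#
  #0⇒invertible {x} x#0 with #⇒invertible x#0
  ... | y , yx≈1 , _ = y , trans (*-congˡ (sym (x-0≈x x))) yx≈1

  1≉0 : ¬ (1# ≈ 0#)
  1≉0 1≈0 = #-irrefl 1≈0 1#0

  cancelˡ-0 : ∀ {x y} z → z * x ≈ 1# → x * y ≈ 0# → y ≈ 0#
  cancelˡ-0 {x} {y} z zx≈1 xy≈0 = begin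
    y            ≈⟨ *-identityˡ y ⟨
    1# * y       ≈⟨ *-congʳ zx≈1 ⟨
    z * x * y    ≈⟨ *-assoc z x y ⟩
    z * (x * y)  ≈⟨ *-congˡ xy≈0 ⟩
    z * 0#       ≈⟨ zeroʳ z ⟩
    0#           ∎

  -- Tightness turns the goal into refuting `y # 0#`; an inverse of y would force x ≈ 0.
  integral : ∀ {x y} → x * y ≈ 0# → ¬ (x ≈ 0#) → y ≈ 0#
  integral {x} {y} xy≈0 x≉0 = proj₁ (tight y 0#) λ y#0 →
    let z , zy≈1 = #0⇒invertible y#0 in
    x≉0 (cancelˡ-0 z zy≈1 (trans (*-comm y x) xy≈0))

  -- Apartness from 0 is not decidable, but ≈ is the negation of #.
  stable-≈ : ∀ {x y z} → (x # 0# → y ≈ z) → (x ≈ 0# → y ≈ z) → y ≈ z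
  stable-≈ {x} {y} {z} f g = proj₁ (tight y z) λ y#z →
    #-irrefl (g (proj₁ (tight x 0#) λ x#0 → #-irrefl (f x#0) y#z)) y#z

module FiniteField {c ℓ₁ ℓ₂} (F : HeytingField c ℓ₁ ℓ₂) {q : ℕ}
  (F-card : Inverse (CommutativeRing.setoid (fieldRing F)) (≡.setoid (Fin q))) where

  open CommutativeRing (fieldRing F) hiding (zero)
  open RingProperties ring using (x∙y⁻¹≈ε⇒x≈y; -‿distribʳ-*)
  open Exp semiring using (_^_)
  open FieldProperties F
  open Inverse F-card using (to; from; to-cong; strictlyInverseˡ; strictlyInverseʳ)
  open CommutativeMonoidSum *-commutativeMonoid
    renaming ( sum to product; sum-replicate to product-replicate
             ; sum-cong-≋ to product-cong; sum-permute to product-permute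
             ; ∑-distrib-+ to ∏-distrib-*; sum-replicate-zero to product-1)
  open SetoidReasoning setoid

  private
    o : Fin q
    o = to 0#

    split : ∀ {n} (o : Fin n) (x : Fin n → Carrier) (y : Carrier) → Fin n → Carrier
    split o x y i = if does (i Fin.≟ o) then y else x i

    -- The enumeration of 𝔽 with 0 replaced by 1, so that a product over all of Fin q is the product
    -- of the nonzero elements.
    nonzero : Fin q → Carrier
    nonzero = split o from 1#

    product-split : ∀ {n} (o : Fin n) y → product (split o (λ _ → 1#) y) ≈ y
    product-split {suc n} zero    y = trans (*-congˡ (product-1 n)) (*-identityʳ y)
    product-split {suc n} (suc o) y = trans (*-identityˡ _) (product-split o y)

    split-* : ∀ x i → x ≈ split o (λ _ → x) 1# i * split o (λ _ → 1#) x i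
    split-* x i with does (i Fin.≟ o)
    ... | true  = sym (*-identityˡ x)
    ... | false = sym (*-identityʳ x)

    -- The first factor is x^(q-1), written as q factors with a 1 at the index of 0; this avoids a
    -- predecessor of q and matches the shape of `nonzero`.
    ^q-split : ∀ x → x ^ q ≈ product (split o (λ _ → x) 1#) * x
    ^q-split x = begin
      x ^ q
        ≈⟨ product-replicate q ⟨
      product {q} (λ _ → x)
        ≈⟨ product-cong (split-* x) ⟩
      product (λ i → split o (λ _ → x) 1# i * split o (λ _ → 1#) x i)
        ≈⟨ ∏-distrib-* (split o (λ _ → x) 1#) (split o (λ _ → 1#) x) ⟩
      product (split o (λ _ → x) 1#) * product (split o (λ _ → 1#) x)
        ≈⟨ *-congˡ (product-split o x) ⟩
      product (split o (λ _ → x) 1#) * x ∎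

    from≈0 : ∀ {i} → from i ≈ 0# → i ≡ o
    from≈0 {i} h = ≡.trans (≡.sym (strictlyInverseˡ i)) (to-cong h)

    nonzero≉0 : ∀ i → ¬ (nonzero i ≈ 0#)
    nonzero≉0 i with i Fin.≟ o
    ... | yes _  = 1≉0
    ... | no i≢o = λ h → i≢o (from≈0 h)

    product≉0 : ∀ {n} (f : Fin n → Carrier) → (∀ i → ¬ (f i ≈ 0#)) → ¬ (product f ≈ 0#)
    product≉0 {zero}  f f≉0 h = 1≉0 h
    product≉0 {suc n} f f≉0 h = product≉0 (f ∘ suc) (f≉0 ∘ suc) (integral h (f≉0 zero))

    module _ {x y} (yx≈1 : y * x ≈ 1#) where

      scale-inverse : ∀ {x y} → y * x ≈ 1# → ∀ i → to (y * from (to (x * from i))) ≡ i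
      scale-inverse {x} {y} yx≈1 i = ≡.trans (to-cong (begin
        y * from (to (x * from i)) ≈⟨ *-congˡ (strictlyInverseʳ (x * from i)) ⟩
        y * (x * from i)           ≈⟨ *-assoc y x (from i) ⟨
        y * x * from i             ≈⟨ *-congʳ yx≈1 ⟩
        1# * from i                ≈⟨ *-identityˡ (from i) ⟩
        from i                     ∎)) (strictlyInverseˡ i)

      scale : Permutation′ q
      scale = mk↔ₛ′ (λ i → to (x * from i)) (λ i → to (y * from i))
        (scale-inverse (trans (*-comm x y) yx≈1)) (scale-inverse yx≈1)

      -- Multiplication by x fixes the index of 0, where both sides carry the filler 1; this is why
      -- the factor there is 1 and not x.
      nonzero-scale : ∀ i → nonzero (to (x * from i)) ≈ split o (λ _ → x) 1# i * nonzero i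
      nonzero-scale i with i Fin.≟ o | to (x * from i) Fin.≟ o
      ... | yes _   | yes _   = sym (*-identityˡ 1#)
      ... | no _    | no _    = strictlyInverseʳ (x * from i)
      ... | yes i≡o | no xi≢o = contradiction
        (to-cong (trans (*-congˡ (trans (reflexive (≡.cong from i≡o)) (strictlyInverseʳ 0#))) (zeroʳ x))) xi≢o
      ... | no i≢o  | yes xi≡o = contradiction
        (from≈0 (cancelˡ-0 y yx≈1 (begin
          x * from i             ≈⟨ strictlyInverseʳ (x * from i) ⟨
          from (to (x * from i)) ≡⟨ ≡.cong from xi≡o ⟩
          from (to 0#)           ≈⟨ strictlyInverseʳ 0# ⟩
          0#                     ∎))) i≢o

      -- Here u stands for x^(q-1). The product P of all nonzero elements satisfies P = uP; P is
      -- only known to be unequal to 0, so it is cancelled by `integral` from P(u - 1) = 0.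
      product-units : product (split o (λ _ → x) 1#) ≈ 1#
      product-units = x∙y⁻¹≈ε⇒x≈y u 1# (integral (begin
        P * (u - 1#)        ≈⟨ distribˡ P u (- 1#) ⟩
        P * u + P * - 1#    ≈⟨ +-cong (*-comm P u) (sym (-‿distribʳ-* P 1#)) ⟩
        u * P - P * 1#      ≈⟨ +-cong (sym P≈uP) (-‿cong (*-identityʳ P)) ⟩
        P - P               ≈⟨ -‿inverseʳ P ⟩
        0#                  ∎) (product≉0 nonzero nonzero≉0))
        where
        P = product nonzero
        u = product (split o (λ _ → x) 1#)
        P≈uP : P ≈ u * P
        P≈uP = begin
          P
            ≈⟨ product-permute nonzero scale ⟩
          product (λ i → nonzero (to (x * from i)))
            ≈⟨ product-cong nonzero-scale ⟩
          product (λ i → split o (λ _ → x) 1# i * nonzero i)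
            ≈⟨ ∏-distrib-* (split o (λ _ → x) 1#) nonzero ⟩
          u * P ∎

  -- Multiplication by a unit x permutes the nonzero elements; compare their
  -- products.
  x^q≈x : ∀ x → x ^ q ≈ x
  x^q≈x x = stable-≈ {x}
    (λ x#0 → let y , yx≈1 = #0⇒invertible x#0 in
      trans (^q-split x) (trans (*-congʳ (product-units yx≈1)) (*-identityˡ x)))
    (λ x≈0 → trans (^q-split x) (trans (*-congˡ x≈0) (trans (zeroʳ _) (sym x≈0))))

-- Division with remainder in skew polynomials

module SkewReduction {c ℓ} (R : CommutativeRing c ℓ)
  (σ : CommutativeRing.Carrier R → CommutativeRing.Carrier R)
  (σ-hom : IsRingHomomorphism (CommutativeRing.rawRing R) (CommutativeRing.rawRing R) σ)
  where

  open CommutativeRing R hiding (zero)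
  open SkewPolynomial R σ σ-hom
  private
    module σ = IsRingHomomorphism σ-hom
    module S = Ring skewRing
    module AP = AbelianGroupProperties S.+-abelianGroup
  open RingProperties ring using (-0#≈0#; -‿distribˡ-*; -‿+-comm; x∙y⁻¹≈ε⇒x≈y)
  open SetoidReasoning setoid

  -- The new σ is applied innermost, as in the recursions of `conv` and `eval`, which pass σ into
  -- their second argument.
  σ^ : ℕ → Carrier → Carrier
  σ^ zero    x = x
  σ^ (suc m) x = σ^ m (σ x)

  σ^-cong : ∀ m {x y} → x ≈ y → σ^ m x ≈ σ^ m y
  σ^-cong zero    p = p
  σ^-cong (suc m) p = σ^-cong m (σ.⟦⟧-cong p)

  σ^-0 : ∀ m → σ^ m 0# ≈ 0#
  σ^-0 zero    = refl
  σ^-0 (suc m) = trans (σ^-cong m σ.0#-homo) (σ^-0 m)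

  σ^-1 : ∀ m → σ^ m 1# ≈ 1#
  σ^-1 zero    = refl
  σ^-1 (suc m) = trans (σ^-cong m σ.1#-homo) (σ^-1 m)

  σ^-* : ∀ m x y → σ^ m (x * y) ≈ σ^ m x * σ^ m y
  σ^-* zero    x y = refl
  σ^-* (suc m) x y = trans (σ^-cong m (σ.*-homo x y)) (σ^-* m (σ x) (σ y))

  monomial : ℕ → Carrier → Poly
  monomial zero    b = const b
  monomial (suc m) b = 0# ∷ monomial m b

  -- Multiplication by τ^m on coefficient sequences. It is polymorphic because the division shifts
  -- both sequences of coefficients and sequences of polynomials that evaluate to them; `shift-lift`
  -- relates the two.
  shift : ∀ {a} {A : Set a} → A → ℕ → (ℕ → A) → ℕ → A
  shift o zero    s k       = s k
  shift o (suc m) s zero    = o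
  shift o (suc m) s (suc k) = shift o m s k

  shift-lift : ∀ {a b p} {A : Set a} {B : Set b} (P : A → B → Set p)
    {o o′} → P o o′ → ∀ {s s′} → (∀ l → P (s l) (s′ l)) →
    ∀ m k → P (shift o m s k) (shift o′ m s′ k)
  shift-lift P Po Ps zero    k       = Ps k
  shift-lift P Po Ps (suc m) zero    = Po
  shift-lift P Po Ps (suc m) (suc k) = shift-lift P Po Ps m k

  shift-+ : ∀ {a} {A : Set a} {o : A} {s} m l → shift o m s (m ℕ.+ l) ≡ s l
  shift-+ zero    l = ≡.refl
  shift-+ (suc m) l = shift-+ m l

  eval-monomial : ∀ l a x → eval (monomial l a) x ≈ a * σ^ l x
  eval-monomial zero    a x = eval-const a x
  eval-monomial (suc l) a x =
    trans (+-cong (zeroˡ x) (eval-monomial l a (σ x))) (+-identityˡ _)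

  eval-⊖ : ∀ f x → eval (⊖ f) x ≈ - eval f x
  eval-⊖ []      x = sym -0#≈0#
  eval-⊖ (a ∷ f) x =
    trans (+-cong (sym (-‿distribˡ-* a x)) (eval-⊖ f (σ x))) (-‿+-comm _ _)

  conv-vanishˡ : ∀ {f : Seq} g → (∀ k → f k ≈ 0#) → ∀ k → conv f g k ≈ 0#
  conv-vanishˡ g f≈0 k = trans (conv-cong f≈0 (λ _ → refl) k) (conv-zeroˡ g k)

  conv-monomialˡ : ∀ m b (g : Seq) k →
    conv (coeff (monomial m b)) g k ≈ shift 0# m (λ l → b * σ^ m (g l)) k
  conv-monomialˡ zero    b g zero    = refl
  conv-monomialˡ zero    b g (suc k) = trans (+-congˡ (conv-zeroˡ (σ ∘ g) k)) (+-identityʳ _)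
  conv-monomialˡ (suc m) b g zero    = zeroˡ _
  conv-monomialˡ (suc m) b g (suc k) =
    trans (+-cong (zeroˡ _) (conv-monomialˡ m b (σ ∘ g) k)) (+-identityˡ _)

  conv-constʳ : ∀ (f s : Seq) → (∀ k → s (suc k) ≈ 0#) → ∀ k → conv f s k ≈ f k * σ^ k (s 0)
  conv-constʳ f s s≈0 zero    = refl
  conv-constʳ f s s≈0 (suc k) = trans
    (+-cong (trans (*-congˡ (s≈0 k)) (zeroʳ _))
            (conv-constʳ (f ∘ suc) (σ ∘ s) (λ l → trans (σ.⟦⟧-cong (s≈0 l)) σ.0#-homo) k))
    (+-identityˡ _)

  -- `conv` recurses on its left factor, so a shift of the right factor has to be carried through
  -- all of its steps.
  conv-tailʳ : ∀ (f s : Seq) → s 0 ≈ 0# → ∀ k → conv f s (suc k) ≈ conv f (s ∘ suc) k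
  conv-tailʳ f s s₀≈0 zero    = trans
    (+-congˡ (trans (*-congˡ (trans (σ.⟦⟧-cong s₀≈0) σ.0#-homo)) (zeroʳ _))) (+-identityʳ _)
  conv-tailʳ f s s₀≈0 (suc k) =
    +-congˡ (conv-tailʳ (f ∘ suc) (σ ∘ s) (trans (σ.⟦⟧-cong s₀≈0) σ.0#-homo) k)

  conv-monomialʳ : ∀ m b (f : Seq) k →
    conv f (coeff (monomial m b)) k ≈ shift 0# m (λ l → f l * σ^ l b) k
  conv-monomialʳ zero    b f k       = conv-constʳ f (coeff (const b)) (λ _ → refl) k
  conv-monomialʳ (suc m) b f zero    = zeroʳ _
  conv-monomialʳ (suc m) b f (suc k) =
    trans (conv-tailʳ f (coeff (monomial (suc m) b)) refl k) (conv-monomialʳ m b f k)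

  -- Of the products landing in degree m + n, all but one have a factor beyond its degree bound. The
  -- bounds need not be attained.
  conv-top : ∀ m n {f g : Seq} → (∀ k → m < k → f k ≈ 0#) → (∀ k → n < k → g k ≈ 0#) →
             conv f g (m ℕ.+ n) ≈ f m * σ^ m (g n)
  conv-top zero zero    f≈0 g≈0 = refl
  conv-top zero (suc n) {g = g} f≈0 g≈0 = trans
    (+-congˡ (conv-vanishˡ (σ ∘ g) (λ k → f≈0 (suc k) (s≤s z≤n)) n)) (+-identityʳ _)
  conv-top (suc m) n {f} {g} f≈0 g≈0 = trans
    (+-cong (trans (*-congˡ (g≈0 _ (s≤s (ℕ.m≤n+m n m)))) (zeroʳ _))
            (conv-top m n (λ k m<k → f≈0 (suc k) (s≤s m<k))
                          (λ k n<k → trans (σ.⟦⟧-cong (g≈0 k n<k)) σ.0#-homo)))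
    (+-identityˡ _)

  coeff-length : ∀ f k → length f ≤ k → coeff f k ≡ 0#
  coeff-length []      k       _       = ≡.refl
  coeff-length (a ∷ f) (suc k) (s≤s p) = coeff-length f k p

  coeff-tabulate : ∀ {n} (v : Fin n → Carrier) k → coeff (tabulate v) (toℕ k) ≡ v k
  coeff-tabulate v zero    = ≡.refl
  coeff-tabulate v (suc k) = coeff-tabulate (v ∘ suc) k

  coeff-tabulate-≥ : ∀ {n} (v : Fin n → Carrier) k → n ≤ k → coeff (tabulate v) k ≡ 0#
  coeff-tabulate-≥ {zero}  v k       _       = ≡.refl
  coeff-tabulate-≥ {suc n} v (suc k) (s≤s p) = coeff-tabulate-≥ (v ∘ suc) k p

  ≈-coeff-tabulate : ∀ {n} (s : Seq) (v : Fin n → Carrier) →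
    (∀ k → s (toℕ k) ≈ v k) → (∀ k → n ≤ k → s k ≈ 0#) → ∀ k → s k ≈ coeff (tabulate v) k
  ≈-coeff-tabulate {zero}  s v p q k       = q k z≤n
  ≈-coeff-tabulate {suc n} s v p q zero    = p zero
  ≈-coeff-tabulate {suc n} s v p q (suc k) =
    ≈-coeff-tabulate (s ∘ suc) (v ∘ suc) (p ∘ suc) (λ l n≤l → q (suc l) (s≤s n≤l)) k

  tabulate-cong : ∀ {n} {v w : Fin n → Carrier} → (∀ k → v k ≈ w k) → tabulate v ≋ tabulate w
  tabulate-cong {n} {v} {w} p = mk≋ (≈-coeff-tabulate (coeff (tabulate v)) w
    (λ k → trans (reflexive (coeff-tabulate v k)) (p k))
    (λ k n≤k → reflexive (coeff-tabulate-≥ v k n≤k)))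

  tabulate-⊕ : ∀ {n} (v w : Fin n → Carrier) →
    tabulate (λ k → v k + w k) ≋ tabulate v ⊕ tabulate w
  tabulate-⊕ {zero}  v w = S.refl
  tabulate-⊕ {suc n} v w = mk≋ λ where
    zero    → refl
    (suc k) → coeff-≈ (tabulate-⊕ (v ∘ suc) (w ∘ suc)) k

  tabulate-0 : ∀ n → tabulate {n = n} (λ _ → 0#) ≋ []
  tabulate-0 n = mk≋ λ k →
    sym (≈-coeff-tabulate {n} (λ _ → 0#) (λ _ → 0#) (λ _ → refl) (λ _ _ → refl) k)

  tabulate-monomial : ∀ {n} (k₀ : Fin n) x →
    tabulate (λ k → if does (k Fin.≟ k₀) then x else 0#) ≋ monomial (toℕ k₀) x
  tabulate-monomial {suc n} zero     x = mk≋ λ where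
    zero    → refl
    (suc k) → coeff-≈ (tabulate-0 n) k
  tabulate-monomial {suc n} (suc k₀) x = mk≋ λ where
    zero    → refl
    (suc k) → coeff-≈ (tabulate-monomial k₀ x) k

  ⊙≋const⊗ : ∀ a f → a ⊙ f ≋ const a ⊗ f
  ⊙≋const⊗ a f = mk≋ λ k → sym (trans (coeff-⊕ (a ⊙ f) (0# ∷ []) k)
    (trans (+-congˡ (0∷[] k)) (+-identityʳ _)))
    where
    0∷[] : ∀ k → coeff (0# ∷ []) k ≈ 0#
    0∷[] zero    = refl
    0∷[] (suc k) = refl

  tabulate-⊙ : ∀ {n} a (v : Fin n → Carrier) → tabulate (λ k → a * v k) ≋ const a ⊗ tabulate v
  tabulate-⊙ {n} a v = S.trans (mk≋ λ k → sym (≈-coeff-tabulate (coeff (a ⊙ tabulate v)) (λ k → a * v k)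
    (λ k → trans (coeff-map (zeroʳ a) (tabulate v) (toℕ k)) (*-congˡ (reflexive (coeff-tabulate v k))))
    (λ k n≤k → trans (coeff-map (zeroʳ a) (tabulate v) k)
      (trans (*-congˡ (reflexive (coeff-tabulate-≥ v k n≤k))) (zeroʳ a))) k)) (⊙≋const⊗ a (tabulate v))

  module Modulo (φ ψ : Poly) where

    inner : Poly → Poly
    inner u = u ⊗ φ ⊕ ⊖ (ψ ⊗ u)

    infix 4 _~_
    record _~_ (f g : Poly) : Set (c ⊔ ℓ) where
      constructor mk~
      field
        multiplier : Poly
        difference : f ⊕ ⊖ g ≋ inner multiplier

    inner-⊕ : ∀ u v → inner (u ⊕ v) ≋ inner u ⊕ inner v
    inner-⊕ u v = S.trans
      (⊕-cong (S.distribʳ φ u v)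
        (S.trans (S.-‿cong (S.distribˡ ψ u v)) (S.sym (AP.⁻¹-∙-comm (ψ ⊗ u) (ψ ⊗ v)))))
      (interchange (u ⊗ φ) (v ⊗ φ) (⊖ (ψ ⊗ u)) (⊖ (ψ ⊗ v)))
      where
      open CommutativeSemigroupProperties
        (CommutativeMonoid.commutativeSemigroup S.+-commutativeMonoid) using (interchange)

    inner-[] : inner [] ≋ []
    inner-[] = S.-‿cong (S.zeroʳ ψ)

    ≋⇒~ : ∀ {f g} → f ≋ g → f ~ g
    ≋⇒~ {f} {g} p = mk~ [] ( S.trans (⊕-cong p S.refl) (S.trans (S.-‿inverseʳ g) (S.sym inner-[])))

    ~-trans : ∀ {f g h} → f ~ g → g ~ h → f ~ h
    ~-trans {f} {g} {h} (mk~ u p) (mk~ v q) = mk~ (u ⊕ v) (S.trans (S.sym telescope)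
      (S.trans (⊕-cong p q) (S.sym (inner-⊕ u v))))
      where
      telescope : (f ⊕ ⊖ g) ⊕ (g ⊕ ⊖ h) ≋ f ⊕ ⊖ h
      telescope = S.trans (S.+-assoc f (⊖ g) (g ⊕ ⊖ h))
        (⊕-cong (S.refl {f}) (AP.\\-leftDividesʳ g (⊖ h)))

    subtract-inner : ∀ f u → f ~ f ⊕ ⊖ inner u
    subtract-inner f u = mk~ u (S.trans
      (⊕-cong (S.refl {f}) (S.sym (AP.⁻¹-∙-comm f (⊖ inner u))))
      (S.trans (AP.\\-leftDividesˡ f (⊖ ⊖ inner u)) (AP.⁻¹-involutive (inner u))))

    coeff-inner : ∀ u k → coeff (inner u) k ≈ conv (coeff u) (coeff φ) k - conv (coeff ψ) (coeff u) k
    coeff-inner u k = trans (coeff-⊕ (u ⊗ φ) (⊖ (ψ ⊗ u)) k) (+-cong (coeff-⊗ u φ k)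
      (trans (coeff-⊖ (ψ ⊗ u) k) (-‿cong (coeff-⊗ ψ u k))))

    -- φ has degree r with leading coefficient inverted by α. The bound on ψ starts at r itself:
    -- this is the strict inequality of ranks.
    module Division {r} (φ-deg : ∀ k → r < k → coeff φ k ≈ 0#)
      (α : Carrier) (α-inv : α * coeff φ r ≈ 1#)
      (ψ-deg : ∀ k → r ≤ k → coeff ψ k ≈ 0#) where

      σ^α-inv : ∀ m → σ^ m α * σ^ m (coeff φ r) ≈ 1#
      σ^α-inv m = trans (sym (σ^-* m α (coeff φ r))) (trans (σ^-cong m α-inv) (σ^-1 m))

      -- uφ has degree r + deg u, which ψu cannot reach.
      inner-injective : ∀ m u → (∀ k → m ≤ k → coeff u k ≈ 0#) →
        (∀ k → r ≤ k → coeff (inner u) k ≈ 0#) → ∀ k → coeff u k ≈ 0#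
      inner-injective zero    u u-deg _  k = u-deg k z≤n
      -- The induction lowers a bound on the degree of u: the coefficient at the bound is shown to
      -- vanish, with no need to know the true degree.
      inner-injective (suc m) u u-deg iu = inner-injective m u u-deg′ iu
        where
        lead : coeff u m * σ^ m (coeff φ r) ≈ 0#
        lead = begin
          coeff u m * σ^ m (coeff φ r)
            ≈⟨ conv-top m r u-deg φ-deg ⟨
          conv (coeff u) (coeff φ) (m ℕ.+ r)
            ≈⟨ trans (+-congˡ -0#≈0#) (+-identityʳ _) ⟨
          conv (coeff u) (coeff φ) (m ℕ.+ r) - 0#
            ≈⟨ +-congˡ (-‿cong ψu≈0) ⟨
          conv (coeff u) (coeff φ) (m ℕ.+ r) - conv (coeff ψ) (coeff u) (m ℕ.+ r)
            ≈⟨ coeff-inner u (m ℕ.+ r) ⟨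
          coeff (inner u) (m ℕ.+ r)
            ≈⟨ iu (m ℕ.+ r) (ℕ.m≤n+m r m) ⟩
          0# ∎
          where
          ψu≈0 : conv (coeff ψ) (coeff u) (m ℕ.+ r) ≈ 0#
          ψu≈0 = begin
            conv (coeff ψ) (coeff u) (m ℕ.+ r)
              ≡⟨ ≡.cong (conv (coeff ψ) (coeff u)) (ℕ.+-comm m r) ⟩
            conv (coeff ψ) (coeff u) (r ℕ.+ m)
              ≈⟨ conv-top r m (λ k r<k → ψ-deg k (ℕ.<⇒≤ r<k)) u-deg ⟩
            coeff ψ r * σ^ r (coeff u m)
              ≈⟨ *-congʳ (ψ-deg r ℕ.≤-refl) ⟩
            0# * σ^ r (coeff u m)
              ≈⟨ zeroˡ _ ⟩
            0# ∎
        uₘ≈0 : coeff u m ≈ 0#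
        uₘ≈0 = begin
          coeff u m                                   ≈⟨ *-identityʳ _ ⟨
          coeff u m * 1#                              ≈⟨ *-congˡ (trans (*-comm _ _) (σ^α-inv m)) ⟨
          coeff u m * (σ^ m (coeff φ r) * σ^ m α)     ≈⟨ *-assoc _ _ _ ⟨
          coeff u m * σ^ m (coeff φ r) * σ^ m α       ≈⟨ *-congʳ lead ⟩
          0# * σ^ m α                                 ≈⟨ zeroˡ _ ⟩
          0#                                          ∎
        u-deg′ : ∀ k → m ≤ k → coeff u k ≈ 0#
        u-deg′ k m≤k with ℕ.m≤n⇒m<n∨m≡n m≤k
        ... | inj₁ m<k    = u-deg k m<k
        ... | inj₂ ≡.refl = uₘ≈0

      -- Two remainders differ by some uφ - ψu of degree below r. Then u = 0 by `inner-injective`,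
      -- started at the length of the list u, and the difference is 0.
      remainder-unique : ∀ (v w : Fin r → Carrier) → tabulate v ~ tabulate w → ∀ k → v k ≈ w k
      remainder-unique v w (mk~ u p) k = x∙y⁻¹≈ε⇒x≈y (v k) (w k) (begin
        v k - w k
          ≡⟨ ≡.cong₂ (λ a b → a - b) (coeff-tabulate v k) (coeff-tabulate w k) ⟨
        coeff (tabulate v) (toℕ k) - coeff (tabulate w) (toℕ k)
          ≈⟨ coeff-diff (toℕ k) ⟨
        coeff (tabulate v ⊕ ⊖ tabulate w) (toℕ k)
          ≈⟨ coeff-≈ p (toℕ k) ⟩
        coeff (inner u) (toℕ k)
          ≈⟨ coeff-≈ inner-u≋[] (toℕ k) ⟩
        0# ∎)
        where
        coeff-diff : ∀ k →
          coeff (tabulate v ⊕ ⊖ tabulate w) k ≈ coeff (tabulate v) k - coeff (tabulate w) k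
        coeff-diff k = trans (coeff-⊕ (tabulate v) _ k) (+-congˡ (coeff-⊖ (tabulate w) k))
        diff-deg : ∀ k → r ≤ k → coeff (inner u) k ≈ 0#
        diff-deg k r≤k = begin
          coeff (inner u) k                            ≈⟨ coeff-≈ p k ⟨
          coeff (tabulate v ⊕ ⊖ tabulate w) k          ≈⟨ coeff-diff k ⟩
          coeff (tabulate v) k - coeff (tabulate w) k
            ≡⟨ ≡.cong₂ (λ a b → a - b) (coeff-tabulate-≥ v k r≤k) (coeff-tabulate-≥ w k r≤k) ⟩
          0# - 0#                                      ≈⟨ -‿inverseʳ 0# ⟩
          0#                                           ∎
        u≋[] : u ≋ []
        u≋[] = mk≋ (inner-injective (length u) u
          (λ k q → reflexive (coeff-length u k q)) diff-deg)
        inner-u≋[] : inner u ≋ []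
        inner-u≋[] = S.trans (⊕-cong (S.*-cong u≋[] S.refl)
          (S.-‿cong (S.*-cong (S.refl {ψ}) u≋[]))) inner-[]

      -- Division with remainder for a family F x whose coefficients are given
      -- by polynomials in τ applied to x: so are those of the remainder.
      remainder : ∀ m (g : ℕ → Poly) (F : Carrier → Poly) →
        (∀ x k → coeff (F x) k ≈ eval (g k) x) →
        (∀ x k → m ℕ.+ r ≤ k → eval (g k) x ≈ 0#) →
        Σ[ h ∈ (Fin r → Poly) ] (∀ x → F x ~ tabulate {n = r} (λ k → eval (h k) x))
           × ((∀ k → r ≤ k → coeff (g k) 0 ≈ 0#) → ∀ k → coeff (h k) 0 ≈ coeff (g (toℕ k)) 0)
      remainder zero g F F-coeff F-deg =
          g ∘ toℕ
        , (λ x → ≋⇒~ (mk≋ (≈-coeff-tabulate (coeff (F x)) _ (λ k → F-coeff x (toℕ k))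
            (λ k r≤k → trans (F-coeff x k) (F-deg x k r≤k)))))
        , (λ _ _ → refl)
      remainder (suc m) g F F-coeff F-deg =
          proj₁ rec
        , (λ x → ~-trans (subtract-inner (F x) (u x)) (proj₁ (proj₂ rec) x))
        , (λ g₀≈0 k → trans (proj₂ (proj₂ rec) (λ k r≤k → trans (g′₀ g₀≈0 k) (g₀≈0 k r≤k)) k)
                            (g′₀ g₀≈0 (toℕ k)))
        where
        β : Poly
        -- The multiplier u = bτ^m contributes bσ^m(φᵣ) in degree m + r, which must equal the top
        -- coefficient of `F x`. Dividing by the unit σ^m(φᵣ) gives b as a polynomial in τ applied
        -- to x.
        β = σ^ m α ⊙ g (m ℕ.+ r)
        u : Carrier → Poly
        u x = monomial m (eval β x)
        A B g′ : ℕ → Poly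
        -- `A l` and `B l` express the coefficients of uφ and ψu in degree m + l as functions of x.
        -- In ψu the power σ^l acts on b, hence the product with a monomial on the left of β.
        A l = σ^ m (coeff φ l) ⊙ β
        B l = monomial l (coeff ψ l) ⊗ β
        g′ k = g k ⊕ ⊖ (shift [] m A k ⊕ ⊖ shift [] m B k)
        F′ : Carrier → Poly
        F′ x = F x ⊕ ⊖ inner (u x)
        eval-A : ∀ x l → eval (A l) x ≈ eval β x * σ^ m (coeff φ l)
        eval-A x l = trans (eval-⊙ (σ^ m (coeff φ l)) β x) (*-comm _ _)
        eval-B : ∀ x l → eval (B l) x ≈ coeff ψ l * σ^ l (eval β x)
        eval-B x l = trans (eval-⊗ (monomial l (coeff ψ l)) β x) (eval-monomial l (coeff ψ l) (eval β x))
        eval-g′ : ∀ x k → eval (g′ k) x ≈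
          eval (g k) x - (eval (shift [] m A k) x - eval (shift [] m B k) x)
        eval-g′ x k = trans (eval-⊕ (g k) _ x) (+-congˡ (trans (eval-⊖ (shift [] m A k ⊕ _) x)
          (-‿cong (trans (eval-⊕ (shift [] m A k) _ x) (+-congˡ (eval-⊖ (shift [] m B k) x))))))
        F′-coeff : ∀ x k → coeff (F′ x) k ≈ eval (g′ k) x
        F′-coeff x k = begin
          coeff (F′ x) k
            ≈⟨ trans (coeff-⊕ (F x) _ k) (+-cong (F-coeff x k) (trans (coeff-⊖ (inner (u x)) k)
                 (-‿cong (coeff-inner (u x) k)))) ⟩
          eval (g k) x - (conv (coeff (u x)) (coeff φ) k - conv (coeff ψ) (coeff (u x)) k)
            ≈⟨ +-congˡ (-‿cong (+-cong (conv-monomialˡ m (eval β x) (coeff φ) k)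
                 (-‿cong (conv-monomialʳ m (eval β x) (coeff ψ) k)))) ⟩
          eval (g k) x - (shift 0# m (λ l → eval β x * σ^ m (coeff φ l)) k
                          - shift 0# m (λ l → coeff ψ l * σ^ l (eval β x)) k)
            ≈⟨ +-congˡ (-‿cong (+-cong (shift-lift Evalsto refl (eval-A x) m k)
                 (-‿cong (shift-lift Evalsto refl (eval-B x) m k)))) ⟨
          eval (g k) x - (eval (shift [] m A k) x - eval (shift [] m B k) x)
            ≈⟨ eval-g′ x k ⟨
          eval (g′ k) x ∎
          where
          Evalsto : Poly → Carrier → Set ℓ
          Evalsto f y = eval f x ≈ y
        eval-g′-+ : ∀ x l → eval (g′ (m ℕ.+ l)) x ≈
          eval (g (m ℕ.+ l)) x - (eval β x * σ^ m (coeff φ l) - coeff ψ l * σ^ l (eval β x))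
        eval-g′-+ x l = trans (eval-g′ x (m ℕ.+ l)) (+-congˡ (-‿cong (+-cong
          (trans (reflexive (≡.cong (λ f → eval f x) (shift-+ {s = A} m l))) (eval-A x l))
          (-‿cong (trans (reflexive (≡.cong (λ f → eval f x) (shift-+ {s = B} m l))) (eval-B x l))))))
        ψ-term : ∀ x l → r ≤ l → coeff ψ l * σ^ l (eval β x) ≈ 0#
        ψ-term x l r≤l = trans (*-congʳ (ψ-deg l r≤l)) (zeroˡ _)
        vanish : ∀ x l → r ≤ l → eval (g (m ℕ.+ l)) x ≈ eval β x * σ^ m (coeff φ l) →
                 eval (g′ (m ℕ.+ l)) x ≈ 0#
        vanish x l r≤l p = begin
          eval (g′ (m ℕ.+ l)) x
            ≈⟨ eval-g′-+ x l ⟩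
          eval (g (m ℕ.+ l)) x - (eval β x * σ^ m (coeff φ l) - coeff ψ l * σ^ l (eval β x))
            ≈⟨ +-cong p (-‿cong (trans (+-congˡ (trans (-‿cong (ψ-term x l r≤l)) -0#≈0#)) (+-identityʳ _))) ⟩
          eval β x * σ^ m (coeff φ l) - eval β x * σ^ m (coeff φ l)
            ≈⟨ -‿inverseʳ _ ⟩
          0# ∎
        -- From degree m + r on, ψu is zero because ψ has degree below r. Above m + r both `F x` and
        -- uφ vanish; in degree m + r they agree by the choice of β.
        F′-deg-+ : ∀ x l → r ≤ l → eval (g′ (m ℕ.+ l)) x ≈ 0#
        F′-deg-+ x l r≤l with ℕ.m≤n⇒m<n∨m≡n r≤l
        ... | inj₁ r<l = vanish x l r≤l (trans
          (F-deg x (m ℕ.+ l) (ℕ.≤-trans (ℕ.≤-reflexive (≡.sym (ℕ.+-suc m r))) (ℕ.+-monoʳ-≤ m r<l)))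
          (sym (trans (*-congˡ (trans (σ^-cong m (φ-deg l r<l)) (σ^-0 m))) (zeroʳ _))))
        ... | inj₂ ≡.refl = vanish x l r≤l (sym (begin
          eval β x * σ^ m (coeff φ r)                            ≈⟨ *-congʳ (eval-⊙ (σ^ m α) (g (m ℕ.+ r)) x) ⟩
          σ^ m α * eval (g (m ℕ.+ r)) x * σ^ m (coeff φ r)       ≈⟨ *-congʳ (*-comm _ _) ⟩
          eval (g (m ℕ.+ r)) x * σ^ m α * σ^ m (coeff φ r)       ≈⟨ *-assoc _ _ _ ⟩
          eval (g (m ℕ.+ r)) x * (σ^ m α * σ^ m (coeff φ r))     ≈⟨ *-congˡ (σ^α-inv m) ⟩
          eval (g (m ℕ.+ r)) x * 1#                              ≈⟨ *-identityʳ _ ⟩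
          eval (g (m ℕ.+ r)) x                                   ∎))
        F′-deg : ∀ x k → m ℕ.+ r ≤ k → eval (g′ k) x ≈ 0#
        F′-deg x k m+r≤k = ≡.subst (λ k → eval (g′ k) x ≈ 0#)
          (ℕ.m+[n∸m]≡n (ℕ.≤-trans (ℕ.m≤m+n m r) m+r≤k))
          (F′-deg-+ x (k ∸ m) (≡.subst (_≤ k ∸ m) (ℕ.m+n∸m≡n m r) (ℕ.∸-monoˡ-≤ m m+r≤k)))
        rec = remainder m g′ F′ F′-coeff F′-deg
        -- β is a scalar multiple of `g (m + r)` and so has no constant term. `A l` and `B l` are
        -- left multiples of β, and the constant term of a product is the product of the constant
        -- terms.
        g′₀ : (∀ k → r ≤ k → coeff (g k) 0 ≈ 0#) → ∀ k → coeff (g′ k) 0 ≈ coeff (g k) 0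
        g′₀ g₀≈0 k = begin
          coeff (g′ k) 0
            ≈⟨ trans (coeff-⊕ (g k) _ 0) (+-congˡ (trans (coeff-⊖ (shift [] m A k ⊕ _) 0)
                 (-‿cong (trans (coeff-⊕ (shift [] m A k) _ 0) (+-congˡ (coeff-⊖ (shift [] m B k) 0)))))) ⟩
          coeff (g k) 0 - (coeff (shift [] m A k) 0 - coeff (shift [] m B k) 0)
            ≈⟨ +-congˡ (-‿cong (+-cong (shift-lift NoConstant {[]} {[]} refl {A} {A} A₀ m k)
                 (-‿cong (shift-lift NoConstant {[]} {[]} refl {B} {B} B₀ m k)))) ⟩
          coeff (g k) 0 - (0# - 0#)
            ≈⟨ trans (+-congˡ (trans (-‿cong (-‿inverseʳ 0#)) -0#≈0#)) (+-identityʳ _) ⟩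
          coeff (g k) 0 ∎
          where
          -- The second argument is a dummy that turns the binary `shift-lift` into a statement
          -- about one sequence.
          NoConstant : Poly → Poly → Set ℓ
          NoConstant f _ = coeff f 0 ≈ 0#
          β₀ : coeff β 0 ≈ 0#
          β₀ = trans (coeff-map (zeroʳ _) (g (m ℕ.+ r)) 0)
            (trans (*-congˡ (g₀≈0 (m ℕ.+ r) (ℕ.m≤n+m r m))) (zeroʳ _))
          A₀ : ∀ l → coeff (A l) 0 ≈ 0#
          A₀ l = trans (coeff-map (zeroʳ _) β 0) (trans (*-congˡ β₀) (zeroʳ _))
          B₀ : ∀ l → coeff (B l) 0 ≈ 0#
          B₀ l = trans (coeff-⊗ (monomial l (coeff ψ l)) β 0) (trans (*-congˡ β₀) (zeroʳ _))

      -- f is the member at x = 1 of the family x ↦ xf, whose coefficients are constant polynomials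
      -- in τ applied to x; the length of the list bounds the degree.
      divide : ∀ f → Σ[ v ∈ (Fin r → Carrier) ] f ~ tabulate v
      divide f with remainder (length f) (λ k → const (coeff f k)) (_⊙ f)
        (λ x k → trans (coeff-map (zeroʳ x) f k) (trans (*-comm _ _) (sym (eval-const _ x))))
        (λ x k q → trans (eval-const _ x) (trans
          (*-congʳ (reflexive (coeff-length f k (ℕ.≤-trans (ℕ.m≤m+n _ r) q)))) (zeroˡ x)))
      ... | h , 1f~h , _ = (λ k → eval (h k) 1#) , ~-trans
        (≋⇒~ (mk≋ λ k → sym (trans (coeff-map (zeroʳ 1#) f k) (*-identityˡ _)))) (1f~h 1#)

      private
        -- The coefficients of ψxτ^k₀ as polynomials in τ applied to x: in degree k₀ + l it is
        -- ψₗτ^l, because moving x past τ^l applies σ^l.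
        ψ-terms : ℕ → ℕ → Poly
        ψ-terms k₀ = shift [] k₀ (λ l → monomial l (coeff ψ l))

        ψ-terms-0 : ∀ {n} (k₀ k : Fin n) → coeff (ψ-terms (toℕ k₀) (toℕ k)) 0 ≈
          (if does (k Fin.≟ k₀) then coeff ψ 0 else 0#)
        ψ-terms-0 zero     zero    = refl
        ψ-terms-0 zero     (suc k) = refl
        ψ-terms-0 (suc k₀) zero    = refl
        ψ-terms-0 (suc k₀) (suc k) = ψ-terms-0 k₀ k

        ψ-terms-> : ∀ k₀ k → k₀ < k → coeff (ψ-terms k₀ k) 0 ≈ 0#
        ψ-terms-> zero     (suc k) _       = refl
        ψ-terms-> (suc k₀) (suc k) (s≤s p) = ψ-terms-> k₀ k p

      -- The family h becomes one column of a block of Π_t. Degrees from r on lie beyond k₀, so the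
      -- terms removed have no constant part, and the constant parts of h are those of `ψ-terms`,
      -- nonzero at most for k = k₀.
      multiply-monomial : (k₀ : Fin r) → Σ[ h ∈ (Fin r → Poly) ]
          (∀ x → ψ ⊗ monomial (toℕ k₀) x ~ tabulate (λ k → eval (h k) x))
        × (∀ k → coeff (h k) 0 ≈ (if does (k Fin.≟ k₀) then coeff ψ 0 else 0#))
      multiply-monomial k₀ =
          proj₁ rec , proj₁ (proj₂ rec)
        , λ k → trans (proj₂ (proj₂ rec) (λ l r≤l →
            ψ-terms-> (toℕ k₀) l (ℕ.<-≤-trans (Fin.toℕ<n k₀) r≤l)) k) (ψ-terms-0 k₀ k)
        where
        F-coeff : ∀ x k → coeff (ψ ⊗ monomial (toℕ k₀) x) k ≈ eval (ψ-terms (toℕ k₀) k) x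
        F-coeff x k = trans (coeff-⊗ ψ (monomial (toℕ k₀) x) k)
          (trans (conv-monomialʳ (toℕ k₀) x (coeff ψ) k)
            (sym (shift-lift (λ f y → eval f x ≈ y) refl (λ l → eval-monomial l (coeff ψ l) x) (toℕ k₀) k)))
        F-deg : ∀ x k → toℕ k₀ ℕ.+ r ≤ k → eval (ψ-terms (toℕ k₀) k) x ≈ 0#
        F-deg x k q = trans (reflexive (≡.cong (λ f → eval f x) (≡.trans
          (≡.cong (ψ-terms (toℕ k₀)) (≡.sym (ℕ.m+[n∸m]≡n (ℕ.≤-trans (ℕ.m≤m+n (toℕ k₀) r) q))))
          (shift-+ (toℕ k₀) (k ∸ toℕ k₀)))))
          (trans (eval-monomial (k ∸ toℕ k₀) _ x) (trans (*-congʳ (ψ-deg (k ∸ toℕ k₀)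
            (≡.subst (_≤ k ∸ toℕ k₀) (ℕ.m+n∸m≡n (toℕ k₀) r) (ℕ.∸-monoˡ-≤ (toℕ k₀) q)))) (zeroˡ _)))
        rec = remainder (toℕ k₀) (ψ-terms (toℕ k₀)) (λ x → ψ ⊗ monomial (toℕ k₀) x) F-coeff F-deg

-- Evaluation of polynomials and rectangular matrices

module PolynomialProperties {c ℓ} (R : CommutativeRing c ℓ) where

  open CommutativeRing R hiding (zero)
  open Polynomial R
  open SkewReduction R id id-isRingHomomorphism public using (⊙≋const⊗)
  private module P = Ring polynomialRing

  cons≋ : ∀ a f → a ∷ f ≋ const a ⊕ X ⊗ f
  cons≋ a f = mk≋ λ where
    zero    → sym (trans (coeff-⊕ (const a) (X ⊗ f) 0)
                (trans (+-congˡ (trans (coeff-⊗ X f 0) (zeroˡ _))) (+-identityʳ a)))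
    (suc k) → sym (trans (coeff-⊕ (const a) (X ⊗ f) (suc k)) (trans (+-identityˡ _)
                (trans (coeff-⊗ X f (suc k)) (trans (+-cong (zeroˡ _) (conv-identityˡ (coeff f) k))
                  (+-identityˡ _)))))

  -- The skew product maps σ over g even when σ is the identity, and `map id g` equals g only
  -- propositionally.
  cons-⊗ : ∀ a f g → (a ∷ f) ⊗ g ≡ a ⊙ g ⊕ (0# ∷ f ⊗ g)
  cons-⊗ a f g = ≡.cong (λ g′ → a ⊙ g ⊕ (0# ∷ f ⊗ g′)) (map-id g)

  -- Evaluation at an element P of an R-algebra; only P has to commute with
  -- the scalars.
  module Evaluation {b ℓb} (B : Ring b ℓb) (s : Carrier → Ring.Carrier B)
    (s-hom : IsRingHomomorphism rawRing (Ring.rawRing B) s)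
    (P : Ring.Carrier B) (P-comm : ∀ a → Ring._≈_ B (Ring._*_ B P (s a)) (Ring._*_ B (s a) P))
    where

    private
      module B = Ring B
      module s = IsRingHomomorphism s-hom
      open SetoidReasoning B.setoid
      open CommutativeSemigroupProperties
        (CommutativeMonoid.commutativeSemigroup B.+-commutativeMonoid) using (interchange)

    at : Poly → B.Carrier
    at []      = B.0#
    at (a ∷ f) = s a B.+ P B.* at f

    at-cons-0 : ∀ {a f} → a ≈ 0# → at f B.≈ B.0# → at (a ∷ f) B.≈ B.0#
    at-cons-0 {a} {f} a≈0 f≈0 = B.trans
      (B.+-cong (B.trans (s.⟦⟧-cong a≈0) s.0#-homo) (B.trans (B.*-congˡ f≈0) (B.zeroʳ P)))
      (B.+-identityˡ B.0#)

    at-0 : ∀ f → f ≋ [] → at f B.≈ B.0#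
    at-0 []      p = B.refl
    at-0 (a ∷ f) p = at-cons-0 {a} {f} (coeff-≈ p 0) (at-0 f (mk≋ (coeff-≈ p ∘ suc)))

    at-cong : ∀ {f g} → f ≋ g → at f B.≈ at g
    at-cong {f}     {[]}    p = at-0 f p
    at-cong {[]}    {b ∷ g} p = B.sym (at-0 (b ∷ g) (P.sym p))
    at-cong {a ∷ f} {b ∷ g} p =
      B.+-cong (s.⟦⟧-cong (coeff-≈ p 0)) (B.*-congˡ (at-cong {f} {g} (mk≋ (coeff-≈ p ∘ suc))))

    at-⊕ : ∀ f g → at (f ⊕ g) B.≈ at f B.+ at g
    at-⊕ []      g       = B.sym (B.+-identityˡ _)
    at-⊕ (a ∷ f) []      = B.sym (B.+-identityʳ _)
    at-⊕ (a ∷ f) (b ∷ g) = B.trans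
      (B.+-cong (s.+-homo a b) (B.trans (B.*-congˡ (at-⊕ f g)) (B.distribˡ P _ _)))
      (interchange _ _ _ _)

    at-⊙ : ∀ a f → at (a ⊙ f) B.≈ s a B.* at f
    at-⊙ a []      = B.sym (B.zeroʳ (s a))
    at-⊙ a (b ∷ f) = begin
      s (a * b) B.+ P B.* at (a ⊙ f)            ≈⟨ B.+-cong (s.*-homo a b) (B.*-congˡ (at-⊙ a f)) ⟩
      s a B.* s b B.+ P B.* (s a B.* at f)      ≈⟨ B.+-congˡ (B.*-assoc P (s a) (at f)) ⟨
      s a B.* s b B.+ P B.* s a B.* at f        ≈⟨ B.+-congˡ (B.*-congʳ (P-comm a)) ⟩
      s a B.* s b B.+ s a B.* P B.* at f        ≈⟨ B.+-congˡ (B.*-assoc (s a) P (at f)) ⟩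
      s a B.* s b B.+ s a B.* (P B.* at f)      ≈⟨ B.distribˡ (s a) (s b) _ ⟨
      s a B.* (s b B.+ P B.* at f)              ∎

    at-⊗ : ∀ f g → at (f ⊗ g) B.≈ at f B.* at g
    at-⊗ []      g = B.sym (B.zeroˡ (at g))
    at-⊗ (a ∷ f) g = begin
      at ((a ∷ f) ⊗ g)
        ≡⟨ ≡.cong at (cons-⊗ a f g) ⟩
      at (a ⊙ g ⊕ (0# ∷ f ⊗ g))
        ≈⟨ at-⊕ (a ⊙ g) (0# ∷ f ⊗ g) ⟩
      at (a ⊙ g) B.+ (s 0# B.+ P B.* at (f ⊗ g))
        ≈⟨ B.+-cong (at-⊙ a g) (B.trans (B.+-congʳ s.0#-homo) (B.+-identityˡ _)) ⟩
      s a B.* at g B.+ P B.* at (f ⊗ g)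
        ≈⟨ B.+-congˡ (B.trans (B.*-congˡ (at-⊗ f g)) (B.sym (B.*-assoc P (at f) (at g)))) ⟩
      s a B.* at g B.+ P B.* at f B.* at g
        ≈⟨ B.distribʳ (at g) (s a) (P B.* at f) ⟨
      (s a B.+ P B.* at f) B.* at g ∎

    at-const : ∀ a → at (const a) B.≈ s a
    at-const a = B.trans (B.+-congˡ (B.zeroʳ P)) (B.+-identityʳ (s a))

    at-X : at X B.≈ P
    at-X = B.trans (B.+-cong s.0#-homo (B.trans (B.*-congˡ (B.trans (at-const 1#) s.1#-homo))
      (B.*-identityʳ P))) (B.+-identityˡ P)

    at-isAlgebraHomomorphism : IsAlgebraHomomorphism B.rawRing s at
    at-isAlgebraHomomorphism = record
      { isRingHomomorphism = record
        { isSemiringHomomorphism = record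
          { isNearSemiringHomomorphism = record
            { +-isMonoidHomomorphism = record
              { isMagmaHomomorphism = record
                { isRelHomomorphism = record { cong = λ {f} {g} → at-cong {f} {g} }
                ; homo = at-⊕ }
              ; ε-homo = B.refl }
            ; *-homo = at-⊗ }
          ; 1#-homo = B.trans (at-const 1#) s.1#-homo }
        ; -‿homo = λ f → GroupProperties.inverseˡ-unique B.+-group _ _
            (B.trans (B.sym (at-⊕ (⊖ f) f)) (at-0 (⊖ f ⊕ f) (P.-‿inverseˡ f))) }
      ; const-homo = at-const }

  module _ {m ℓm n ℓn} (M : LeftModule polynomialRing m ℓm) (N : LeftModule polynomialRing n ℓn) where

    private
      module M = LeftModule M
      module N = LeftModule N

    -- R[X] is generated by constants and X, so an additive map is R[X]-linear once it commutes with
    -- these. The elements on which it commutes with a fixed scalar are closed under sums, which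
    -- permits a further reduction to additive generators.
    module Linearity (f : M.Carrierᴹ → N.Carrierᴹ)
      (f-cong : ∀ {x y} → x M.≈ᴹ y → f x N.≈ᴹ f y)
      (f-+ : ∀ x y → f (x M.+ᴹ y) N.≈ᴹ f x N.+ᴹ f y)
      (f-0 : f M.0ᴹ N.≈ᴹ N.0ᴹ)
      where

      open SetoidReasoning N.≈ᴹ-setoid
      open CommutativeSemigroupProperties
        (CommutativeMonoid.commutativeSemigroup N.+ᴹ-commutativeMonoid) using (interchange)

      commutes : Poly → M.Carrierᴹ → Set ℓn
      commutes a x = f (a M.*ₗ x) N.≈ᴹ a N.*ₗ f x

      commutes-0 : ∀ a → commutes a M.0ᴹ
      commutes-0 a = begin
        f (a M.*ₗ M.0ᴹ)   ≈⟨ f-cong (M.*ₗ-zeroʳ a) ⟩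
        f M.0ᴹ            ≈⟨ f-0 ⟩
        N.0ᴹ              ≈⟨ N.*ₗ-zeroʳ a ⟨
        a N.*ₗ N.0ᴹ       ≈⟨ N.*ₗ-congˡ f-0 ⟨
        a N.*ₗ f M.0ᴹ     ∎

      commutes-+ : ∀ a {x y} → commutes a x → commutes a y → commutes a (x M.+ᴹ y)
      commutes-+ a {x} {y} p q = begin
        f (a M.*ₗ (x M.+ᴹ y))            ≈⟨ f-cong (M.*ₗ-distribˡ a x y) ⟩
        f (a M.*ₗ x M.+ᴹ a M.*ₗ y)       ≈⟨ f-+ _ _ ⟩
        f (a M.*ₗ x) N.+ᴹ f (a M.*ₗ y)   ≈⟨ N.+ᴹ-cong p q ⟩
        a N.*ₗ f x N.+ᴹ a N.*ₗ f y       ≈⟨ N.*ₗ-distribˡ a (f x) (f y) ⟨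
        a N.*ₗ (f x N.+ᴹ f y)            ≈⟨ N.*ₗ-congˡ (f-+ x y) ⟨
        a N.*ₗ f (x M.+ᴹ y)              ∎

      commutes-resp : ∀ a {x y} → x M.≈ᴹ y → commutes a x → commutes a y
      commutes-resp a {x} {y} x≈y p = begin
        f (a M.*ₗ y)   ≈⟨ f-cong (M.*ₗ-congˡ x≈y) ⟨
        f (a M.*ₗ x)   ≈⟨ p ⟩
        a N.*ₗ f x     ≈⟨ N.*ₗ-congˡ (f-cong x≈y) ⟩
        a N.*ₗ f y     ∎

      linear : (∀ a x → commutes (const a) x) → (∀ x → commutes X x) → ∀ g x → commutes g x
      linear f-const f-X []      x = begin
        f ([] M.*ₗ x)   ≈⟨ f-cong (M.*ₗ-zeroˡ x) ⟩
        f M.0ᴹ          ≈⟨ f-0 ⟩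
        N.0ᴹ            ≈⟨ N.*ₗ-zeroˡ (f x) ⟨
        [] N.*ₗ f x     ∎
      linear f-const f-X (a ∷ g) x = begin
        f ((a ∷ g) M.*ₗ x)
          ≈⟨ f-cong (M.≈ᴹ-trans (M.*ₗ-congʳ (cons≋ a g)) (M.*ₗ-distribʳ x (const a) (X ⊗ g))) ⟩
        f (const a M.*ₗ x M.+ᴹ (X ⊗ g) M.*ₗ x)
          ≈⟨ f-+ _ _ ⟩
        f (const a M.*ₗ x) N.+ᴹ f ((X ⊗ g) M.*ₗ x)
          ≈⟨ N.+ᴹ-cong (f-const a x) (f-cong (M.*ₗ-assoc X g x)) ⟩
        const a N.*ₗ f x N.+ᴹ f (X M.*ₗ (g M.*ₗ x))
          ≈⟨ N.+ᴹ-congˡ (N.≈ᴹ-trans (f-X (g M.*ₗ x)) (N.*ₗ-congˡ (linear f-const f-X g x))) ⟩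
        const a N.*ₗ f x N.+ᴹ X N.*ₗ (g N.*ₗ f x)
          ≈⟨ N.+ᴹ-congˡ (N.*ₗ-assoc X g (f x)) ⟨
        const a N.*ₗ f x N.+ᴹ (X ⊗ g) N.*ₗ f x
          ≈⟨ N.≈ᴹ-trans (N.*ₗ-congʳ (cons≋ a g)) (N.*ₗ-distribʳ (f x) (const a) (X ⊗ g)) ⟨
        (a ∷ g) N.*ₗ f x ∎

module MatrixProperties {c ℓ} (R : Ring c ℓ) where

  open Ring R
  open Matrix R

  *ᴹ-congˡ : ∀ {m n o} (M : Mat m n) {N N′ : Mat n o} → N ≈ᴹ N′ → M *ᴹ N ≈ᴹ M *ᴹ N′
  *ᴹ-congˡ M {N} {N′} p = *ᴹ-cong {M = M} {M} {N} {N′} (λ _ _ → refl) p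

  *ᴹ-congʳ : ∀ {m n o} (P : Mat n o) {M M′ : Mat m n} → M ≈ᴹ M′ → M *ᴹ P ≈ᴹ M′ *ᴹ P
  *ᴹ-congʳ P {M} {M′} p = *ᴹ-cong {M = M} {M′} {P} {P} p (λ _ _ → refl)

  scalar-*ᴹ : ∀ {m n} a (M : Mat m n) → scalar a *ᴹ M ≈ᴹ (λ i j → a * M i j)
  scalar-*ᴹ a M i j = diag-∑ˡ (λ _ → a) (λ k → M k j) i

  *ᴹ-scalar : ∀ {m n} a (M : Mat m n) → M *ᴹ scalar a ≈ᴹ (λ i j → M i j * a)
  *ᴹ-scalar a M i j = diag-∑ʳ (λ _ → a) (M i) j

  module _ {a} (a-central : ∀ x → a * x ≈ x * a) where

    scalar-central : ∀ {m n} (M : Mat m n) → scalar a *ᴹ M ≈ᴹ M *ᴹ scalar a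
    scalar-central M i j =
      trans (scalar-*ᴹ a M i j) (trans (a-central (M i j)) (sym (*ᴹ-scalar a M i j)))

    scalar-swap : ∀ {m n o} (M : Mat m n) (N : Mat n o) →
                  M *ᴹ (scalar a *ᴹ N) ≈ᴹ scalar a *ᴹ (M *ᴹ N)
    scalar-swap {m} {n} {o} M N = begin
      M *ᴹ (scalar a *ᴹ N)   ≈⟨ *ᴹ-assoc M (scalar a) N ⟨
      (M *ᴹ scalar a) *ᴹ N   ≈⟨ *ᴹ-congʳ N (scalar-central M) ⟨
      (scalar a *ᴹ M) *ᴹ N   ≈⟨ *ᴹ-assoc (scalar a) M N ⟩
      scalar a *ᴹ (M *ᴹ N)   ∎
      where open SetoidReasoning (AbelianGroup.setoid (matAbelianGroup m o))

-- 𝐭-modules and derivations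

module TModuleProperties {c ℓ₁ ℓ₂ c′ ℓ₁′ ℓ₂′} (B : Base c ℓ₁ ℓ₂ c′ ℓ₁′ ℓ₂′) where

  open TModules B
  open Base B using (p; e; q; p-prime; K-char; 𝔽-card; η; η-hom)
  open MKτ using
    ( Mat; _≈ᴹ_; _+ᴹ_; _*ᴹ_; -ᴹ_; 0ᴹ; *ᴹ-assoc; *ᴹ-zeroˡ; *ᴹ-zeroʳ; *ᴹ-distribˡ; *ᴹ-distribʳ; negˡ; negʳ)
  open MatrixProperties Kτ.skewRing
  open PolynomialProperties (fieldRing (Base.𝔽 B))

  module SR = SkewReduction (fieldRing (Base.K B)) Frob
    (Characteristic.frobenius-isRingHomomorphism (fieldRing (Base.K B)) p-prime
      (Equivalence.from (K-char p) (divides 1 (≡.sym (ℕ.*-identityˡ p)))) e)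

  private
    module η = IsRingHomomorphism η-hom
    module 𝔽ᴱ = Exp 𝔽.semiring

  η-^ : ∀ n x → η (x 𝔽ᴱ.^ n) K.≈ η x Kᴱ.^ n
  η-^ zero    x = η.1#-homo
  η-^ (suc n) x = K.trans (η.*-homo x _) (K.*-congˡ (η-^ n x))

  Frob-η : ∀ x → Frob (η x) K.≈ η x
  Frob-η x = K.trans (K.sym (η-^ q x)) (η.⟦⟧-cong (FiniteField.x^q≈x (Base.𝔽 B) 𝔽-card x))

  Frob^-η : ∀ m x → SR.σ^ m (η x) K.≈ η x
  Frob^-η zero    x = K.refl
  Frob^-η (suc m) x = K.trans (SR.σ^-cong m (Frob-η x)) (Frob^-η m x)

  -- Moving η x past τ^k applies Frobenius k times, and Frobenius fixes η x because x^q = x in 𝔽.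
  const-η-central : ∀ x f → Kτ.const (η x) Kτ.* f Kτ.≈ f Kτ.* Kτ.const (η x)
  const-η-central x f = Kτ.mk≋ λ k → begin
    Kτ.coeff (Kτ.const (η x) Kτ.* f) k             ≈⟨ Kτ.coeff-⊗ (Kτ.const (η x)) f k ⟩
    Kτ.conv (Kτ.coeff (Kτ.const (η x))) (Kτ.coeff f) k  ≈⟨ SR.conv-monomialˡ 0 (η x) (Kτ.coeff f) k ⟩
    η x K.* Kτ.coeff f k                           ≈⟨ K.*-comm _ _ ⟩
    Kτ.coeff f k K.* η x                           ≈⟨ K.*-congˡ (Frob^-η k x) ⟨
    Kτ.coeff f k K.* SR.σ^ k (η x)                 ≈⟨ SR.conv-monomialʳ 0 (η x) (Kτ.coeff f) k ⟨
    Kτ.conv (Kτ.coeff f) (Kτ.coeff (Kτ.const (η x))) k  ≈⟨ Kτ.coeff-⊗ f (Kτ.const (η x)) k ⟨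
    Kτ.coeff (f Kτ.* Kτ.const (η x)) k             ∎
    where open SetoidReasoning K.setoid

  const-cong : ∀ {x y} → x K.≈ y → Kτ.const x Kτ.≈ Kτ.const y
  const-cong p = Kτ.mk≋ λ where
    zero    → p
    (suc k) → K.refl

  const-* : ∀ x y → Kτ.const (x K.* y) Kτ.≈ Kτ.const x Kτ.* Kτ.const y
  const-* x y = Kτ.mk≋ λ where
    zero          → K.sym (K.+-identityʳ _)
    (suc zero)    → K.refl
    (suc (suc k)) → K.refl

  S : ∀ {d} → 𝔽.Carrier → Mat d d
  S x = MKτ.scalar (Kτ.const (η x))

  S-isRingHomomorphism : ∀ d → IsRingHomomorphism 𝔽.rawRing (Ring.rawRing (MKτ.matRing d)) S
  S-isRingHomomorphism d = record
    { isSemiringHomomorphism = record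
      { isNearSemiringHomomorphism = record
        { +-isMonoidHomomorphism = record
          { isMagmaHomomorphism = record
            { isRelHomomorphism = record
              { cong = λ p → MKτ.diag-cong {d} λ _ → const-cong (η.⟦⟧-cong p) }
            ; homo = λ x y → M.trans (MKτ.diag-cong λ _ → const-cong (η.+-homo x y))
                (MKτ.diag-+ {d} (λ _ → Kτ.const (η x)) (λ _ → Kτ.const (η y))) }
          ; ε-homo = M.trans (MKτ.diag-cong λ _ → Kτ.mk≋ λ where
              zero    → η.0#-homo
              (suc k) → K.refl) (MKτ.diag-0 {d}) }
        ; *-homo = λ x y → M.trans
            (MKτ.diag-cong λ _ → Kτ.trans (const-cong (η.*-homo x y)) (const-* (η x) (η y)))
            (MKτ.diag-* {d} (λ _ → Kτ.const (η x)) (λ _ → Kτ.const (η y))) }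
      ; 1#-homo = MKτ.diag-cong {d} λ _ → const-cong η.1#-homo }
    ; -‿homo = λ x → M.trans (MKτ.diag-cong λ _ → const-cong (η.-‿homo x))
        (MKτ.diag-neg {d} (λ _ → Kτ.const (η x))) }
    where module M = Ring (MKτ.matRing d)

  -- 𝔽_q[t] is free on t, so a value at t extends to an algebra map as soon as it commutes with the
  -- scalar matrices; centrality of η(x) gives this for every P.
  module FromMatrix {d} (P : Mat d d)
    (P-nilpotent : MK.IsNilpotent (coeffᴹ 0 P MK.+ᴹ (MK.-ᴹ MK.scalar θ))) where

    private
      module M = Ring (MKτ.matRing d)
      module Ev = Evaluation (MKτ.matRing d) S (S-isRingHomomorphism d) P
        (λ x → M.sym (scalar-central (const-η-central x) P))

    tModule : TModule d
    tModule = record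
      { act       = Ev.at
      ; act-hom   = Ev.at-isAlgebraHomomorphism
      ; nilpotent = nilpotent-resp P-nilpotent
      }
      where
      nilpotent-resp : MK.IsNilpotent (coeffᴹ 0 P MK.+ᴹ (MK.-ᴹ MK.scalar θ)) →
                       MK.IsNilpotent (coeffᴹ 0 (Ev.at A.X) MK.+ᴹ (MK.-ᴹ MK.scalar θ))
      nilpotent-resp (k , Nᵏ≈0) = k , MR.trans (ME.^-congˡ k λ i j →
        K.+-congʳ (Kτ.coeff-≈ (Ev.at-X i j) 0)) Nᵏ≈0
        where
        module MR = Ring (MK.matRing d)
        module ME = Exp MR.semiring

    act-X : act tModule A.X ≈ᴹ P
    act-X = Ev.at-X

  act-cons : ∀ {d} (Φ : TModule d) x f →
    act Φ (x ∷ f) ≈ᴹ S x +ᴹ act Φ A.X *ᴹ act Φ f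
  act-cons {d} Φ x f = M.trans (H.⟦⟧-cong (cons≋ x f)) (M.trans (H.+-homo (A.const x) (A.X A.* f))
    (M.+-cong (H.const-homo x) (H.*-homo A.X f)))
    where
    module M = Ring (MKτ.matRing d)
    module H = TModule.hom Φ

  act-⊙ : ∀ {d} (Φ : TModule d) x f → act Φ (x A.⊙ f) ≈ᴹ S x *ᴹ act Φ f
  act-⊙ {d} Φ x f = M.trans (H.⟦⟧-cong (⊙≋const⊗ x f)) (M.trans (H.*-homo (A.const x) f)
    (*ᴹ-congʳ (act Φ f) (H.const-homo x)))
    where
    module M = Ring (MKτ.matRing d)
    module H = TModule.hom Φ

  module Derivations {d e : ℕ} (Φ : TModule d) (Ψ : TModule e) where

    private
      module G = AbelianGroup (MKτ.matAbelianGroup e d)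
      module GP = AbelianGroupProperties (MKτ.matAbelianGroup e d)
      module HΦ = TModule.hom Φ
      module HΨ = TModule.hom Ψ
      open CommutativeSemigroupProperties G.commutativeSemigroup using (interchange)
      open SetoidReasoning G.setoid
      Ψₜ = act Ψ A.X
      Φₜ = act Φ A.X

    module FromValue (M : Mat e d) where

      -- The recursion is forced: a derivation vanishes on constants, so the Leibniz rule for x + tf
      -- leaves Ψ_t δ(f) + δ(t) Φ_f, with δ(t) = M.
      der : A.Poly → Mat e d
      der []      = 0ᴹ
      der (x ∷ f) = Ψₜ *ᴹ der f +ᴹ M *ᴹ act Φ f

      der-cons-0 : ∀ {x} f → f A.≈ [] → der f ≈ᴹ 0ᴹ → der (x ∷ f) ≈ᴹ 0ᴹ
      der-cons-0 f f≈0 df≈0 = begin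
        Ψₜ *ᴹ der f +ᴹ M *ᴹ act Φ f
          ≈⟨ G.∙-cong (*ᴹ-congˡ Ψₜ df≈0)
               (*ᴹ-congˡ M λ i j → Kτ.trans (HΦ.⟦⟧-cong f≈0 i j) (HΦ.0#-homo i j)) ⟩
        Ψₜ *ᴹ 0ᴹ +ᴹ M *ᴹ 0ᴹ
          ≈⟨ G.∙-cong (*ᴹ-zeroʳ Ψₜ) (*ᴹ-zeroʳ M) ⟩
        0ᴹ +ᴹ 0ᴹ
          ≈⟨ G.identityˡ 0ᴹ ⟩
        0ᴹ ∎

      der-0 : ∀ f → f A.≈ [] → der f ≈ᴹ 0ᴹ
      der-0 []      p = G.refl
      der-0 (x ∷ f) p = der-cons-0 {x} f f≈0 (der-0 f f≈0)
        where f≈0 = A.mk≋ (A.coeff-≈ p ∘ suc)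

      der-cong : ∀ {f g} → f A.≈ g → der f ≈ᴹ der g
      der-cong {f}     {[]}    p = der-0 f p
      der-cong {[]}    {y ∷ g} p = G.sym (der-0 (y ∷ g) (A.sym p))
      der-cong {x ∷ f} {y ∷ g} p = G.∙-cong
        (*ᴹ-congˡ Ψₜ (der-cong {f} {g} f≈g)) (*ᴹ-congˡ M (HΦ.⟦⟧-cong f≈g))
        where f≈g = A.mk≋ (A.coeff-≈ p ∘ suc)

      der-+ : ∀ f g → der (f A.+ g) ≈ᴹ der f +ᴹ der g
      der-+ []      g       = G.sym (G.identityˡ (der g))
      der-+ (x ∷ f) []      = G.sym (G.identityʳ (der (x ∷ f)))
      der-+ (x ∷ f) (y ∷ g) = begin
        Ψₜ *ᴹ der (f A.+ g) +ᴹ M *ᴹ act Φ (f A.+ g)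
          ≈⟨ G.∙-cong (*ᴹ-congˡ Ψₜ (der-+ f g)) (*ᴹ-congˡ M (HΦ.+-homo f g)) ⟩
        Ψₜ *ᴹ (der f +ᴹ der g) +ᴹ M *ᴹ (act Φ f +ᴹ act Φ g)
          ≈⟨ G.∙-cong (*ᴹ-distribˡ Ψₜ (der f) (der g)) (*ᴹ-distribˡ M (act Φ f) (act Φ g)) ⟩
        (Ψₜ *ᴹ der f +ᴹ Ψₜ *ᴹ der g) +ᴹ (M *ᴹ act Φ f +ᴹ M *ᴹ act Φ g)
          ≈⟨ interchange (Ψₜ *ᴹ der f) (Ψₜ *ᴹ der g) (M *ᴹ act Φ f) (M *ᴹ act Φ g) ⟩
        der (x ∷ f) +ᴹ der (y ∷ g) ∎

      -- The scalar has to cross Ψ_t and the arbitrary matrix M, which is where its centrality in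
      -- K{τ} is used.
      der-⊙ : ∀ x f → der (x A.⊙ f) ≈ᴹ S x *ᴹ der f
      der-⊙ x []      = G.sym (*ᴹ-zeroʳ (S x))
      der-⊙ x (y ∷ f) = begin
        Ψₜ *ᴹ der (x A.⊙ f) +ᴹ M *ᴹ act Φ (x A.⊙ f)
          ≈⟨ G.∙-cong (*ᴹ-congˡ Ψₜ (der-⊙ x f)) (*ᴹ-congˡ M (act-⊙ Φ x f)) ⟩
        Ψₜ *ᴹ (S x *ᴹ der f) +ᴹ M *ᴹ (S x *ᴹ act Φ f)
          ≈⟨ G.∙-cong (scalar-swap (const-η-central x) Ψₜ (der f))
                      (scalar-swap (const-η-central x) M (act Φ f)) ⟩
        S x *ᴹ (Ψₜ *ᴹ der f) +ᴹ S x *ᴹ (M *ᴹ act Φ f)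
          ≈⟨ *ᴹ-distribˡ (S x) (Ψₜ *ᴹ der f) (M *ᴹ act Φ f) ⟨
        S x *ᴹ der (y ∷ f) ∎

      -- Expanding both recursions gives four terms. Those ending in `der g` combine to Ψ of x + tf,
      -- and those ending in `act Φ g` combine to the recursion of `der (x ∷ f)`.
      der-leibniz : ∀ f g → der (f A.* g) ≈ᴹ act Ψ f *ᴹ der g +ᴹ der f *ᴹ act Φ g
      der-leibniz []      g = G.sym (begin
        act Ψ [] *ᴹ der g +ᴹ 0ᴹ *ᴹ act Φ g
          ≈⟨ G.∙-cong (*ᴹ-congʳ (der g) HΨ.0#-homo) (*ᴹ-zeroˡ (act Φ g)) ⟩
        0ᴹ *ᴹ der g +ᴹ 0ᴹ
          ≈⟨ G.∙-congʳ (*ᴹ-zeroˡ (der g)) ⟩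
        0ᴹ +ᴹ 0ᴹ
          ≈⟨ G.identityˡ 0ᴹ ⟩
        0ᴹ ∎)
      der-leibniz (x ∷ f) g = begin
        der ((x ∷ f) A.* g)
          ≡⟨ ≡.cong der (cons-⊗ x f g) ⟩
        der (x A.⊙ g A.+ (𝔽.0# ∷ f A.* g))
          ≈⟨ der-+ (x A.⊙ g) (𝔽.0# ∷ f A.* g) ⟩
        der (x A.⊙ g) +ᴹ (Ψₜ *ᴹ der (f A.* g) +ᴹ M *ᴹ act Φ (f A.* g))
          ≈⟨ G.∙-cong (der-⊙ x g)
               (G.∙-cong (*ᴹ-congˡ Ψₜ (der-leibniz f g)) (*ᴹ-congˡ M (HΦ.*-homo f g))) ⟩
        S x *ᴹ der g +ᴹ (Ψₜ *ᴹ (act Ψ f *ᴹ der g +ᴹ der f *ᴹ act Φ g) +ᴹ M *ᴹ (act Φ f *ᴹ act Φ g))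
          ≈⟨ G.∙-congˡ {S x *ᴹ der g} (G.∙-cong
               (*ᴹ-distribˡ Ψₜ (act Ψ f *ᴹ der g) (der f *ᴹ act Φ g))
               (G.sym (*ᴹ-assoc M (act Φ f) (act Φ g)))) ⟩
        S x *ᴹ der g +ᴹ
        ((Ψₜ *ᴹ (act Ψ f *ᴹ der g) +ᴹ Ψₜ *ᴹ (der f *ᴹ act Φ g)) +ᴹ (M *ᴹ act Φ f) *ᴹ act Φ g)
          ≈⟨ G.∙-congˡ {S x *ᴹ der g}
               (G.assoc (Ψₜ *ᴹ (act Ψ f *ᴹ der g)) (Ψₜ *ᴹ (der f *ᴹ act Φ g))
                        ((M *ᴹ act Φ f) *ᴹ act Φ g)) ⟩
        S x *ᴹ der g +ᴹ
        (Ψₜ *ᴹ (act Ψ f *ᴹ der g) +ᴹ (Ψₜ *ᴹ (der f *ᴹ act Φ g) +ᴹ (M *ᴹ act Φ f) *ᴹ act Φ g))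
          ≈⟨ G.assoc (S x *ᴹ der g) (Ψₜ *ᴹ (act Ψ f *ᴹ der g))
                     (Ψₜ *ᴹ (der f *ᴹ act Φ g) +ᴹ (M *ᴹ act Φ f) *ᴹ act Φ g) ⟨
        (S x *ᴹ der g +ᴹ Ψₜ *ᴹ (act Ψ f *ᴹ der g)) +ᴹ
        (Ψₜ *ᴹ (der f *ᴹ act Φ g) +ᴹ (M *ᴹ act Φ f) *ᴹ act Φ g)
          ≈⟨ G.∙-cong {u = Ψₜ *ᴹ (der f *ᴹ act Φ g) +ᴹ (M *ᴹ act Φ f) *ᴹ act Φ g} left right ⟩
        act Ψ (x ∷ f) *ᴹ der g +ᴹ der (x ∷ f) *ᴹ act Φ g ∎
        where
        left : S x *ᴹ der g +ᴹ Ψₜ *ᴹ (act Ψ f *ᴹ der g) ≈ᴹ act Ψ (x ∷ f) *ᴹ der g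
        left = begin
          S x *ᴹ der g +ᴹ Ψₜ *ᴹ (act Ψ f *ᴹ der g)
            ≈⟨ G.∙-congˡ {S x *ᴹ der g} (*ᴹ-assoc Ψₜ (act Ψ f) (der g)) ⟨
          S x *ᴹ der g +ᴹ (Ψₜ *ᴹ act Ψ f) *ᴹ der g
            ≈⟨ *ᴹ-distribʳ (der g) (S x) (Ψₜ *ᴹ act Ψ f) ⟨
          (S x +ᴹ Ψₜ *ᴹ act Ψ f) *ᴹ der g
            ≈⟨ *ᴹ-congʳ (der g) (act-cons Ψ x f) ⟨
          act Ψ (x ∷ f) *ᴹ der g ∎
        right : Ψₜ *ᴹ (der f *ᴹ act Φ g) +ᴹ (M *ᴹ act Φ f) *ᴹ act Φ g ≈ᴹ der (x ∷ f) *ᴹ act Φ g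
        right = begin
          Ψₜ *ᴹ (der f *ᴹ act Φ g) +ᴹ (M *ᴹ act Φ f) *ᴹ act Φ g
            ≈⟨ G.∙-congʳ {(M *ᴹ act Φ f) *ᴹ act Φ g} (*ᴹ-assoc Ψₜ (der f) (act Φ g)) ⟨
          (Ψₜ *ᴹ der f) *ᴹ act Φ g +ᴹ (M *ᴹ act Φ f) *ᴹ act Φ g
            ≈⟨ *ᴹ-distribʳ (act Φ g) (Ψₜ *ᴹ der f) (M *ᴹ act Φ f) ⟨
          der (x ∷ f) *ᴹ act Φ g ∎

      derivation : Der Φ Ψ
      derivation = record
        { δ        = der
        ; δ-cong   = λ {f} {g} → der-cong {f} {g}
        ; δ-+      = der-+
        ; δ-scalar = λ x f → G.trans (der-cong (A.sym (⊙≋const⊗ x f)))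
            (G.trans (der-⊙ x f) (scalar-*ᴹ (Kτ.const (η x)) (der f)))
        ; leibniz  = der-leibniz
        }

      der-X : der A.X ≈ᴹ M
      der-X = begin
        Ψₜ *ᴹ der (A.const 𝔽.1#) +ᴹ M *ᴹ act Φ (A.const 𝔽.1#)
          ≈⟨ G.∙-cong (*ᴹ-congˡ Ψₜ (der-cons-0 {𝔽.1#} [] A.refl G.refl)) (*ᴹ-congˡ M HΦ.1#-homo) ⟩
        Ψₜ *ᴹ 0ᴹ +ᴹ M *ᴹ MKτ.1ᴹ
          ≈⟨ G.∙-cong (*ᴹ-zeroʳ Ψₜ) (MKτ.*ᴹ-identityʳ M) ⟩
        0ᴹ +ᴹ M
          ≈⟨ G.identityˡ M ⟩
        M ∎

    open FromValue public using (derivation; der-X)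

    -- The Leibniz rule for 1 = 1 · 1 reads δ(1) = δ(1) + δ(1).
    der-1 : ∀ (D : Der Φ Ψ) → Der.δ D A.1# ≈ᴹ 0ᴹ
    der-1 D = GP.identityˡ-unique (δ A.1#) (δ A.1#) (G.sym (begin
      δ A.1#
        ≈⟨ δ-cong (A.*-identityˡ A.1#) ⟨
      δ (A.1# A.* A.1#)
        ≈⟨ leibniz A.1# A.1# ⟩
      act Ψ A.1# *ᴹ δ A.1# +ᴹ δ A.1# *ᴹ act Φ A.1#
        ≈⟨ G.∙-cong (*ᴹ-congʳ (δ A.1#) HΨ.1#-homo) (*ᴹ-congˡ (δ A.1#) HΦ.1#-homo) ⟩
      MKτ.1ᴹ *ᴹ δ A.1# +ᴹ δ A.1# *ᴹ MKτ.1ᴹ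
        ≈⟨ G.∙-cong (MKτ.*ᴹ-identityˡ (δ A.1#)) (MKτ.*ᴹ-identityʳ (δ A.1#)) ⟩
      δ A.1# +ᴹ δ A.1# ∎))
      where open Der D

    der-const : ∀ (D : Der Φ Ψ) x → Der.δ D (A.const x) ≈ᴹ 0ᴹ
    der-const D x = begin
      δ (A.const x)                                  ≈⟨ δ-cong (A.*-identityʳ (A.const x)) ⟨
      δ (A.const x A.* A.1#)                         ≈⟨ δ-scalar x A.1# ⟩
      (λ i j → Kτ.const (η x) Kτ.* δ A.1# i j)
        ≈⟨ (λ i j → Kτ.trans (Kτ.*-congˡ {Kτ.const (η x)} (der-1 D i j)) (Kτ.zeroʳ (Kτ.const (η x)))) ⟩
      0ᴹ ∎
      where open Der D

    der-[] : ∀ (D : Der Φ Ψ) → Der.δ D [] ≈ᴹ 0ᴹ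
    der-[] D = GP.identityˡ-unique (δ []) (δ []) (G.sym (δ-+ [] []))
      where open Der D

    der-cons : ∀ (D : Der Φ Ψ) x f →
      Der.δ D (x ∷ f) ≈ᴹ Ψₜ *ᴹ Der.δ D f +ᴹ Der.δ D A.X *ᴹ act Φ f
    der-cons D x f = begin
      δ (x ∷ f)                                   ≈⟨ δ-cong (cons≋ x f) ⟩
      δ (A.const x A.+ A.X A.* f)                 ≈⟨ δ-+ (A.const x) (A.X A.* f) ⟩
      δ (A.const x) +ᴹ δ (A.X A.* f)              ≈⟨ G.∙-cong (der-const D x) (leibniz A.X f) ⟩
      0ᴹ +ᴹ (Ψₜ *ᴹ δ f +ᴹ δ A.X *ᴹ act Φ f)       ≈⟨ G.identityˡ (Ψₜ *ᴹ δ f +ᴹ δ A.X *ᴹ act Φ f) ⟩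
      Ψₜ *ᴹ δ f +ᴹ δ A.X *ᴹ act Φ f               ∎
      where open Der D

    inner-[] : ∀ U → inner Φ Ψ U [] ≈ᴹ 0ᴹ
    inner-[] U = begin
      U *ᴹ act Φ [] +ᴹ (-ᴹ (act Ψ [] *ᴹ U))
        ≈⟨ G.∙-cong (*ᴹ-congˡ U HΦ.0#-homo) (G.⁻¹-cong (*ᴹ-congʳ U HΨ.0#-homo)) ⟩
      U *ᴹ 0ᴹ +ᴹ (-ᴹ (0ᴹ *ᴹ U))
        ≈⟨ G.∙-cong (*ᴹ-zeroʳ U) (G.⁻¹-cong (*ᴹ-zeroˡ U)) ⟩
      0ᴹ +ᴹ (-ᴹ 0ᴹ)
        ≈⟨ G.inverseʳ 0ᴹ ⟩
      0ᴹ ∎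

    -- Inner derivations obey the recursion of `der`. The scalar parts of UΦ and ΨU cancel because
    -- scalars are central, and inserting Ψ_t U Φ_f with both signs splits the rest into the two
    -- required terms.
    inner-cons : ∀ U x f →
      inner Φ Ψ U (x ∷ f) ≈ᴹ Ψₜ *ᴹ inner Φ Ψ U f +ᴹ inner Φ Ψ U A.X *ᴹ act Φ f
    inner-cons U x f = begin
      U *ᴹ act Φ (x ∷ f) +ᴹ (-ᴹ (act Ψ (x ∷ f) *ᴹ U))
        ≈⟨ G.∙-cong UΦ (G.trans (G.⁻¹-cong ΨU) (G.sym (GP.⁻¹-∙-comm s ψU))) ⟩
      (s +ᴹ Uφ) +ᴹ ((-ᴹ s) +ᴹ (-ᴹ ψU))
        ≈⟨ interchange s Uφ (-ᴹ s) (-ᴹ ψU) ⟩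
      (s +ᴹ (-ᴹ s)) +ᴹ (Uφ +ᴹ (-ᴹ ψU))
        ≈⟨ G.trans (G.∙-congʳ {Uφ +ᴹ (-ᴹ ψU)} (G.inverseʳ s)) (G.identityˡ (Uφ +ᴹ (-ᴹ ψU))) ⟩
      Uφ +ᴹ (-ᴹ ψU)
        ≈⟨ G.comm Uφ (-ᴹ ψU) ⟩
      (-ᴹ ψU) +ᴹ Uφ
        ≈⟨ G.∙-congˡ {(-ᴹ ψU)} (GP.\\-leftDividesˡ ψUφ Uφ) ⟨
      (-ᴹ ψU) +ᴹ (ψUφ +ᴹ ((-ᴹ ψUφ) +ᴹ Uφ))
        ≈⟨ G.assoc (-ᴹ ψU) ψUφ ((-ᴹ ψUφ) +ᴹ Uφ) ⟨
      ((-ᴹ ψU) +ᴹ ψUφ) +ᴹ ((-ᴹ ψUφ) +ᴹ Uφ)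
        ≈⟨ G.∙-cong {u = inner Φ Ψ U A.X *ᴹ act Φ f} left right ⟨
      Ψₜ *ᴹ inner Φ Ψ U f +ᴹ inner Φ Ψ U A.X *ᴹ act Φ f ∎
      where
      s Uφ ψU ψUφ : Mat e d
      s   = S x *ᴹ U
      Uφ  = (U *ᴹ Φₜ) *ᴹ act Φ f
      ψU  = Ψₜ *ᴹ (act Ψ f *ᴹ U)
      ψUφ = Ψₜ *ᴹ (U *ᴹ act Φ f)
      UΦ : U *ᴹ act Φ (x ∷ f) ≈ᴹ s +ᴹ Uφ
      UΦ = begin
        U *ᴹ act Φ (x ∷ f)
          ≈⟨ *ᴹ-congˡ U (act-cons Φ x f) ⟩
        U *ᴹ (S x +ᴹ Φₜ *ᴹ act Φ f)
          ≈⟨ *ᴹ-distribˡ U (S x) (Φₜ *ᴹ act Φ f) ⟩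
        U *ᴹ S x +ᴹ U *ᴹ (Φₜ *ᴹ act Φ f)
          ≈⟨ G.∙-cong (scalar-central (const-η-central x) U) (*ᴹ-assoc U Φₜ (act Φ f)) ⟨
        s +ᴹ Uφ ∎
      ΨU : act Ψ (x ∷ f) *ᴹ U ≈ᴹ s +ᴹ ψU
      ΨU = begin
        act Ψ (x ∷ f) *ᴹ U
          ≈⟨ *ᴹ-congʳ U (act-cons Ψ x f) ⟩
        (S x +ᴹ Ψₜ *ᴹ act Ψ f) *ᴹ U
          ≈⟨ *ᴹ-distribʳ U (S x) (Ψₜ *ᴹ act Ψ f) ⟩
        s +ᴹ (Ψₜ *ᴹ act Ψ f) *ᴹ U
          ≈⟨ G.∙-congˡ {s} (*ᴹ-assoc Ψₜ (act Ψ f) U) ⟩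
        s +ᴹ ψU ∎
      left : Ψₜ *ᴹ inner Φ Ψ U f ≈ᴹ (-ᴹ ψU) +ᴹ ψUφ
      left = begin
        Ψₜ *ᴹ (U *ᴹ act Φ f +ᴹ (-ᴹ (act Ψ f *ᴹ U)))
          ≈⟨ *ᴹ-distribˡ Ψₜ (U *ᴹ act Φ f) (-ᴹ (act Ψ f *ᴹ U)) ⟩
        ψUφ +ᴹ Ψₜ *ᴹ (-ᴹ (act Ψ f *ᴹ U))
          ≈⟨ G.∙-congˡ {ψUφ} (negʳ Ψₜ (act Ψ f *ᴹ U)) ⟩
        ψUφ +ᴹ (-ᴹ ψU)
          ≈⟨ G.comm ψUφ (-ᴹ ψU) ⟩
        (-ᴹ ψU) +ᴹ ψUφ ∎
      right : inner Φ Ψ U A.X *ᴹ act Φ f ≈ᴹ (-ᴹ ψUφ) +ᴹ Uφ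
      right = begin
        (U *ᴹ Φₜ +ᴹ (-ᴹ (Ψₜ *ᴹ U))) *ᴹ act Φ f
          ≈⟨ *ᴹ-distribʳ (act Φ f) (U *ᴹ Φₜ) (-ᴹ (Ψₜ *ᴹ U)) ⟩
        Uφ +ᴹ (-ᴹ (Ψₜ *ᴹ U)) *ᴹ act Φ f
          ≈⟨ G.∙-congˡ {Uφ} (G.trans (negˡ (Ψₜ *ᴹ U) (act Φ f)) (G.⁻¹-cong (*ᴹ-assoc Ψₜ U (act Φ f)))) ⟩
        Uφ +ᴹ (-ᴹ ψUφ)
          ≈⟨ G.comm Uφ (-ᴹ ψUφ) ⟩
        (-ᴹ ψUφ) +ᴹ Uφ ∎

    -- Both sides satisfy one recursion along the coefficient list, driven by the value at t, and
    -- both vanish on the empty list.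
    der≈inner : ∀ (D : Der Φ Ψ) U → Der.δ D A.X ≈ᴹ inner Φ Ψ U A.X →
                ∀ a → Der.δ D a ≈ᴹ inner Φ Ψ U a
    der≈inner D U p []      = G.trans (der-[] D) (G.sym (inner-[] U))
    der≈inner D U p (x ∷ f) = begin
      δ (x ∷ f)
        ≈⟨ der-cons D x f ⟩
      Ψₜ *ᴹ δ f +ᴹ δ A.X *ᴹ act Φ f
        ≈⟨ G.∙-cong (*ᴹ-congˡ Ψₜ (der≈inner D U p f)) (*ᴹ-congʳ (act Φ f) p) ⟩
      Ψₜ *ᴹ inner Φ Ψ U f +ᴹ inner Φ Ψ U A.X *ᴹ act Φ f
        ≈⟨ inner-cons U x f ⟨
      inner Φ Ψ U (x ∷ f) ∎
      where open Der D

    -- The difference of D and D′ is itself a derivation, so agreement with an inner one at t is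
    -- agreement everywhere.
    ∼-at-X : ∀ {D D′ : Der Φ Ψ} U → Der.δ D A.X +ᴹ (-ᴹ Der.δ D′ A.X) ≈ᴹ inner Φ Ψ U A.X →
             _∼_ Φ Ψ D D′
    ∼-at-X {D} {D′} U p = U , der≈inner (_+ᴰ_ Φ Ψ D (-ᴰ_ Φ Ψ D′)) U p

-- The module of extensions

open import Data.Nat.Base using (_*_)

-- Numbering the coordinates of remainders

module DependentIndex where

  join : ∀ {n} (r : Fin n → ℕ) i → Fin (r i) → Fin (sumℕ r)
  join r zero    k = k ↑ˡ sumℕ (r ∘ suc)
  join r (suc i) k = r zero ↑ʳ join (r ∘ suc) i k

  split : ∀ {n} (r : Fin n → ℕ) → Fin (sumℕ r) → Σ[ i ∈ Fin n ] Fin (r i)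
  split {suc n} r x =
    [ zero ,_ , (λ y → let i , k = split (r ∘ suc) y in suc i , k) ]′ (splitAt (r zero) x)

  split-join : ∀ {n} (r : Fin n → ℕ) i k → split r (join r i k) ≡ (i , k)
  split-join r zero    k rewrite Fin.splitAt-↑ˡ (r zero) k (sumℕ (r ∘ suc)) = ≡.refl
  split-join r (suc i) k
    rewrite Fin.splitAt-↑ʳ (r zero) (sumℕ (r ∘ suc)) (join (r ∘ suc) i k)
          | split-join (r ∘ suc) i k = ≡.refl

  join-split : ∀ {n} (r : Fin n → ℕ) x → join r (proj₁ (split r x)) (proj₂ (split r x)) ≡ x
  join-split {suc n} r x with splitAt (r zero) x in eq
  ... | inj₁ k = Fin.splitAt⁻¹-↑ˡ eq
  ... | inj₂ y = ≡.trans (≡.cong (r zero ↑ʳ_) (join-split (r ∘ suc) y)) (Fin.splitAt⁻¹-↑ʳ eq)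

  module Blocks (m : ℕ) {n} (r : Fin n → ℕ) where

    -- A triple (j , i , k) names the coefficient of τ^k in the remainder of the entry in row j and
    -- column i; its range for k depends on i through rk φᵢ.
    Block : Set
    Block = Fin m × Σ[ i ∈ Fin n ] Fin (r i)

    index : Block → Fin (m * sumℕ r)
    index (j , i , k) = combine j (join r i k)

    block : Fin (m * sumℕ r) → Block
    block x = map₂ (split r) (remQuot (sumℕ r) x)

    block-index : ∀ b → block (index b) ≡ b
    block-index (j , i , k) = ≡.trans
      (≡.cong (map₂ (split r)) (Fin.remQuot-combine j (join r i k))) (≡.cong (j ,_) (split-join r i k))

    index-block : ∀ x → index (block x) ≡ x
    index-block x =
      ≡.trans (≡.cong (combine {m} j) (join-split r y)) (Fin.combine-remQuot {m} (sumℕ r) x)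
      where
      j = proj₁ (remQuot {m} (sumℕ r) x)
      y = proj₂ (remQuot {m} (sumℕ r) x)

    index-injective : ∀ b b′ → index b ≡ index b′ → b ≡ b′
    index-injective b b′ p =
      ≡.trans (≡.sym (block-index b)) (≡.trans (≡.cong block p) (block-index b′))


-- The action of t on remainders and the isomorphism with Ext¹

module ExtensionModule {c ℓ₁ ℓ₂ c′ ℓ₁′ ℓ₂′} (B : Base c ℓ₁ ℓ₂ c′ ℓ₁′ ℓ₂′) where

  open TModules B
  open Base B using (η)
  open TModuleProperties B
  open MKτ using (Mat; _≈ᴹ_; _+ᴹ_; _*ᴹ_; -ᴹ_; 0ᴹ)

  single : ∀ {D} → Fin D → K.Carrier → Fin D → K.Carrier
  single y c x = if does (x Fin.≟ y) then c else K.0#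

  -- Every vector is the sum of its one-coordinate parts. Vectors are functions compared pointwise,
  -- so Q must respect that equality explicitly.
  single-induction : ∀ {ℓ} {D} (Q : (Fin D → K.Carrier) → Set ℓ) →
    (∀ {v w} → (∀ x → v x K.≈ w x) → Q v → Q w) →
    (∀ {v w} → Q v → Q w → Q (λ x → v x K.+ w x)) →
    Q (λ _ → K.0#) → (∀ y c → Q (single y c)) → ∀ v → Q v
  single-induction {D = zero}  Q resp plus Q0 Qs v = resp (λ ()) Q0
  single-induction {D = suc D} Q resp plus Q0 Qs v =
    resp (λ { zero → K.+-identityʳ _ ; (suc x) → K.+-identityˡ _ })
      (plus (Qs zero (v zero)) (single-induction (Q ∘ extend)
        (λ p → resp λ { zero → K.refl ; (suc x) → p x })
        (λ p q → resp (λ { zero → K.+-identityˡ _ ; (suc x) → K.refl }) (plus p q))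
        (resp (λ { zero → K.refl ; (suc x) → K.refl }) Q0)
        (λ y c → resp (λ { zero → K.refl ; (suc x) → K.refl }) (Qs (suc y) c))
        (v ∘ suc)))
    where
    extend : (Fin D → K.Carrier) → Fin (suc D) → K.Carrier
    extend w zero    = K.0#
    extend w (suc x) = w x

  module KSum = SemiringSum K.semiring

  sum-single : ∀ {D} (f : Fin D → Kτ.Poly) y c →
    KSum.sum (λ x → Kτ.eval (f x) (single y c x)) K.≈ Kτ.eval (f y) c
  sum-single {suc D} f zero    c = K.trans (K.+-congˡ (K.trans
    (KSum.sum-cong-≋ λ x → Kτ.eval-0 (f (suc x))) (KSum.sum-replicate-zero D))) (K.+-identityʳ _)
  sum-single f (suc y) c = K.trans
    (K.+-cong (Kτ.eval-0 (f zero)) (sum-single (f ∘ suc) y c)) (K.+-identityˡ _)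

  if-yes : ∀ {a} {A : Set a} {n} (i : Fin n) {x y : A} → (if does (i Fin.≟ i) then x else y) ≡ x
  if-yes i {x} {y} = ≡.cong (if_then x else y) (dec-true (i Fin.≟ i) ≡.refl)

  if-no : ∀ {a} {A : Set a} {n} {i j : Fin n} → i ≢ j → {x y : A} →
           (if does (i Fin.≟ j) then x else y) ≡ y
  if-no {i = i} {j} i≢j {x} {y} = ≡.cong (if_then x else y) (dec-false (i Fin.≟ j) i≢j)

  module Extensions (n m : ℕ)
    (φ : Fin n → DrinfeldModule) (ψ : Fin m → DrinfeldModule)
    (r : Fin n → ℕ) (s : Fin m → ℕ)
    (φ-rank : ∀ i → HasRank (φ i) (r i)) (ψ-rank : ∀ j → HasRank (ψ j) (s j))
    (s<r : ∀ i j → s j < r i) where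

    dim : ℕ
    dim = m * sumℕ r

    Φ : TModule n
    Φ = ∏ φ
    Ψ : TModule m
    Ψ = ∏ ψ

    φₜ : Fin n → Kτ.Poly
    φₜ i = act (φ i) A.X zero zero
    ψₜ : Fin m → Kτ.Poly
    ψₜ j = act (ψ j) A.X zero zero

    open Derivations Φ Ψ
    open DependentIndex.Blocks m r

    module Entry (j : Fin m) (i : Fin n) where

      open SR.Modulo (φₜ i) (ψₜ j) public

      leading : ∃[ α ] α K.* Kτ.coeff (φₜ i) (r i) K.≈ K.1#
      leading with proj₂ (φ-rank i)
      -- The escape clause of `HasRank` for rank 0 is ruled out by s j < r i, so the leading
      -- coefficient is apart from 0 and invertible.
      ... | inj₁ r≡0                = contradiction (≡.subst (s j <_) r≡0 (s<r i j)) λ ()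
      ... | inj₂ (zero , zero , r#0) = FieldProperties.#0⇒invertible (Base.K B) r#0

      open Division {r i} (λ k r<k → proj₁ (φ-rank i) k r<k zero zero)
        (proj₁ leading) (proj₂ leading)
        (λ k r≤k → proj₁ (ψ-rank j) k (ℕ.<-≤-trans (s<r i j) r≤k) zero zero) public

    -- The nilpotency witness of a product of Drinfeld modules has exponent 1, since a nilpotent
    -- element of a field is 0; its diagonal entry says that ψⱼ(t) has constant term θ.
    ψₜ-0 : ∀ j → Kτ.coeff (ψₜ j) 0 K.≈ θ
    ψₜ-0 j = RingProperties.x∙y⁻¹≈ε⇒x≈y K.ring (Kτ.coeff (ψₜ j) 0) θ (begin
      Kτ.coeff (ψₜ j) 0 K.- θ
        ≡⟨ ≡.cong₂ (λ f x → Kτ.coeff f 0 K.- x) (if-yes j) (if-yes j) ⟨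
      N j j
        ≈⟨ MK.*ᴹ-identityʳ N j j ⟨
      (N MK.*ᴹ MK.1ᴹ) j j
        ≈⟨ proj₂ (TModule.nilpotent Ψ) j j ⟩
      K.0# ∎)
      where
      open SetoidReasoning K.setoid
      N : MK.Mat m m
      N = coeffᴹ 0 (act Ψ A.X) MK.+ᴹ (MK.-ᴹ MK.scalar θ)

    -- Φ_t and Ψ_t are diagonal, so multiplication by them never mixes entries of U; this is the
    -- splitting of Ext¹.
    inner-entry : ∀ (U : Mat m n) j i →
      inner Φ Ψ U A.X j i Kτ.≈ SR.Modulo.inner (φₜ i) (ψₜ j) (U j i)
    inner-entry U j i = Kτ.+-cong (MKτ.diag-∑ʳ φₜ (U j) i)
      (Kτ.-‿cong (MKτ.diag-∑ˡ ψₜ (λ k → U k i) j))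

    ∼⇒~ : ∀ {D D′ : Der Φ Ψ} → _∼_ Φ Ψ D D′ → ∀ j i →
          Entry._~_ j i (Der.δ D A.X j i) (Der.δ D′ A.X j i)
    ∼⇒~ (U , p) j i = Entry.mk~ (U j i) (Kτ.trans (p A.X j i) (inner-entry U j i))

    ~⇒∼ : ∀ {D D′ : Der Φ Ψ} →
          (∀ j i → Entry._~_ j i (Der.δ D A.X j i) (Der.δ D′ A.X j i)) → _∼_ Φ Ψ D D′
    ~⇒∼ {D} {D′} p = ∼-at-X {D} {D′} (λ j i → Entry._~_.multiplier (p j i)) λ j i →
      Kτ.trans (Entry._~_.difference (p j i))
        (Kτ.sym (inner-entry (λ j i → Entry._~_.multiplier (p j i)) j i))

    matrix : (Fin dim → K.Carrier) → Mat m n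
    matrix v j i = tabulate (λ k → v (index (j , i , k)))

    extension : (Fin dim → K.Carrier) → Der Φ Ψ
    extension v = derivation (matrix v)

    extension-X : ∀ v → Der.δ (extension v) A.X ≈ᴹ matrix v
    extension-X v = der-X (matrix v)

    -- The column of the matrix of the action of t at the basis vector b.
    column : Block → Block → Kτ.Poly
    column (j₀ , i₀ , k₀) (j , i , k) with j Fin.≟ j₀ | i Fin.≟ i₀
    ... | yes _ | yes ≡.refl = proj₁ (Entry.multiply-monomial j₀ i₀ k₀) k
    ... | yes _ | no _       = []
    ... | no _  | _          = []

    -- The matrix Π_t, with one diagonal block of size `r i` for each pair (j , i).
    P : Mat dim dim
    P x y = column (block y) (block x)

    -- Off the block of b₀ the entry is zero; inside it, `multiply-monomial` leaves only the
    -- constant term of ψⱼ(t) on the diagonal, which is θ. Hence the constant part of P is exactly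
    -- θI.
    column-0 : ∀ b₀ b → Kτ.coeff (column b₀ b) 0 K.≈ single (index b₀) θ (index b)
    column-0 (j₀ , i₀ , k₀) (j , i , k) with j Fin.≟ j₀ | i Fin.≟ i₀
    ... | no j≢j₀ | _ = K.reflexive (≡.sym (if-no
      (j≢j₀ ∘ ≡.cong proj₁ ∘ index-injective (j , i , k) (j₀ , i₀ , k₀))))
    ... | yes _ | no i≢i₀ = K.reflexive (≡.sym (if-no
      (i≢i₀ ∘ ≡.cong (proj₁ ∘ proj₂) ∘ index-injective (j , i , k) (j₀ , i₀ , k₀))))
    ... | yes ≡.refl | yes ≡.refl with k Fin.≟ k₀ | proj₂ (proj₂ (Entry.multiply-monomial j₀ i₀ k₀)) k
    ...   | yes ≡.refl | p = K.trans p (K.trans (ψₜ-0 j₀)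
      (K.reflexive (≡.sym (if-yes (index (j₀ , i₀ , k₀))))))
    ...   | no k≢k₀    | p = K.trans p (K.reflexive (≡.sym (if-no
      (k≢k₀ ∘ (λ { ≡.refl → ≡.refl }) ∘ index-injective (j , i , k) (j₀ , i₀ , k₀)))))

    P-0 : ∀ x y → Kτ.coeff (P x y) 0 K.≈ MK.scalar θ x y
    P-0 x y = K.trans (column-0 (block y) (block x)) (K.reflexive
      (≡.cong₂ (λ x y → single y θ x) (index-block x) (index-block y)))

    P-nilpotent : MK.IsNilpotent (coeffᴹ 0 P MK.+ᴹ (MK.-ᴹ MK.scalar θ))
    P-nilpotent = 1 , λ x y → K.trans (MK.*ᴹ-identityʳ (coeffᴹ 0 P MK.+ᴹ (MK.-ᴹ MK.scalar θ)) x y)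
      (K.trans (K.+-congʳ (P-0 x y)) (K.-‿inverseʳ _))

    Π : TModule dim
    Π = FromMatrix.tModule P P-nilpotent

    act-Π-X : act Π A.X ≈ᴹ P
    act-Π-X = FromMatrix.act-X P P-nilpotent

    private
      module MW = LeftModule (MordellWeil Π)
      module E = LeftModule (Ext¹ Φ Ψ)

    ≋⇒∼ : ∀ {D D′ : Der Φ Ψ} → Der.δ D A.X ≈ᴹ Der.δ D′ A.X → D E.≈ᴹ D′
    ≋⇒∼ {D} {D′} p = ~⇒∼ {D} {D′} λ j i → Entry.≋⇒~ j i (p j i)

    extension-cong : ∀ {v w} → v MW.≈ᴹ w → extension v E.≈ᴹ extension w
    extension-cong {v} {w} p = ≋⇒∼ {extension v} {extension w} λ j i → Kτ.trans (extension-X v j i)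
      (Kτ.trans (SR.tabulate-cong (λ k → p (index (j , i , k)))) (Kτ.sym (extension-X w j i)))

    extension-+ : ∀ v w → extension (v MW.+ᴹ w) E.≈ᴹ extension v E.+ᴹ extension w
    extension-+ v w = ≋⇒∼ {extension (v MW.+ᴹ w)} {extension v E.+ᴹ extension w} λ j i →
      Kτ.trans (extension-X (v MW.+ᴹ w) j i)
        (Kτ.trans (SR.tabulate-⊕ (λ k → v (index (j , i , k))) (λ k → w (index (j , i , k))))
          (Kτ.sym (Kτ.+-cong (extension-X v j i) (extension-X w j i))))

    extension-0 : extension MW.0ᴹ E.≈ᴹ E.0ᴹ
    extension-0 = ≋⇒∼ {extension MW.0ᴹ} {E.0ᴹ} λ j i →
      Kτ.trans (extension-X MW.0ᴹ j i) (SR.tabulate-0 (r i))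

    act-const-MW : ∀ x v y → (A.const x MW.*ₗ v) y K.≈ η x K.* v y
    act-const-MW x v y = K.trans
      (KSum.sum-cong-≋ λ z → Kτ.eval-congˡ (TModule.hom.const-homo Π x y z) (v z))
      (K.trans (KSum.sum-cong-≋ (λ z → eval-diag y z (v z)))
        (MK.diag-∑ˡ (λ _ → η x) v y))
      where
      eval-diag : ∀ (y z : Fin dim) c → Kτ.eval (MKτ.scalar (Kτ.const (η x)) y z) c K.≈
                  MK.scalar (η x) y z K.* c
      eval-diag y z c with does (y Fin.≟ z)
      ... | true  = Kτ.eval-const (η x) c
      ... | false = K.sym (K.zeroˡ c)

    extension-const : ∀ x v → extension (A.const x MW.*ₗ v) E.≈ᴹ A.const x E.*ₗ extension v
    extension-const x v = ≋⇒∼ {extension (A.const x MW.*ₗ v)} {A.const x E.*ₗ extension v} λ j i → begin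
      Der.δ (extension (A.const x MW.*ₗ v)) A.X j i
        ≈⟨ extension-X (A.const x MW.*ₗ v) j i ⟩
      tabulate (λ k → (A.const x MW.*ₗ v) (index (j , i , k)))
        ≈⟨ SR.tabulate-cong (λ k → act-const-MW x v (index (j , i , k))) ⟩
      tabulate (λ k → η x K.* v (index (j , i , k)))
        ≈⟨ SR.tabulate-⊙ (η x) (λ k → v (index (j , i , k))) ⟩
      Kτ.const (η x) Kτ.* matrix v j i
        ≈⟨ Kτ.*-congˡ {Kτ.const (η x)} (extension-X v j i) ⟨
      Kτ.const (η x) Kτ.* Der.δ (extension v) A.X j i
        ≈⟨ scalar-act Φ Ψ x (Der.δ (extension v) A.X) j i ⟨
      (act Ψ (A.const x) *ᴹ Der.δ (extension v) A.X) j i ∎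
      where open SetoidReasoning Kτ.setoid

    act-X-single : ∀ b c b′ → (A.X MW.*ₗ single (index b) c) (index b′) K.≈ Kτ.eval (column b b′) c
    act-X-single b c b′ = K.trans (sum-single (act Π A.X (index b′)) (index b) c)
      (K.trans (Kτ.eval-congˡ (act-Π-X (index b′) (index b)) c)
        (K.reflexive (≡.cong₂ (λ b b′ → Kτ.eval (column b b′) c) (block-index b) (block-index b′))))

    ψ-single-0 : ∀ b c j i → (∀ k → index (j , i , k) ≢ index b) →
      ψₜ j Kτ.* matrix (single (index b) c) j i Kτ.≈ tabulate {n = r i} (λ _ → K.0#)
    ψ-single-0 b c j i off = begin
      ψₜ j Kτ.* matrix (single (index b) c) j i
        ≈⟨ Kτ.*-congˡ {ψₜ j} (SR.tabulate-cong λ k → K.reflexive (if-no (off k))) ⟩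
      ψₜ j Kτ.* tabulate {n = r i} (λ _ → K.0#)
        ≈⟨ Kτ.*-congˡ {ψₜ j} (SR.tabulate-0 (r i)) ⟩
      ψₜ j Kτ.* []
        ≈⟨ Kτ.zeroʳ (ψₜ j) ⟩
      []
        ≈⟨ SR.tabulate-0 (r i) ⟨
      tabulate {n = r i} (λ _ → K.0#) ∎
      where open SetoidReasoning Kτ.setoid

    -- A one-coordinate vector is a matrix whose only possibly nonzero entry is cτ^k₀. In that entry
    -- the claim is the reduction behind `column`; elsewhere both sides vanish.
    ψ-single : ∀ b c j i → Entry._~_ j i (ψₜ j Kτ.* matrix (single (index b) c) j i)
                                         (tabulate (λ k → Kτ.eval (column b (j , i , k)) c))
    ψ-single (j₀ , i₀ , k₀) c j i with j Fin.≟ j₀ | i Fin.≟ i₀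
    ... | yes ≡.refl | yes ≡.refl = Entry.~-trans j i
      (Entry.≋⇒~ j i (Kτ.*-congˡ {ψₜ j} (Kτ.trans (SR.tabulate-cong (λ k → K.reflexive (single-index k)))
        (SR.tabulate-monomial k₀ c))))
      (proj₁ (proj₂ (Entry.multiply-monomial j i k₀)) c)
      where
      single-index : ∀ k → single (index (j , i , k₀)) c (index (j , i , k)) ≡ single k₀ c k
      single-index k with k Fin.≟ k₀
      ... | yes ≡.refl = if-yes (index (j , i , k₀))
      ... | no k≢k₀    = if-no
        (k≢k₀ ∘ (λ { ≡.refl → ≡.refl }) ∘ index-injective (j , i , k) (j₀ , i₀ , k₀))
    ... | yes _ | no i≢i₀ = Entry.≋⇒~ j i (ψ-single-0 (j₀ , i₀ , k₀) c j i
      λ k → i≢i₀ ∘ ≡.cong (proj₁ ∘ proj₂) ∘ index-injective (j , i , k) (j₀ , i₀ , k₀))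
    ... | no j≢j₀ | _ = Entry.≋⇒~ j i (ψ-single-0 (j₀ , i₀ , k₀) c j i
      λ k → j≢j₀ ∘ ≡.cong proj₁ ∘ index-injective (j , i , k) (j₀ , i₀ , k₀))

    extension-X-single : ∀ b c → extension (A.X MW.*ₗ single (index b) c) E.≈ᴹ
                                 A.X E.*ₗ extension (single (index b) c)
    -- Reduction leads from a product to its remainder, opposite to the direction of the goal; hence
    -- the symmetry.
    extension-X-single b c = E.≈ᴹ-sym {A.X E.*ₗ extension v} {extension (A.X MW.*ₗ v)}
      (~⇒∼ {A.X E.*ₗ extension v} {extension (A.X MW.*ₗ v)} λ j i → Entry.~-trans j i
        (Entry.≋⇒~ j i (Kτ.trans (MKτ.diag-∑ˡ ψₜ (λ k → Der.δ (extension v) A.X k i) j)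
          (Kτ.*-congˡ {ψₜ j} (extension-X v j i))))
        (Entry.~-trans j i (ψ-single b c j i)
          (Entry.≋⇒~ j i (Kτ.sym (Kτ.trans (extension-X (A.X MW.*ₗ v) j i)
            (SR.tabulate-cong λ k → act-X-single b c (j , i , k)))))))
      where
      v : Fin dim → K.Carrier
      v = single (index b) c

    module L = PolynomialProperties.Linearity (fieldRing (Base.𝔽 B)) (MordellWeil Π) (Ext¹ Φ Ψ)
      extension (λ {v} {w} → extension-cong {v} {w}) extension-+ extension-0

    -- t acts additively on K^dim but need not act K-linearly, so basis vectors alone do not
    -- suffice: all their multiples by c in K are tested, and these generate additively.
    extension-*ₗ : ∀ a v → extension (a MW.*ₗ v) E.≈ᴹ a E.*ₗ extension v
    extension-*ₗ = L.linear extension-const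
      (single-induction (L.commutes A.X)
        (λ {v} {w} → L.commutes-resp A.X {v} {w})
        (λ {v} {w} → L.commutes-+ A.X {v} {w})
        (L.commutes-0 A.X)
        (λ y c → ≡.subst (λ y → L.commutes A.X (single y c)) (index-block y)
          (extension-X-single (block y) c)))

    extension-injective : ∀ {v w} → extension v E.≈ᴹ extension w → v MW.≈ᴹ w
    extension-injective {v} {w} p x = ≡.subst (λ x → v x K.≈ w x) (index-block x)
      (Entry.remainder-unique j i (λ k → v (index (j , i , k))) (λ k → w (index (j , i , k)))
        (Entry.~-trans j i (Entry.≋⇒~ j i (Kτ.sym (extension-X v j i)))
          (Entry.~-trans j i (∼⇒~ {extension v} {extension w} p j i)
            (Entry.≋⇒~ j i (extension-X w j i)))) k)
      where
      j = proj₁ (block x)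
      i = proj₁ (proj₂ (block x))
      k = proj₂ (proj₂ (block x))

    extension-surjective : ∀ D → ∃[ v ] extension v E.≈ᴹ D
    extension-surjective D = v , E.≈ᴹ-sym {D} {extension v} (~⇒∼ {D} {extension v} λ j i →
      Entry.~-trans j i (proj₂ (Entry.divide j i (Der.δ D A.X j i)))
        (Entry.≋⇒~ j i (Kτ.sym (Kτ.trans (extension-X v j i)
          (SR.tabulate-cong λ k → K.reflexive (≡.cong coordinate (block-index (j , i , k))))))))
      where
      coordinate : Block → K.Carrier
      coordinate (j , i , k) = proj₁ (Entry.divide j i (Der.δ D A.X j i)) k
      v : Fin dim → K.Carrier
      v = coordinate ∘ block

    extension-isIsomorphism : MordellWeil Π ≅ Ext¹ Φ Ψ
    extension-isIsomorphism = extension , record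
      { isLeftModuleMonomorphism = record
        { isLeftModuleHomomorphism = record
          { +ᴹ-isGroupHomomorphism = record
            { isMonoidHomomorphism = record
              { isMagmaHomomorphism = record
                { isRelHomomorphism = record { cong = λ {v} {w} → extension-cong {v} {w} }
                ; homo = extension-+ }
              ; ε-homo = extension-0 }
            ; ⁻¹-homo = λ v → GroupProperties.inverseˡ-unique (AbelianGroup.group E.+ᴹ-abelianGroup)
                (extension (MW.-ᴹ v)) (extension v)
                (E.≈ᴹ-trans {extension (MW.-ᴹ v) E.+ᴹ extension v} {extension MW.0ᴹ} {E.0ᴹ}
                  (E.≈ᴹ-trans {extension (MW.-ᴹ v) E.+ᴹ extension v}
                    {extension (MW.-ᴹ v MW.+ᴹ v)} {extension MW.0ᴹ}
                    (E.≈ᴹ-sym {extension (MW.-ᴹ v MW.+ᴹ v)} {extension (MW.-ᴹ v) E.+ᴹ extension v}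
                      (extension-+ (MW.-ᴹ v) v))
                    (extension-cong {MW.-ᴹ v MW.+ᴹ v} {MW.0ᴹ} (λ x → K.-‿inverseˡ (v x))))
                  extension-0) }
          ; *ₗ-homo = extension-*ₗ }
        ; injective = λ {v} {w} → extension-injective {v} {w} }
      ; surjective = λ D → let v , p = extension-surjective D in
          v , λ {w} q → E.≈ᴹ-trans {extension w} {extension v} {D} (extension-cong {w} {v} q) p }

theorem6p1 : ∀ {c ℓ₁ ℓ₂ c′ ℓ₁′ ℓ₂′} (B : Base c ℓ₁ ℓ₂ c′ ℓ₁′ ℓ₂′) → let open TModules B in
    (n m : ℕ) → .{{_ : NonZero n}} → .{{_ : NonZero m}} →
    (φ : Fin n → DrinfeldModule) (ψ : Fin m → DrinfeldModule)
    (r : Fin n → ℕ) (s : Fin m → ℕ) →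
    (∀ i → HasRank (φ i) (r i)) → (∀ j → HasRank (ψ j) (s j)) →
    (∀ i j → s j < r i) →
    ∃[ Π ] MordellWeil {m * sumℕ r} Π ≅ Ext¹ (∏ φ) (∏ ψ)
theorem6p1 B n m φ ψ r s φ-rank ψ-rank s<r = Π , extension-isIsomorphism
  where open ExtensionModule.Extensions B n m φ ψ r s φ-rank ψ-rank s<r
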